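{- There exists a parallel algorithm that solves the single-source shortest paths problem on a graph $G=(V,E)$ with positive edge weights and source $s$ using $O(|E|\log|V|)$ work and $O(\overline{\mathrm{rank}}(V)\log|V|)$ span, where $\overline{\mathrm{rank}}(V)=\dfrac{\max_{v\in V}d(v)}{\min_{e\in E}w(e)}$.
   Context: Here $w(e)>0$ is the weight of edge $e$ and $d(v)$ is the shortest-path distance from the source $s$ to $v$; every vertex is assumed reachable from $s$ and $|V|\ge 2$. The single-source shortest paths problem asks for $d(v)$ for all $v\in V$. Model: work-span binary-forking model. Threads share memory and run standard RAM instructions and a fork instruction that creates two child threads (the parent is suspended until both terminate), together with the atomic test-and-set. Work is the total number of instructions; span is the length of the longest chain of dependent instructions. -}

module Defs where

open import Algebra.Bundles using (CommutativeRing)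
open import Algebra.Structures using (IsCommutativeRing)
import Algebra.Definitions.RawMonoid as RawMonoidDefinitions
open import Data.Fin.Base using (Fin; toℕ)
open import Data.Fin.Permutation using (Permutation′; _⟨$⟩ʳ_)
open import Data.List.Base using (List; []; _∷_; _++_; applyUpTo; drop; head; tabulate)
open import Data.Maybe.Base using (fromMaybe)
open import Data.Nat.Base as ℕ using (ℕ; zero; _∸_; _^_; _/_; _%_)
open import Data.Nat.Properties as ℕ using (m^n≢0)
open import Data.Product.Base using (∃-syntax; _×_)
open import Function.Base using (_∘_)
open import Level using (Level)
open import Relation.Binary.Core using (Rel)
import Relation.Binary.Construct.NonStrictToStrict as ToStrict
open import Relation.Binary.PropositionalEquality.Core using (_≡_)
open import Relation.Binary.Structures using (IsDecTotalOrder)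
open import Relation.Nullary.Decidable.Core using (does)
open import Relation.Nullary.Negation.Core using (¬_)
open import Data.Bool.Base using (if_then_else_)

private
  variable
    c ℓ₁ ℓ₂ : Level

-- Weights range over an arbitrary ordered field; the reals are the intended
-- example.  The order is decidable because comparing two weights is a machine
-- instruction below.
record OrderedField (c ℓ₁ ℓ₂ : Level) : Set (Level.suc (c Level.⊔ ℓ₁ Level.⊔ ℓ₂)) where
  infix  8 _⁻¹
  infixl 7 _*_
  infixl 6 _+_
  infix  4 _≈_ _≤_
  field
    Carrier           : Set c
    _≈_               : Rel Carrier ℓ₁
    _≤_               : Rel Carrier ℓ₂
    _+_ _*_           : Carrier → Carrier → Carrier
    -_                : Carrier → Carrier
    0# 1#             : Carrier
    _⁻¹               : Carrier → Carrier
    isCommutativeRing : IsCommutativeRing _≈_ _+_ _*_ -_ 0# 1#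
    isDecTotalOrder   : IsDecTotalOrder _≈_ _≤_
    1≉0               : ¬ (1# ≈ 0#)
    -- The value of 0# ⁻¹ is unspecified.
    *-inverseʳ        : ∀ x → ¬ (x ≈ 0#) → x * x ⁻¹ ≈ 1#
    +-monoˡ-≤         : ∀ z {x y} → x ≤ y → x + z ≤ y + z
    *-nonNegative     : ∀ {x y} → 0# ≤ x → 0# ≤ y → 0# ≤ x * y

  commutativeRing : CommutativeRing c ℓ₁
  commutativeRing = record { isCommutativeRing = isCommutativeRing }

  open IsDecTotalOrder isDecTotalOrder public using (_≤?_)
  open ToStrict _≈_ _≤_ public using (_<_)

  fromℕ : ℕ → Carrier
  fromℕ n = n · 1#
    where
    open RawMonoidDefinitions (CommutativeRing.+-rawMonoid commutativeRing)
      renaming (_×_ to _·_)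

  -- x is the maximum (minimum) of the values of f.
  IsMaximum IsMinimum : ∀ {a} {A : Set a} → (A → Carrier) → Carrier → Set _
  IsMaximum f x = (∃[ i ] f i ≈ x) × (∀ i → f i ≤ x)
  IsMinimum f x = (∃[ i ] f i ≈ x) × (∀ i → x ≤ f i)

-- Finite simple directed graphs with positive edge weights.  An undirected
-- graph is given by both orientations of each of its edges.
record Graph (K : OrderedField c ℓ₁ ℓ₂) : Set (c Level.⊔ ℓ₁ Level.⊔ ℓ₂) where
  open OrderedField K
  field
    ∣V∣ ∣E∣ : ℕ

  V : Set
  V = Fin ∣V∣

  E : Set
  E = Fin ∣E∣

  field
    source target : E → V
    simple        : ∀ {e f} → source e ≡ source f → target e ≡ target f → e ≡ f
    weight        : E → Carrier
    positive      : ∀ e → 0# < weight e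

module _ {K : OrderedField c ℓ₁ ℓ₂} (G : Graph K) where
  open OrderedField K
  open Graph G

  data Walk : V → V → Carrier → Set c where
    []  : ∀ {v} → Walk v v 0#
    _∷_ : ∀ e {v x} → Walk (target e) v x → Walk (source e) v (weight e + x)

  Reachable : V → V → Set c
  Reachable s v = ∃[ x ] Walk s v x

  IsDistance : V → V → Carrier → Set (c Level.⊔ ℓ₁ Level.⊔ ℓ₂)
  IsDistance s v d = (∃[ x ] (Walk s v x × x ≈ d)) × (∀ {x} → Walk s v x → d ≤ x)

  -- r = max_v d(v) / min_e w(e), where d gives the distances from the source.
  IsRelaxedRank : (V → Carrier) → Carrier → Set (c Level.⊔ ℓ₁ Level.⊔ ℓ₂)
  IsRelaxedRank d r =
    ∃[ D ] ∃[ w ] (IsMaximum d D × IsMinimum weight w × r ≈ D * w ⁻¹)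

  -- Compressed adjacency lists: the edges leaving v are, in some order, the
  -- edges at positions j with offset v ≤ j < offset (v + 1).
  record AdjacencyArray : Set where
    field
      offset : ℕ → ℕ
      edges  : Permutation′ ∣E∣

    edgeAt : Fin ∣E∣ → E
    edgeAt j = edges ⟨$⟩ʳ j

    field
      offset-first    : offset 0 ≡ 0
      offset-last     : offset ∣V∣ ≡ ∣E∣
      offset-monotone : ∀ (v : V) → offset (toℕ v) ℕ.≤ offset (ℕ.suc (toℕ v))
      edgeAt-source   : ∀ j → let v = toℕ (source (edgeAt j)) in
                        offset v ℕ.≤ toℕ j × toℕ j ℕ.< offset (ℕ.suc v)

-- A thread has word registers and weight registers, each named by a number;
-- a program mentions only finitely many of them.  Shared memory likewise
-- consists of word cells and weight cells, both addressed by words.  The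
-- superscript ᵂ marks the operations on weights.
Register Label : Set
Register = ℕ
Label    = ℕ

data WordOp : Set where
  add sub mul div : WordOp

data WeightOp : Set where
  add sub : WeightOp

data Instruction : Set where
  const    : (dst : Register) → ℕ → Instruction
  word     : WordOp → (dst x y : Register) → Instruction
  load     : (dst address : Register) → Instruction
  store    : (address src : Register) → Instruction
  -- dst receives the old content of the cell, which becomes 1.
  test&set : (dst address : Register) → Instruction
  weight   : WeightOp → (dst x y : Register) → Instruction
  loadᵂ    : (dst address : Register) → Instruction
  storeᵂ   : (address src : Register) → Instruction
  -- The conditional jumps are taken if x ≤ y.
  jump     : Label → Instruction
  jump≤    : (x y : Register) → Label → Instruction
  jump≤ᵂ   : (x y : Register) → Label → Instruction
  fork     : (left right : Label) → Instruction
  halt     : Instruction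

Program : Set
Program = List Instruction

nth : ∀ {a} {A : Set a} → A → List A → ℕ → A
nth default xs i = fromMaybe default (head (drop i xs))

_[_≔_] : ∀ {a} {A : Set a} → (ℕ → A) → ℕ → A → ℕ → A
(f [ i ≔ x ]) j = if does (j ℕ.≟ i) then x else f j

-- The binary-forking machine whose words have the given number of bits.
module Machine (K : OrderedField c ℓ₁ ℓ₂) (bits : ℕ) (program : Program) where
  open OrderedField K

  truncate : ℕ → ℕ
  truncate x = (x % 2 ^ bits) {{m^n≢0 2 bits}}

  ⟦_⟧ : WordOp → ℕ → ℕ → ℕ
  ⟦ add ⟧ x y         = truncate (x ℕ.+ y)
  ⟦ sub ⟧ x y         = x ∸ y
  ⟦ mul ⟧ x y         = truncate (x ℕ.* y)
  ⟦ div ⟧ x zero      = 0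
  ⟦ div ⟧ x (ℕ.suc y) = x / ℕ.suc y

  ⟦_⟧ᵂ : WeightOp → Carrier → Carrier → Carrier
  ⟦ add ⟧ᵂ x y = x + y
  ⟦ sub ⟧ᵂ x y = x + (- y)

  record Memory : Set c where
    constructor memory
    field
      words   : ℕ → ℕ
      weights : ℕ → Carrier

  record Thread : Set c where
    constructor thread
    field
      pc   : Label
      reg  : Register → ℕ
      regᵂ : Register → Carrier

  data Outcome : Set c where
    continue : Thread → Memory → Outcome
    spawn    : (left right parent : Thread) → Outcome
    stop     : Outcome

  -- The children of a fork start with copies of the registers of the parent,
  -- which later resumes with its own registers.
  execute : Instruction → Thread → Memory → Outcome
  execute i (thread pc reg regᵂ) M@(memory words weights) = outcome i
    where
    next : Label
    next = ℕ.suc pc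

    outcome : Instruction → Outcome
    outcome (const r n)      = continue (thread next (reg [ r ≔ truncate n ]) regᵂ) M
    outcome (word o r x y)   = continue (thread next (reg [ r ≔ ⟦ o ⟧ (reg x) (reg y) ]) regᵂ) M
    outcome (load r a)       = continue (thread next (reg [ r ≔ words (reg a) ]) regᵂ) M
    outcome (store a r)      = continue (thread next reg regᵂ) (memory (words [ reg a ≔ reg r ]) weights)
    outcome (test&set r a)   = continue (thread next (reg [ r ≔ words (reg a) ]) regᵂ)
                                        (memory (words [ reg a ≔ 1 ]) weights)
    outcome (weight o r x y) = continue (thread next reg (regᵂ [ r ≔ ⟦ o ⟧ᵂ (regᵂ x) (regᵂ y) ])) M
    outcome (loadᵂ r a)      = continue (thread next reg (regᵂ [ r ≔ weights (reg a) ])) M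
    outcome (storeᵂ a r)     = continue (thread next reg regᵂ) (memory words (weights [ reg a ≔ regᵂ r ]))
    outcome (jump l)         = continue (thread l reg regᵂ) M
    outcome (jump≤ x y l)    = continue (thread (if does (reg x ℕ.≤? reg y) then l else next) reg regᵂ) M
    outcome (jump≤ᵂ x y l)   = continue (thread (if does (regᵂ x ≤? regᵂ y) then l else next) reg regᵂ) M
    outcome (fork l r)       = spawn (thread l reg regᵂ) (thread r reg regᵂ) (thread next reg regᵂ)
    outcome halt             = stop

  run : Thread → Memory → Outcome
  run t = execute (nth halt program (Thread.pc t)) t

  -- The number attached to an active or ended thread is the length of the
  -- longest chain of dependent instructions ending with its latest one.
  data Task : Set c where
    active  : ℕ → Thread → Task
    blocked : (parent : Thread) (left right : Task) → Task
    ended   : ℕ → Task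

  -- A task, the shared memory, and the number of instructions executed so far.
  record Configuration : Set c where
    constructor ⟨_,_,_⟩
    field
      task   : Task
      shared : Memory
      work   : ℕ

  -- Any active thread may execute its next instruction, atomically, so the
  -- executions are the arbitrary interleavings of the threads.
  infix 3 _⟶_
  data _⟶_ : Configuration → Configuration → Set c where
    continue : ∀ {k t M n t′ M′} → run t M ≡ continue t′ M′ →
               ⟨ active k t , M , n ⟩ ⟶ ⟨ active (ℕ.suc k) t′ , M′ , ℕ.suc n ⟩
    spawn    : ∀ {k t M n l r p} → run t M ≡ spawn l r p →
               ⟨ active k t , M , n ⟩ ⟶
               ⟨ blocked p (active (ℕ.suc k) l) (active (ℕ.suc k) r) , M , ℕ.suc n ⟩
    stop     : ∀ {k t M n} → run t M ≡ stop →
               ⟨ active k t , M , n ⟩ ⟶ ⟨ ended (ℕ.suc k) , M , ℕ.suc n ⟩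
    left     : ∀ {p l r M n l′ M′ n′} → ⟨ l , M , n ⟩ ⟶ ⟨ l′ , M′ , n′ ⟩ →
               ⟨ blocked p l r , M , n ⟩ ⟶ ⟨ blocked p l′ r , M′ , n′ ⟩
    right    : ∀ {p l r M n r′ M′ n′} → ⟨ r , M , n ⟩ ⟶ ⟨ r′ , M′ , n′ ⟩ →
               ⟨ blocked p l r , M , n ⟩ ⟶ ⟨ blocked p l r′ , M′ , n′ ⟩
    -- The parent resumes; this is not an instruction.
    join     : ∀ {p j k M n} →
               ⟨ blocked p (ended j) (ended k) , M , n ⟩ ⟶ ⟨ active (j ℕ.⊔ k) p , M , n ⟩

  -- Every maximal execution from the given configuration is finite and ends
  -- with the root thread terminated and Post span work memory.
  data EveryExecution {p} (Post : ℕ → ℕ → Memory → Set p) : Configuration → Set (c Level.⊔ p) where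
    finished : ∀ {k M n} → Post k n M → EveryExecution Post ⟨ ended k , M , n ⟩
    step     : ∀ {C} → ∃[ C′ ] (C ⟶ C′) → (∀ {C′} → C ⟶ C′ → EveryExecution Post C′) →
               EveryExecution Post C

  start : Memory → Configuration
  start M = ⟨ active 0 (thread 0 (λ _ → 0) (λ _ → 0#)) , M , 0 ⟩

  -- The words are |V|, |E|, the source, the |V| + 1 offsets and the targets
  -- of the edges; all remaining cells are zero.
  input : (G : Graph K) → AdjacencyArray G → Graph.V G → Memory
  input G A s = memory
    (nth 0 (∣V∣ ∷ ∣E∣ ∷ toℕ s ∷ applyUpTo offset (ℕ.suc ∣V∣) ++ tabulate (toℕ ∘ target ∘ edgeAt)))
    (nth 0# (tabulate (Graph.weight G ∘ edgeAt)))
    where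
    open Graph G hiding (weight)
    open AdjacencyArray A

  -- The distances are delivered in the weight cells following the input.
  output : (G : Graph K) → Memory → Graph.V G → Carrier
  output G M v = Memory.weights M (Graph.∣E∣ G ℕ.+ toℕ v)

-- Dijkstra's algorithm in phases.  Let t be the least tentative distance of an
-- unsettled vertex and w the least edge weight.  A tentative distance of at
-- most t + w is final: a shorter walk would lead through another unsettled
-- vertex, at distance at least t, and then along one more edge.  So all these
-- vertices are settled at once, t grows by at least w, and there are at most
-- max d / w phases.
--
-- The queue is a tournament tree whose leaves are the edges, grouped by target,
-- so that simultaneous relaxations towards the same vertex write to different
-- cells.  A phase first descends from the root to the vertices to be settled;
-- each of these writes the leaves of its outgoing edges and marks the nodes
-- above them.  Then the marked nodes are recomputed bottom-up.  Each settled
-- vertex and each relaxed edge costs O(log |V|) work, each phase O(log |V|) span.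
--
-- The only race is that several threads set the same mark.  Hence all
-- interleavings have the same effect, work and span as the execution that runs
-- the left child of every fork before the right one, and it suffices to verify
-- that sequential execution together with a log of its memory accesses.
module Submission where

open import Defs
open import Algebra.Bundles using (CommutativeRing)
import Algebra.Properties.Ring as RingProperties
open import Data.Bool.Base using (if_then_else_)
open import Data.Empty using (⊥; ⊥-elim)
open import Data.Fin.Base as Fin using (Fin; fromℕ<; toℕ)
open import Data.Fin.Permutation using (_⟨$⟩ˡ_; inverseʳ)
import Data.Fin.Properties as Fin
open import Data.List.Base as List using (List; []; _++_; _∷_; applyUpTo; length; tabulate)
open import Data.List.Membership.Propositional using (_∈_)
open import Data.List.Membership.Propositional.Properties using (∈-++⁺ʳ; ∈-++⁺ˡ; ∈-++⁻)
import Data.List.Properties as List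
open import Data.List.Relation.Binary.Subset.Propositional using (_⊆_)
open import Data.List.Relation.Unary.All as All using (All; []; _∷_)
import Data.List.Relation.Unary.All.Properties as All
open import Data.List.Relation.Unary.Any using (here; there)
open import Data.Nat.Base as ℕ using (_^_; suc; s≤s; zero; z≤n; ℕ)
import Data.Nat.DivMod as ℕ
open import Data.Nat.Divisibility using (divides)
open import Data.Nat.Induction using (<-rec; <-wellFounded)
open import Data.Nat.Logarithm using (⌈log₂2^n⌉≡n; ⌈log₂_⌉; ⌈log₂⌈n/2⌉⌉≡⌈log₂n⌉∸1; ⌈log₂⌉-mono-≤)
import Data.Nat.Properties as ℕ
open import Data.Nat.Tactic.RingSolver using (solve-∀)
open import Data.Product.Base using (_,_; _×_; proj₁; proj₂; Σ; ∃-syntax)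
open import Data.Sum.Base using ([_,_]′; _⊎_; inj₁; inj₂)
open import Function.Base using (_$_; _∘_; case_of_; id)
open import Induction.WellFounded using (Acc; acc)
open import Level using (Level)
open import Relation.Binary.PropositionalEquality
open import Relation.Binary.Structures using (module IsDecTotalOrder)
open import Relation.Nullary using (Dec; does; no; yes; ¬_)
open import Relation.Nullary.Decidable using (dec-false; dec-true; decidable-stable; ¬?)

-- Interleaved executions

module Interleaving {c ℓ₁ ℓ₂} (K : OrderedField c ℓ₁ ℓ₂) (bits : ℕ) (program : Program) where
  open OrderedField K using (Carrier)
  open Machine K bits program

  data Cell : Set where
    wordCell weightCell : ℕ → Cell

  data Content : Cell → Set c where
    word   : ∀ {a} → ℕ → Content (wordCell a)
    weight : ∀ {a} → Carrier → Content (weightCell a)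

  get : Memory → ∀ x → Content x
  get M (wordCell a)   = word (Memory.words M a)
  get M (weightCell a) = weight (Memory.weights M a)

  set : ∀ x → Content x → Memory → Memory
  set (wordCell a)   (word v)   (memory ws wts) = memory (ws [ a ≔ v ]) wts
  set (weightCell a) (weight v) (memory ws wts) = memory ws (wts [ a ≔ v ])

  _≟ᶜ_ : (x y : Cell) → Dec (x ≡ y)
  wordCell a ≟ᶜ wordCell b with a ℕ.≟ b
  ... | yes refl = yes refl
  ... | no a≢b   = no λ where refl → a≢b refl
  wordCell a ≟ᶜ weightCell b = no λ ()
  weightCell a ≟ᶜ wordCell b = no λ ()
  weightCell a ≟ᶜ weightCell b with a ℕ.≟ b
  ... | yes refl = yes refl
  ... | no a≢b   = no λ where refl → a≢b refl

  get-set-same : ∀ x v M → get (set x v M) x ≡ v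
  get-set-same (wordCell a) (word v) M rewrite dec-true (a ℕ.≟ a) refl = refl
  get-set-same (weightCell a) (weight v) M rewrite dec-true (a ℕ.≟ a) refl = refl

  get-set-other : ∀ {x y} v M → x ≢ y → get (set x v M) y ≡ get M y
  get-set-other {wordCell a} {wordCell b} (word v) M x≢y
    rewrite dec-false (b ℕ.≟ a) (λ where refl → x≢y refl) = refl
  get-set-other {wordCell a} {weightCell b} (word v) M x≢y = refl
  get-set-other {weightCell a} {wordCell b} (weight v) M x≢y = refl
  get-set-other {weightCell a} {weightCell b} (weight v) M x≢y
    rewrite dec-false (b ℕ.≟ a) (λ where refl → x≢y refl) = refl

  data Access : Set c where
    read  : Cell → Access
    write : ∀ x → Content x → Access

  Log : Set c
  Log = List Access

  perform : Access → Memory → Memory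
  perform (read x)    M = M
  perform (write x v) M = set x v M

  apply : Log → Memory → Memory
  apply []      M = M
  apply (e ∷ l) M = apply l (perform e M)

  apply-++ : ∀ l l′ M → apply (l ++ l′) M ≡ apply l′ (apply l M)
  apply-++ []      l′ M = refl
  apply-++ (e ∷ l) l′ M = apply-++ l l′ (perform e M)

  infix 4 _≗ᴹ_
  _≗ᴹ_ : Memory → Memory → Set c
  M ≗ᴹ M′ = ∀ x → get M x ≡ get M′ x

  get-set-cong : ∀ x v {M M′} y → get M y ≡ get M′ y → get (set x v M) y ≡ get (set x v M′) y
  get-set-cong x v {M} {M′} y eq with x ≟ᶜ y
  ... | yes refl = trans (get-set-same x v M) (sym (get-set-same x v M′))
  ... | no x≢y   = trans (get-set-other v M x≢y) (trans eq (sym (get-set-other v M′ x≢y)))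

  get-perform-cong : ∀ e {M M′} y → get M y ≡ get M′ y → get (perform e M) y ≡ get (perform e M′) y
  get-perform-cong (read x)    y eq = eq
  get-perform-cong (write x v) y eq = get-set-cong x v y eq

  get-apply-cong : ∀ l {M M′} y → get M y ≡ get M′ y → get (apply l M) y ≡ get (apply l M′) y
  get-apply-cong []      y eq = eq
  get-apply-cong (e ∷ l) y eq = get-apply-cong l y (get-perform-cong e y eq)

  get-apply-other : ∀ l M {x} → (∀ v → ¬ write x v ∈ l) → get (apply l M) x ≡ get M x
  get-apply-other []      M ∉l = refl
  get-apply-other (read y ∷ l) M ∉l = get-apply-other l M λ v → ∉l v ∘ there
  get-apply-other (write y v ∷ l) M {x} ∉l =
    trans (get-apply-other l (set y v M) λ v → ∉l v ∘ there)
          (get-set-other v M λ where refl → ∉l v (here refl))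

  get-apply-write : ∀ l M {x v} → write x v ∈ l → (∀ {v′} → write x v′ ∈ l → v′ ≡ v) → get (apply l M) x ≡ v
  get-apply-write (e ∷ l) M {x} {v} w unique = go l (perform e M) w
    where
    still : ∀ l M → (∀ {v′} → write x v′ ∈ l → v′ ≡ v) → get M x ≡ v → get (apply l M) x ≡ v
    still []      M uniq eq = eq
    still (read y ∷ l) M uniq eq = still l M (uniq ∘ there) eq
    still (write y u ∷ l) M uniq eq with y ≟ᶜ x
    ... | yes refl = still l _ (uniq ∘ there) (trans (get-set-same y u M) (uniq (here refl)))
    ... | no y≢x   = still l _ (uniq ∘ there) (trans (get-set-other u M y≢x) eq)
    go : ∀ l′ M′ → write x v ∈ e ∷ l → get (apply l (perform e M)) x ≡ v
    go l′ M′ (here refl) = still l _ (unique ∘ there) (get-set-same x v M)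
    go l′ M′ (there w′)  = get-apply-write l (perform e M) w′ (unique ∘ there)

  data Independent : Access → Access → Set c where
    read-read   : ∀ {x y} → Independent (read x) (read y)
    read-write  : ∀ {x y v} → x ≢ y → Independent (read x) (write y v)
    write-read  : ∀ {x y v} → x ≢ y → Independent (write x v) (read y)
    write-write : ∀ {x y v w} → x ≢ y → Independent (write x v) (write y w)
    same-write  : ∀ {x v} → Independent (write x v) (write x v)

  Compatible : Log → Log → Set c
  Compatible l l′ = ∀ {e e′} → e ∈ l → e′ ∈ l′ → Independent e e′

  Independent-sym : ∀ {e e′} → Independent e e′ → Independent e′ e
  Independent-sym read-read         = read-read
  Independent-sym (read-write x≢y)  = write-read (x≢y ∘ sym)
  Independent-sym (write-read x≢y)  = read-write (x≢y ∘ sym)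
  Independent-sym (write-write x≢y) = write-write (x≢y ∘ sym)
  Independent-sym same-write        = same-write

  perform-comm : ∀ {e e′} → Independent e e′ → ∀ M →
                 perform e′ (perform e M) ≗ᴹ perform e (perform e′ M)
  perform-comm read-read        M z = refl
  perform-comm (read-write _)   M z = refl
  perform-comm (write-read _)   M z = refl
  perform-comm same-write       M z = refl
  perform-comm (write-write {x} {y} {v} {w} x≢y) M z with y ≟ᶜ z
  ... | yes refl = trans (get-set-same y w (set x v M))
                         (sym (trans (get-set-other v (set y w M) x≢y) (get-set-same y w M)))
  ... | no y≢z   = trans (get-set-other w (set x v M) y≢z)
                         (get-set-cong x v z (sym (get-set-other w M y≢z)))

  apply-perform-comm : ∀ e l → (∀ {e′} → e′ ∈ l → Independent e e′) → ∀ M →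
                       apply l (perform e M) ≗ᴹ perform e (apply l M)
  apply-perform-comm e []       ind M z = refl
  apply-perform-comm e (e′ ∷ l) ind M z =
    trans (get-apply-cong l z (perform-comm (ind (here refl)) M z))
          (apply-perform-comm e l (ind ∘ there) (perform e′ M) z)

  apply-comm : ∀ l l′ → Compatible l l′ → ∀ M → apply l′ (apply l M) ≗ᴹ apply l (apply l′ M)
  apply-comm []      l′ ind M z = refl
  apply-comm (e ∷ l) l′ ind M z =
    trans (apply-comm l l′ (ind ∘ there) (perform e M) z)
          (get-apply-cong l z (apply-perform-comm e l′ (ind (here refl)) M z))

  -- The left child of a fork is run to completion before the right one.
  data Eval : Thread → Memory → Log → (work span : ℕ) → Set c where
    halt   : ∀ {t M} → (∀ M′ → run t M′ ≡ stop) → Eval t M [] 1 1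
    silent : ∀ {t t′ M l w s} → (∀ M′ → run t M′ ≡ continue t′ M′) →
             Eval t′ M l w s → Eval t M l (suc w) (suc s)
    load   : ∀ {t M l w s} x (f : Content x → Thread) →
             (∀ M′ → run t M′ ≡ continue (f (get M′ x)) M′) →
             Eval (f (get M x)) M l w s → Eval t M (read x ∷ l) (suc w) (suc s)
    store  : ∀ {t t′ M l w s} x v → (∀ M′ → run t M′ ≡ continue t′ (set x v M′)) →
             Eval t′ (set x v M) l w s → Eval t M (write x v ∷ l) (suc w) (suc s)
    fork   : ∀ {t l r p M l₁ l₂ l₃ w₁ w₂ w₃ s₁ s₂ s₃} → (∀ M′ → run t M′ ≡ spawn l r p) →
             Eval l M l₁ w₁ s₁ → Eval r (apply l₁ M) l₂ w₂ s₂ → Compatible l₁ l₂ →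
             Eval p (apply l₂ (apply l₁ M)) l₃ w₃ s₃ →
             Eval t M (l₁ ++ l₂ ++ l₃) (suc (w₁ ℕ.+ w₂ ℕ.+ w₃)) (suc (s₁ ℕ.⊔ s₂ ℕ.+ s₃))

  length≤work : ∀ {t M l w s} → Eval t M l w s → length l ℕ.≤ w
  length≤work (halt _)        = z≤n
  length≤work (silent _ e)    = ℕ.m≤n⇒m≤1+n (length≤work e)
  length≤work (load _ _ _ e)  = s≤s (length≤work e)
  length≤work (store _ _ _ e) = s≤s (length≤work e)
  length≤work (fork {l₁ = l₁} {l₂} {l₃} {w₁} {w₂} {w₃} _ e₁ e₂ _ e₃) = begin
    length (l₁ ++ l₂ ++ l₃)                       ≡⟨ List.length-++ l₁ ⟩
    length l₁ ℕ.+ length (l₂ ++ l₃)               ≡⟨ cong (length l₁ ℕ.+_) (List.length-++ l₂) ⟩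
    length l₁ ℕ.+ (length l₂ ℕ.+ length l₃)       ≤⟨ ℕ.+-mono-≤ (length≤work e₁) (ℕ.+-mono-≤ (length≤work e₂) (length≤work e₃)) ⟩
    w₁ ℕ.+ (w₂ ℕ.+ w₃)                            ≡⟨ ℕ.+-assoc w₁ w₂ w₃ ⟨
    w₁ ℕ.+ w₂ ℕ.+ w₃                              ≤⟨ ℕ.n≤1+n _ ⟩
    suc (w₁ ℕ.+ w₂ ℕ.+ w₃)                        ∎
    where open ℕ.≤-Reasoning

  AgreeOnReads : Log → Memory → Memory → Set c
  AgreeOnReads l M M′ = ∀ {x} → read x ∈ l → get M x ≡ get M′ x

  Eval-cong : ∀ {t M M′ l w s} → AgreeOnReads l M M′ → Eval t M l w s → Eval t M′ l w s
  Eval-cong agree (halt eq) = halt eq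
  Eval-cong agree (silent eq e) = silent eq (Eval-cong agree e)
  Eval-cong {M = M} {M′} agree (load x f eq e) =
    load x f eq (subst (λ v → Eval (f v) M′ _ _ _) (agree (here refl)) (Eval-cong (agree ∘ there) e))
  Eval-cong agree (store x v eq e) = store x v eq (Eval-cong (λ {y} r → get-set-cong x v y (agree (there r))) e)
  Eval-cong agree (fork {l₁ = l₁} {l₂} eq e₁ e₂ comp e₃) =
    fork eq (Eval-cong (agree ∘ ∈-++⁺ˡ) e₁)
            (Eval-cong (λ {y} r → get-apply-cong l₁ y (agree (∈-++⁺ʳ l₁ (∈-++⁺ˡ r)))) e₂)
            comp
            (Eval-cong (λ {y} r → get-apply-cong l₂ y (get-apply-cong l₁ y (agree (∈-++⁺ʳ l₁ (∈-++⁺ʳ l₂ r))))) e₃)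

  data EvalTask : Task → Memory → Log → (work span : ℕ) → Set c where
    active  : ∀ {k t M l w s} → Eval t M l w s → EvalTask (active k t) M l w (k ℕ.+ s)
    ended   : ∀ {k M} → EvalTask (ended k) M [] 0 k
    blocked : ∀ {l r p M l₁ l₂ l₃ w₁ w₂ w₃ s₁ s₂ s₃} →
              EvalTask l M l₁ w₁ s₁ → EvalTask r M l₂ w₂ s₂ → Compatible l₁ l₂ →
              Eval p (apply l₂ (apply l₁ M)) l₃ w₃ s₃ →
              EvalTask (blocked p l r) M (l₁ ++ l₂ ++ l₃) (w₁ ℕ.+ w₂ ℕ.+ w₃) (s₁ ℕ.⊔ s₂ ℕ.+ s₃)

  EvalTask-cong : ∀ {T M M′ l w s} → AgreeOnReads l M M′ → EvalTask T M l w s → EvalTask T M′ l w s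
  EvalTask-cong agree (active e) = active (Eval-cong agree e)
  EvalTask-cong agree ended = ended
  EvalTask-cong agree (blocked {l₁ = l₁} {l₂} e₁ e₂ comp e₃) =
    blocked (EvalTask-cong (agree ∘ ∈-++⁺ˡ) e₁)
            (EvalTask-cong (agree ∘ ∈-++⁺ʳ l₁ ∘ ∈-++⁺ˡ) e₂)
            comp
            (Eval-cong (λ {y} r → get-apply-cong l₂ y (get-apply-cong l₁ y (agree (∈-++⁺ʳ l₁ (∈-++⁺ʳ l₂ r))))) e₃)

  Compatible⇒AgreeOnReads : ∀ {l l′} → Compatible l l′ → ∀ M → AgreeOnReads l′ (apply l M) M
  Compatible⇒AgreeOnReads {l} {l′} comp M r = get-apply-other l M λ v w → conflict (comp w r)
    where
    conflict : ∀ {x v} → ¬ Independent (write x v) (read x)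
    conflict (write-read x≢x) = x≢x refl

  -- A fork consumes one instruction and creates one blocked task; a join
  -- removes a blocked task without executing an instruction.
  joins : Task → ℕ
  joins (active _ _)    = 0
  joins (ended _)       = 0
  joins (blocked _ l r) = suc (joins l ℕ.+ joins r)

  measure : Task → ℕ → ℕ
  measure T w = joins T ℕ.+ 2 ℕ.* w

  record Progress (T T′ : Task) (M M′ : Memory) (n n′ : ℕ) (l : Log) (w s : ℕ) : Set c where
    field
      {log′}    : Log
      {w′}      : ℕ
      eval′     : EvalTask T′ M′ log′ w′ s
      log′⊆     : log′ ⊆ l
      pre       : Log
      pre⊆      : pre ⊆ l
      effect    : M′ ≡ apply pre M
      final     : apply log′ M′ ≗ᴹ apply l M
      work      : n′ ℕ.+ w′ ≡ n ℕ.+ w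
      decreases : measure T′ w′ ℕ.< measure T w

  ++-⊆ˡ : ∀ {l l′ r : Log} → l ⊆ l′ → l ++ r ⊆ l′ ++ r
  ++-⊆ˡ {l} {l′} l⊆l′ x = [ ∈-++⁺ˡ ∘ l⊆l′ , ∈-++⁺ʳ l′ ]′ (∈-++⁻ l x)

  ++-⊆ʳ : ∀ l {r r′ : Log} → r ⊆ r′ → l ++ r ⊆ l ++ r′
  ++-⊆ʳ l r⊆r′ x = [ ∈-++⁺ˡ , ∈-++⁺ʳ l ∘ r⊆r′ ]′ (∈-++⁻ l x)

  private
    2*-suc : ∀ w → 2 ℕ.* w ℕ.< 2 ℕ.* suc w
    2*-suc w = ℕ.*-monoʳ-< 2 (ℕ.n<1+n w)

    span-fork : ∀ k s₁ s₂ s₃ →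
                (suc k ℕ.+ s₁) ℕ.⊔ (suc k ℕ.+ s₂) ℕ.+ s₃ ≡ k ℕ.+ suc (s₁ ℕ.⊔ s₂ ℕ.+ s₃)
    span-fork k s₁ s₂ s₃ = begin
      (suc k ℕ.+ s₁) ℕ.⊔ (suc k ℕ.+ s₂) ℕ.+ s₃  ≡⟨ cong (ℕ._+ s₃) (ℕ.+-distribˡ-⊔ (suc k) s₁ s₂) ⟨
      suc k ℕ.+ (s₁ ℕ.⊔ s₂) ℕ.+ s₃              ≡⟨ ℕ.+-assoc (suc k) (s₁ ℕ.⊔ s₂) s₃ ⟩
      suc k ℕ.+ (s₁ ℕ.⊔ s₂ ℕ.+ s₃)              ≡⟨ ℕ.+-suc k _ ⟨
      k ℕ.+ suc (s₁ ℕ.⊔ s₂ ℕ.+ s₃)              ∎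
      where open ≡-Reasoning

    shift : ∀ {x n n′ a b w} → n′ ℕ.+ a ≡ n ℕ.+ b → n′ ℕ.+ (x ℕ.+ a ℕ.+ w) ≡ n ℕ.+ (x ℕ.+ b ℕ.+ w)
    shift {x} {n} {n′} {a} {b} {w} eq = trans (lemma n′ x a w) (trans (cong (ℕ._+ (x ℕ.+ w)) eq) (sym (lemma n x b w)))
      where
      lemma : ∀ n x a w → n ℕ.+ (x ℕ.+ a ℕ.+ w) ≡ n ℕ.+ a ℕ.+ (x ℕ.+ w)
      lemma = solve-∀

    measure-mono : ∀ j j′ i a b x w → j′ ℕ.+ 2 ℕ.* a ℕ.< j ℕ.+ 2 ℕ.* b →
                   suc (i ℕ.+ j′) ℕ.+ 2 ℕ.* (x ℕ.+ a ℕ.+ w) ℕ.< suc (i ℕ.+ j) ℕ.+ 2 ℕ.* (x ℕ.+ b ℕ.+ w)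
    measure-mono j j′ i a b x w lt =
      subst₂ ℕ._<_ (sym (lemma j′ i a x w)) (sym (lemma j i b x w)) (ℕ.+-monoʳ-< (suc i ℕ.+ 2 ℕ.* (x ℕ.+ w)) lt)
      where
      lemma : ∀ j i a x w → suc (i ℕ.+ j) ℕ.+ 2 ℕ.* (x ℕ.+ a ℕ.+ w) ≡ suc i ℕ.+ 2 ℕ.* (x ℕ.+ w) ℕ.+ (j ℕ.+ 2 ℕ.* a)
      lemma = solve-∀

  progress : ∀ {T T′ M M′ n n′ l w s} → EvalTask T M l w s →
             ⟨ T , M , n ⟩ ⟶ ⟨ T′ , M′ , n′ ⟩ → Progress T T′ M M′ n n′ l w s
  progress {M = M} {n = n} (active {k} (halt eq)) (stop _) = record
    { eval′ = subst (EvalTask _ _ _ _) (ℕ.+-comm 1 k) ended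
    ; log′⊆ = λ () ; pre = [] ; pre⊆ = λ () ; effect = refl ; final = λ _ → refl
    ; work = sym (ℕ.+-suc n 0) ; decreases = s≤s z≤n }
  progress {M = M} (active (halt eq)) (continue eq′) with () ← trans (sym (eq M)) eq′
  progress {M = M} (active (halt eq)) (spawn eq′) with () ← trans (sym (eq M)) eq′
  progress {M = M} {n = n} (active {k} (silent {w = w} eq e)) (continue eq′)
    with refl ← trans (sym (eq M)) eq′ = record
    { eval′ = subst (EvalTask _ _ _ _) (sym (ℕ.+-suc k _)) (active e)
    ; log′⊆ = id ; pre = [] ; pre⊆ = λ () ; effect = refl ; final = λ _ → refl
    ; work = sym (ℕ.+-suc n _) ; decreases = 2*-suc w }
  progress {M = M} (active (silent eq e)) (spawn eq′) with () ← trans (sym (eq M)) eq′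
  progress {M = M} (active (silent eq e)) (stop eq′) with () ← trans (sym (eq M)) eq′
  progress {M = M} {n = n} (active {k} (load {w = w} x f eq e)) (continue eq′)
    with refl ← trans (sym (eq M)) eq′ = record
    { eval′ = subst (EvalTask _ _ _ _) (sym (ℕ.+-suc k _)) (active e)
    ; log′⊆ = there ; pre = [] ; pre⊆ = λ () ; effect = refl ; final = λ _ → refl
    ; work = sym (ℕ.+-suc n _) ; decreases = 2*-suc w }
  progress {M = M} (active (load x f eq e)) (spawn eq′) with () ← trans (sym (eq M)) eq′
  progress {M = M} (active (load x f eq e)) (stop eq′) with () ← trans (sym (eq M)) eq′
  progress {M = M} {n = n} (active {k} (store {w = w} x v eq e)) (continue eq′)
    with refl ← trans (sym (eq M)) eq′ = record
    { eval′ = subst (EvalTask _ _ _ _) (sym (ℕ.+-suc k _)) (active e)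
    ; log′⊆ = there ; pre = write x v ∷ [] ; pre⊆ = λ where (here refl) → here refl
    ; effect = refl ; final = λ _ → refl
    ; work = sym (ℕ.+-suc n _) ; decreases = 2*-suc w }
  progress {M = M} (active (store x v eq e)) (spawn eq′) with () ← trans (sym (eq M)) eq′
  progress {M = M} (active (store x v eq e)) (stop eq′) with () ← trans (sym (eq M)) eq′
  progress {M = M} {n = n} (active {k} (fork {w₁ = w₁} {w₂} {w₃} {s₁} {s₂} {s₃} eq e₁ e₂ comp e₃)) (spawn eq′)
    with refl ← trans (sym (eq M)) eq′ = record
    { eval′ = subst (EvalTask _ _ _ _) (span-fork k s₁ s₂ s₃)
                (blocked (active e₁) (active (Eval-cong (Compatible⇒AgreeOnReads comp M) e₂)) comp e₃)
    ; log′⊆ = id ; pre = [] ; pre⊆ = λ () ; effect = refl ; final = λ _ → refl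
    ; work = sym (ℕ.+-suc n _)
    ; decreases = ℕ.≤-reflexive (sym (ℕ.*-suc 2 (w₁ ℕ.+ w₂ ℕ.+ w₃))) }
  progress {M = M} (active (fork eq e₁ e₂ comp e₃)) (continue eq′) with () ← trans (sym (eq M)) eq′
  progress {M = M} (active (fork eq e₁ e₂ comp e₃)) (stop eq′) with () ← trans (sym (eq M)) eq′
  progress (blocked ended ended comp e₃) join = record
    { eval′ = active e₃ ; log′⊆ = id ; pre = [] ; pre⊆ = λ () ; effect = refl ; final = λ _ → refl
    ; work = refl ; decreases = ℕ.≤-refl }
  progress {M = M} {M′} {n} {n′} (blocked {l} {r} {p} {l₁ = l₁} {l₂} {l₃} {w₁} {w₂} {w₃} e₁ e₂ comp e₃) (left {l′ = l′} st) = record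
    { eval′ = blocked eval′
                (EvalTask-cong (λ {x} x∈ → sym (trans (cong (λ M → get M x) effect)
                   (Compatible⇒AgreeOnReads {pre} (λ a b → comp (pre⊆ a) b) M x∈))) e₂)
                (λ a b → comp (log′⊆ a) b)
                (Eval-cong (λ {x} _ → get-apply-cong l₂ x (sym (final x))) e₃)
    ; log′⊆ = ++-⊆ˡ log′⊆ ; pre = pre ; pre⊆ = ∈-++⁺ˡ ∘ pre⊆ ; effect = effect
    ; final = λ x → begin
        get (apply (log′ ++ l₂ ++ l₃) M′) x              ≡⟨ cong (λ M → get M x) (apply-++ log′ _ M′) ⟩
        get (apply (l₂ ++ l₃) (apply log′ M′)) x         ≡⟨ get-apply-cong (l₂ ++ l₃) x (final x) ⟩
        get (apply (l₂ ++ l₃) (apply l₁ M)) x            ≡⟨ cong (λ M → get M x) (apply-++ l₁ _ M) ⟨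
        get (apply (l₁ ++ l₂ ++ l₃) M) x                 ∎
    ; work = shift {0} {n} {n′} {b = w₁ ℕ.+ w₂} {w₃}
               (trans (sym (ℕ.+-assoc n′ w′ w₂)) (trans (cong (ℕ._+ w₂) work) (ℕ.+-assoc n w₁ w₂)))
    ; decreases = subst₂ ℕ._<_ (regroup (joins l′) (joins r) w′ w₂ w₃) (regroup (joins l) (joins r) w₁ w₂ w₃)
        (measure-mono (joins l) (joins l′) (joins r) w′ w₁ w₂ w₃ decreases)
    }
    where
    open Progress (progress e₁ st)
    open ≡-Reasoning
    regroup : ∀ j i a x w → suc (i ℕ.+ j) ℕ.+ 2 ℕ.* (x ℕ.+ a ℕ.+ w) ≡ suc (j ℕ.+ i) ℕ.+ 2 ℕ.* (a ℕ.+ x ℕ.+ w)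
    regroup = solve-∀
  progress {M = M} {M′} {n} {n′} (blocked {l} {r} {p} {l₁ = l₁} {l₂} {l₃} {w₁} {w₂} {w₃} e₁ e₂ comp e₃) (right {r′ = r′} st) = record
    { eval′ = blocked
                (EvalTask-cong (λ {x} x∈ → sym (trans (cong (λ M → get M x) effect)
                   (Compatible⇒AgreeOnReads {pre} (λ a b → Independent-sym (comp b (pre⊆ a))) M x∈))) e₁)
                eval′
                (λ a b → comp a (log′⊆ b))
                (Eval-cong (λ {x} _ → sym (reorder x)) e₃)
    ; log′⊆ = ++-⊆ʳ l₁ (++-⊆ˡ log′⊆)
    ; pre = pre ; pre⊆ = ∈-++⁺ʳ l₁ ∘ ∈-++⁺ˡ ∘ pre⊆ ; effect = effect
    ; final = λ x → begin
        get (apply (l₁ ++ log′ ++ l₃) M′) x              ≡⟨ cong (λ M → get M x) (trans (apply-++ l₁ _ M′) (apply-++ log′ l₃ _)) ⟩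
        get (apply l₃ (apply log′ (apply l₁ M′))) x      ≡⟨ get-apply-cong l₃ x (reorder x) ⟩
        get (apply l₃ (apply l₂ (apply l₁ M))) x         ≡⟨ cong (λ M → get M x) (trans (apply-++ l₁ _ M) (apply-++ l₂ l₃ _)) ⟨
        get (apply (l₁ ++ l₂ ++ l₃) M) x                 ∎
    ; work = shift {w₁} {n} {n′} work
    ; decreases = measure-mono (joins r) (joins r′) (joins l) w′ w₂ w₁ w₃ decreases
    }
    where
    open Progress (progress e₂ st)
    open ≡-Reasoning
    reorder : apply log′ (apply l₁ M′) ≗ᴹ apply l₂ (apply l₁ M)
    reorder x = begin
      get (apply log′ (apply l₁ M′)) x  ≡⟨ apply-comm l₁ log′ (λ a b → comp a (log′⊆ b)) M′ x ⟩
      get (apply l₁ (apply log′ M′)) x  ≡⟨ get-apply-cong l₁ x (final x) ⟩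
      get (apply l₁ (apply l₂ M)) x     ≡⟨ apply-comm l₁ l₂ comp M x ⟨
      get (apply l₂ (apply l₁ M)) x     ∎

  can-step : ∀ {T M l w s} n → EvalTask T M l w s →
             (∃[ k ] T ≡ ended k) ⊎ (∃[ C ] ⟨ T , M , n ⟩ ⟶ C)
  can-step {M = M} n (active (halt eq))         = inj₂ (_ , stop (eq M))
  can-step {M = M} n (active (silent eq _))     = inj₂ (_ , continue (eq M))
  can-step {M = M} n (active (load _ _ eq _))   = inj₂ (_ , continue (eq M))
  can-step {M = M} n (active (store _ _ eq _))  = inj₂ (_ , continue (eq M))
  can-step {M = M} n (active (fork eq _ _ _ _)) = inj₂ (_ , spawn (eq M))
  can-step n ended                              = inj₁ (_ , refl)
  can-step n (blocked e₁ e₂ _ _) with can-step n e₁ | can-step n e₂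
  ... | inj₂ (_ , st)   | _               = inj₂ (_ , left st)
  ... | inj₁ _          | inj₂ (_ , st)   = inj₂ (_ , right st)
  ... | inj₁ (_ , refl) | inj₁ (_ , refl) = inj₂ (_ , join)

  module _ {p} (Post : ℕ → ℕ → Memory → Set p) where

    everyTaskExecution : ∀ {T M l w s} n → Acc ℕ._<_ (measure T w) → EvalTask T M l w s →
                         (∀ M′ → M′ ≗ᴹ apply l M → Post s (n ℕ.+ w) M′) → EveryExecution Post ⟨ T , M , n ⟩
    everyTaskExecution {s = s} n (acc rec) e post with can-step n e
    everyTaskExecution n (acc rec) ended post | inj₁ (_ , refl) =
      finished (subst (λ w → Post _ w _) (ℕ.+-identityʳ n) (post _ λ _ → refl))
    ... | inj₂ st = step st λ {C′} st′ →
      let open Progress (progress e st′) in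
      everyTaskExecution _ (rec decreases) eval′ λ M′ eq →
        subst (λ w → Post s w M′) (sym work) (post M′ λ x → trans (eq x) (final x))

    everyExecution : ∀ {t M l w s} → Eval t M l w s → (∀ M′ → M′ ≗ᴹ apply l M → Post s w M′) →
                     EveryExecution Post ⟨ active 0 t , M , 0 ⟩
    everyExecution e = everyTaskExecution 0 (<-wellFounded _) (active e)

-- The program

-- N is the least power of two that is at least |V|.  Node x of a tree has the
-- children 2x and 2x + 1; vertex v is node N + v, and the edge at position j
-- with target t is the leaf (N + t) N² + j.  The weight cell base + x holds the
-- least tentative distance at the leaves below x, where 0 stands for infinity
-- and a negative number for a settled vertex; the word cell base + x is 1 while
-- that value may be out of date.  A first tree, of the bare edge weights, only
-- serves to find the least weight.
0ʳ 1ʳ 2ʳ 3ʳ nʳ mʳ sʳ Nʳ N²ʳ N³ʳ targetsʳ baseʳ xʳ loʳ hiʳ pʳ qʳ tʳ yʳ : Register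
0ʳ       = 0
1ʳ       = 1
2ʳ       = 2
3ʳ       = 3
nʳ       = 4
mʳ       = 5
sʳ       = 6
Nʳ       = 7
N²ʳ      = 8
N³ʳ      = 9
targetsʳ = 10
baseʳ    = 11
xʳ       = 12
loʳ      = 13
hiʳ      = 14
pʳ       = 15
qʳ       = 16
tʳ       = 17
yʳ       = 18

0ᵂ aᵂ widthᵂ closedᵂ limitᵂ bᵂ cᵂ : Register
0ᵂ      = 0
aᵂ      = 1
widthᵂ  = 2
closedᵂ = 3
limitᵂ  = 4
bᵂ      = 5
cᵂ      = 6

SIZE LAYOUT PHASE HALT REPAIR DIRTY OPEN PUTʳ PUTˡ NOˡ PUT0 REPAIRˡ REPAIRʳ EXTRACT DESCEND EXTRACTˡ EXTRACTʳ SETTLE OWN EDGES EDGESˡ EDGESʳ INSERT MARK : Label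
SIZE     = 7
LAYOUT   = 10
PHASE    = 29
HALT     = 35
REPAIR   = 36
DIRTY    = 40
OPEN     = 51
PUTʳ     = 54
PUTˡ     = 56
NOˡ      = 58
PUT0     = 60
REPAIRˡ  = 62
REPAIRʳ  = 64
EXTRACT  = 67
DESCEND  = 72
EXTRACTˡ = 75
EXTRACTʳ = 77
SETTLE   = 80
OWN      = 91
EDGES    = 93
EDGESˡ   = 100
EDGESʳ   = 102
INSERT   = 104
MARK     = 113

sssp : Program
sssp =
    const 1ʳ 1                    ∷
    const 2ʳ 2                    ∷
    const 3ʳ 3                    ∷
    load nʳ 0ʳ                    ∷
    load mʳ 1ʳ                    ∷
    load sʳ 2ʳ                    ∷
    const Nʳ 1                    ∷
    jump≤ nʳ Nʳ LAYOUT            ∷  -- SIZE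
    word add Nʳ Nʳ Nʳ             ∷
    jump SIZE                     ∷
    word mul N²ʳ Nʳ Nʳ            ∷  -- LAYOUT
    word mul N³ʳ N²ʳ Nʳ           ∷
    const targetsʳ 4              ∷
    word add targetsʳ targetsʳ nʳ ∷
    word add baseʳ targetsʳ mʳ    ∷
    word sub hiʳ mʳ 0ʳ            ∷
    fork EDGES HALT               ∷
    word sub xʳ 1ʳ 0ʳ             ∷
    fork REPAIR HALT              ∷
    word add pʳ baseʳ 1ʳ          ∷
    loadᵂ widthᵂ pʳ               ∷
    weight sub closedᵂ 0ᵂ widthᵂ  ∷
    word add baseʳ baseʳ N³ʳ      ∷
    word add baseʳ baseʳ N³ʳ      ∷
    word add xʳ Nʳ sʳ             ∷
    fork SETTLE HALT              ∷
    word sub xʳ 1ʳ 0ʳ             ∷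
    fork REPAIR HALT              ∷
    word add pʳ baseʳ 1ʳ          ∷
    loadᵂ aᵂ pʳ                   ∷  -- PHASE
    jump≤ᵂ aᵂ 0ᵂ HALT             ∷
    weight add limitᵂ aᵂ widthᵂ   ∷
    fork EXTRACT HALT             ∷
    fork REPAIR HALT              ∷
    jump PHASE                    ∷
    halt                          ∷  -- HALT
    word add pʳ baseʳ xʳ          ∷  -- REPAIR
    load tʳ pʳ                    ∷
    jump≤ 1ʳ tʳ DIRTY             ∷
    halt                          ∷
    store pʳ 0ʳ                   ∷  -- DIRTY
    jump≤ N³ʳ xʳ HALT             ∷
    fork REPAIRˡ REPAIRʳ          ∷
    word add qʳ xʳ xʳ             ∷
    word add qʳ baseʳ qʳ          ∷
    loadᵂ aᵂ qʳ                   ∷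
    word add qʳ qʳ 1ʳ             ∷
    loadᵂ bᵂ qʳ                   ∷
    loadᵂ cᵂ pʳ                   ∷
    jump≤ᵂ 0ᵂ cᵂ OPEN             ∷
    halt                          ∷
    jump≤ᵂ aᵂ 0ᵂ NOˡ              ∷  -- OPEN
    jump≤ᵂ bᵂ 0ᵂ PUTˡ             ∷
    jump≤ᵂ aᵂ bᵂ PUTˡ             ∷
    storeᵂ pʳ bᵂ                  ∷  -- PUTʳ
    halt                          ∷
    storeᵂ pʳ aᵂ                  ∷  -- PUTˡ
    halt                          ∷
    jump≤ᵂ bᵂ 0ᵂ PUT0             ∷  -- NOˡ
    jump PUTʳ                     ∷
    storeᵂ pʳ 0ᵂ                  ∷  -- PUT0
    halt                          ∷
    word add xʳ xʳ xʳ             ∷  -- REPAIRˡ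
    jump REPAIR                   ∷
    word add xʳ xʳ xʳ             ∷  -- REPAIRʳ
    word add xʳ xʳ 1ʳ             ∷
    jump REPAIR                   ∷
    word add pʳ baseʳ xʳ          ∷  -- EXTRACT
    loadᵂ aᵂ pʳ                   ∷
    jump≤ᵂ aᵂ 0ᵂ HALT             ∷
    jump≤ᵂ aᵂ limitᵂ DESCEND      ∷
    halt                          ∷
    jump≤ Nʳ xʳ SETTLE            ∷  -- DESCEND
    fork EXTRACTˡ EXTRACTʳ        ∷
    halt                          ∷
    word add xʳ xʳ xʳ             ∷  -- EXTRACTˡ
    jump EXTRACT                  ∷
    word add xʳ xʳ xʳ             ∷  -- EXTRACTʳ
    word add xʳ xʳ 1ʳ             ∷
    jump EXTRACT                  ∷
    word sub qʳ xʳ Nʳ             ∷  -- SETTLE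
    word add pʳ 3ʳ qʳ             ∷
    load loʳ pʳ                   ∷
    word add pʳ pʳ 1ʳ             ∷
    load hiʳ pʳ                   ∷
    word add qʳ mʳ qʳ             ∷
    storeᵂ qʳ aᵂ                  ∷
    word add pʳ baseʳ xʳ          ∷
    storeᵂ pʳ closedᵂ             ∷
    fork OWN EDGES                ∷
    halt                          ∷
    word sub yʳ xʳ 0ʳ             ∷  -- OWN
    jump MARK                     ∷
    jump≤ hiʳ loʳ HALT            ∷  -- EDGES
    word add tʳ loʳ 1ʳ            ∷
    jump≤ hiʳ tʳ INSERT           ∷
    word add tʳ loʳ hiʳ           ∷
    word div tʳ tʳ 2ʳ             ∷
    fork EDGESˡ EDGESʳ            ∷
    halt                          ∷
    word sub hiʳ tʳ 0ʳ            ∷  -- EDGESˡ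
    jump EDGES                    ∷
    word sub loʳ tʳ 0ʳ            ∷  -- EDGESʳ
    jump EDGES                    ∷
    word add qʳ targetsʳ loʳ      ∷  -- INSERT
    load tʳ qʳ                    ∷
    word add yʳ Nʳ tʳ             ∷
    word mul yʳ yʳ N²ʳ            ∷
    word add yʳ yʳ loʳ            ∷
    word add qʳ baseʳ yʳ          ∷
    loadᵂ bᵂ loʳ                  ∷
    weight add bᵂ aᵂ bᵂ           ∷
    storeᵂ qʳ bᵂ                  ∷
    word add qʳ baseʳ yʳ          ∷  -- MARK
    store qʳ 1ʳ                   ∷
    word div yʳ yʳ 2ʳ             ∷
    jump≤ 1ʳ yʳ MARK              ∷
    halt                          ∷
    []

opaque
  sealed : Program
  sealed = sssp

  sealed≡ : sealed ≡ sssp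
  sealed≡ = refl

module Rules {c ℓ₁ ℓ₂} (K : OrderedField c ℓ₁ ℓ₂) (bits : ℕ) (program source : Program) (program≡ : program ≡ source)
             (bound : ℕ) (bound< : bound ℕ.< 2 ^ bits) where
  open OrderedField K
  open Machine K bits program
  open Interleaving K bits program public

  record Runs {q} (t : Thread) (M : Memory) (Q : Log → ℕ → ℕ → Set q) : Set (c Level.⊔ q) where
    constructor runs
    field
      {log}       : Log
      {work span} : ℕ
      eval        : Eval t M log work span
      holds       : Q log work span

  private
    variable
      q     : Level
      pc    : Label
      ρ     : Register → ℕ
      ω     : Register → Carrier
      M     : Memory
      Q     : Log → ℕ → ℕ → Set q
      r x y : Register
      l l′  : Label

    fetch : Label → Instruction
    fetch = nth halt source

    fetched : ∀ pc {i} → fetch pc ≡ i → nth halt program pc ≡ i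
    fetched pc = trans (cong (λ p → nth halt p pc) program≡)

  tick : (Log → ℕ → ℕ → Set q) → Log → ℕ → ℕ → Set q
  tick Q l w s = Q l (suc w) (suc s)

  tick[_] : Access → (Log → ℕ → ℕ → Set q) → Log → ℕ → ℕ → Set q
  tick[ e ] Q l w s = Q (e ∷ l) (suc w) (suc s)

  Runs-map : ∀ {q q′ t M} {Q : Log → ℕ → ℕ → Set q} {Q′ : Log → ℕ → ℕ → Set q′} →
             (∀ {l w s} → Q l w s → Q′ l w s) → Runs t M Q → Runs t M Q′
  Runs-map f (runs e h) = runs e (f h)

  truncate-id : ∀ {k} → k ℕ.≤ bound → truncate k ≡ k
  truncate-id k≤ = ℕ.m<n⇒m%n≡m {{ℕ.m^n≢0 2 bits}} (ℕ.≤-<-trans k≤ bound<)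

  private
    quietly : ∀ {t t′} → (∀ M′ → run t M′ ≡ continue t′ M′) → Runs t′ M (tick Q) → Runs t M Q
    quietly eq (runs e h) = runs (silent eq e) h

  const! : ∀ {k} → fetch pc ≡ const r k → k ℕ.≤ bound →
           Runs (thread (suc pc) (ρ [ r ≔ k ]) ω) M (tick Q) → Runs (thread pc ρ ω) M Q
  const! {pc = pc} {r = r} {ρ = ρ} {ω = ω} {k = k} i k≤ = quietly λ M′ →
    trans (cong (λ i → execute i (thread pc ρ ω) M′) (fetched pc i))
          (cong (λ v → continue (thread (suc pc) (ρ [ r ≔ v ]) ω) M′) (truncate-id k≤))

  add! : ∀ {z} → fetch pc ≡ word add r x y → ρ x ℕ.+ ρ y ≡ z → z ℕ.≤ bound →
         Runs (thread (suc pc) (ρ [ r ≔ z ]) ω) M (tick Q) → Runs (thread pc ρ ω) M Q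
  add! {pc = pc} {r = r} {ρ = ρ} {ω = ω} i refl z≤ = quietly λ M′ →
    trans (cong (λ i → execute i (thread pc ρ ω) M′) (fetched pc i))
          (cong (λ v → continue (thread (suc pc) (ρ [ r ≔ v ]) ω) M′) (truncate-id z≤))

  mul! : ∀ {z} → fetch pc ≡ word mul r x y → ρ x ℕ.* ρ y ≡ z → z ℕ.≤ bound →
         Runs (thread (suc pc) (ρ [ r ≔ z ]) ω) M (tick Q) → Runs (thread pc ρ ω) M Q
  mul! {pc = pc} {r = r} {ρ = ρ} {ω = ω} i refl z≤ = quietly λ M′ →
    trans (cong (λ i → execute i (thread pc ρ ω) M′) (fetched pc i))
          (cong (λ v → continue (thread (suc pc) (ρ [ r ≔ v ]) ω) M′) (truncate-id z≤))

  sub! : ∀ {z} → fetch pc ≡ word sub r x y → ρ x ℕ.∸ ρ y ≡ z →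
         Runs (thread (suc pc) (ρ [ r ≔ z ]) ω) M (tick Q) → Runs (thread pc ρ ω) M Q
  sub! {pc = pc} {r = r} {ρ = ρ} {ω = ω} i refl = quietly λ M′ → cong (λ i → execute i (thread pc ρ ω) M′) (fetched pc i)

  half! : ∀ {z} → fetch pc ≡ word div r x y → ρ y ≡ 2 → ρ x ℕ./ 2 ≡ z →
          Runs (thread (suc pc) (ρ [ r ≔ z ]) ω) M (tick Q) → Runs (thread pc ρ ω) M Q
  half! {pc = pc} {r = r} {x = x} {y = y} {ρ = ρ} {ω = ω} i y≡2 refl = quietly λ M′ →
    trans (cong (λ i → execute i (thread pc ρ ω) M′) (fetched pc i))
          (cong (λ d → continue (thread (suc pc) (ρ [ r ≔ ⟦ div ⟧ (ρ x) d ]) ω) M′) y≡2)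

  addᵂ! : fetch pc ≡ weight add r x y →
          Runs (thread (suc pc) ρ (ω [ r ≔ ω x + ω y ])) M (tick Q) → Runs (thread pc ρ ω) M Q
  addᵂ! {pc = pc} {ρ = ρ} {ω = ω} i = quietly λ M′ → cong (λ i → execute i (thread pc ρ ω) M′) (fetched pc i)

  subᵂ! : fetch pc ≡ weight sub r x y →
          Runs (thread (suc pc) ρ (ω [ r ≔ ω x + (- ω y) ])) M (tick Q) → Runs (thread pc ρ ω) M Q
  subᵂ! {pc = pc} {ρ = ρ} {ω = ω} i = quietly λ M′ → cong (λ i → execute i (thread pc ρ ω) M′) (fetched pc i)

  jump! : fetch pc ≡ jump l → Runs (thread l ρ ω) M (tick Q) → Runs (thread pc ρ ω) M Q
  jump! {pc = pc} {ρ = ρ} {ω = ω} i = quietly λ M′ → cong (λ i → execute i (thread pc ρ ω) M′) (fetched pc i)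

  jump≤-yes! : fetch pc ≡ jump≤ x y l → ρ x ℕ.≤ ρ y →
               Runs (thread l ρ ω) M (tick Q) → Runs (thread pc ρ ω) M Q
  jump≤-yes! {pc = pc} {x = x} {y = y} {l = l} {ρ = ρ} {ω = ω} i x≤y = quietly λ M′ →
    trans (cong (λ i → execute i (thread pc ρ ω) M′) (fetched pc i))
          (cong (λ b → continue (thread (if b then l else suc pc) ρ ω) M′) (dec-true (ρ x ℕ.≤? ρ y) x≤y))

  jump≤-no! : fetch pc ≡ jump≤ x y l → ρ y ℕ.< ρ x →
              Runs (thread (suc pc) ρ ω) M (tick Q) → Runs (thread pc ρ ω) M Q
  jump≤-no! {pc = pc} {x = x} {y = y} {l = l} {ρ = ρ} {ω = ω} i y<x = quietly λ M′ →
    trans (cong (λ i → execute i (thread pc ρ ω) M′) (fetched pc i))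
          (cong (λ b → continue (thread (if b then l else suc pc) ρ ω) M′) (dec-false (ρ x ℕ.≤? ρ y) (ℕ.<⇒≱ y<x)))

  jump≤ᵂ-yes! : fetch pc ≡ jump≤ᵂ x y l → ω x ≤ ω y →
                Runs (thread l ρ ω) M (tick Q) → Runs (thread pc ρ ω) M Q
  jump≤ᵂ-yes! {pc = pc} {x = x} {y = y} {l = l} {ω = ω} {ρ = ρ} i x≤y = quietly λ M′ →
    trans (cong (λ i → execute i (thread pc ρ ω) M′) (fetched pc i))
          (cong (λ b → continue (thread (if b then l else suc pc) ρ ω) M′) (dec-true (ω x ≤? ω y) x≤y))

  jump≤ᵂ-no! : fetch pc ≡ jump≤ᵂ x y l → ¬ ω x ≤ ω y →
               Runs (thread (suc pc) ρ ω) M (tick Q) → Runs (thread pc ρ ω) M Q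
  jump≤ᵂ-no! {pc = pc} {x = x} {y = y} {l = l} {ω = ω} {ρ = ρ} i x≰y = quietly λ M′ →
    trans (cong (λ i → execute i (thread pc ρ ω) M′) (fetched pc i))
          (cong (λ b → continue (thread (if b then l else suc pc) ρ ω) M′) (dec-false (ω x ≤? ω y) x≰y))

  halt! : fetch pc ≡ halt → Q [] 1 1 → Runs (thread pc ρ ω) M Q
  halt! {pc = pc} {ρ = ρ} {ω = ω} i h = runs (halt λ M′ → cong (λ i → execute i (thread pc ρ ω) M′) (fetched pc i)) h

  load! : ∀ {a v} → fetch pc ≡ load r x → ρ x ≡ a → Memory.words M a ≡ v →
          Runs (thread (suc pc) (ρ [ r ≔ v ]) ω) M (tick[ read (wordCell a) ] Q) → Runs (thread pc ρ ω) M Q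
  load! {pc = pc} {r = r} {x = x} {ρ = ρ} {M = M} {ω = ω} i refl refl (runs e h) = runs (load (wordCell (ρ x)) f eq e) h
    where
    f : Content (wordCell (ρ x)) → Thread
    f (word v) = thread (suc pc) (ρ [ r ≔ v ]) ω
    eq : ∀ M′ → run (thread pc ρ ω) M′ ≡ continue (f (get M′ (wordCell (ρ x)))) M′
    eq M′ = cong (λ i → execute i (thread pc ρ ω) M′) (fetched pc i)

  loadᵂ! : ∀ {a v} → fetch pc ≡ loadᵂ r x → ρ x ≡ a → Memory.weights M a ≡ v →
           Runs (thread (suc pc) ρ (ω [ r ≔ v ])) M (tick[ read (weightCell a) ] Q) → Runs (thread pc ρ ω) M Q
  loadᵂ! {pc = pc} {r = r} {x = x} {ρ = ρ} {M = M} {ω = ω} i refl refl (runs e h) = runs (load (weightCell (ρ x)) f eq e) h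
    where
    f : Content (weightCell (ρ x)) → Thread
    f (weight v) = thread (suc pc) ρ (ω [ r ≔ v ])
    eq : ∀ M′ → run (thread pc ρ ω) M′ ≡ continue (f (get M′ (weightCell (ρ x)))) M′
    eq M′ = cong (λ i → execute i (thread pc ρ ω) M′) (fetched pc i)

  store! : ∀ {a v} → fetch pc ≡ store x y → ρ x ≡ a → ρ y ≡ v →
           Runs (thread (suc pc) ρ ω) (set (wordCell a) (word v) M) (tick[ write (wordCell a) (word v) ] Q) →
           Runs (thread pc ρ ω) M Q
  store! {pc = pc} {x = x} {y = y} {ρ = ρ} {ω = ω} i refl refl (runs e h) = runs (store (wordCell (ρ x)) (word (ρ y)) eq e) h
    where
    eq : ∀ M′ → run (thread pc ρ ω) M′ ≡ continue (thread (suc pc) ρ ω) (set (wordCell (ρ x)) (word (ρ y)) M′)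
    eq M′ = cong (λ i → execute i (thread pc ρ ω) M′) (fetched pc i)

  storeᵂ! : ∀ {a v} → fetch pc ≡ storeᵂ x y → ρ x ≡ a → ω y ≡ v →
            Runs (thread (suc pc) ρ ω) (set (weightCell a) (weight v) M) (tick[ write (weightCell a) (weight v) ] Q) →
            Runs (thread pc ρ ω) M Q
  storeᵂ! {pc = pc} {x = x} {y = y} {ρ = ρ} {ω = ω} i refl refl (runs e h) = runs (store (weightCell (ρ x)) (weight (ω y)) eq e) h
    where
    eq : ∀ M′ → run (thread pc ρ ω) M′ ≡ continue (thread (suc pc) ρ ω) (set (weightCell (ρ x)) (weight (ω y)) M′)
    eq M′ = cong (λ i → execute i (thread pc ρ ω) M′) (fetched pc i)

  fork! : ∀ {q₁ q₂} {Q₁ : Log → ℕ → ℕ → Set q₁} {Q₂ : Log → Log → ℕ → ℕ → Set q₂} →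
          fetch pc ≡ fork l l′ →
          Runs (thread l ρ ω) M Q₁ →
          (∀ {l₁ w₁ s₁} → Q₁ l₁ w₁ s₁ → Runs (thread l′ ρ ω) (apply l₁ M) (Q₂ l₁)) →
          (∀ {l₁ w₁ s₁ l₂ w₂ s₂} → Q₁ l₁ w₁ s₁ → Q₂ l₁ l₂ w₂ s₂ → Compatible l₁ l₂) →
          (∀ {l₁ w₁ s₁ l₂ w₂ s₂} → Q₁ l₁ w₁ s₁ → Q₂ l₁ l₂ w₂ s₂ →
           Runs (thread (suc pc) ρ ω) (apply l₂ (apply l₁ M))
             (λ l₃ w₃ s₃ → Q (l₁ ++ l₂ ++ l₃) (suc (w₁ ℕ.+ w₂ ℕ.+ w₃)) (suc (s₁ ℕ.⊔ s₂ ℕ.+ s₃)))) →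
          Runs (thread pc ρ ω) M Q
  fork! {pc = pc} {ρ = ρ} {ω = ω} i (runs e₁ h₁) other compatible rest
    with other h₁
  ... | runs e₂ h₂ with rest h₁ h₂
  ... | runs e₃ h₃ =
    runs (fork (λ M′ → cong (λ i → execute i (thread pc ρ ω) M′) (fetched pc i)) e₁ e₂ (compatible h₁ h₂) e₃) h₃

  -- The machine has no procedure call: one is made by forking against a
  -- thread that halts at once.
  call! : ∀ {q₁} {Q₁ : Log → ℕ → ℕ → Set q₁} →
          fetch pc ≡ fork l l′ → fetch l′ ≡ halt →
          Runs (thread l ρ ω) M Q₁ →
          (∀ {l₁ w₁ s₁} → Q₁ l₁ w₁ s₁ →
           Runs (thread (suc pc) ρ ω) (apply l₁ M)
             (λ l₃ w₃ s₃ → Q (l₁ ++ l₃) (2 ℕ.+ (w₁ ℕ.+ w₃)) (2 ℕ.+ (s₁ ℕ.+ s₃)))) →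
          (∀ {l w s s′} → s′ ℕ.≤ s → Q l w s → Q l w s′) →
          Runs (thread pc ρ ω) M Q
  call! {Q = Q} {Q₁ = Q₁} i i′ callee rest lower =
    fork! {Q₁ = Q₁} {Q₂ = λ _ l₂ w₂ s₂ → l₂ ≡ [] × w₂ ≡ 1 × s₂ ≡ 1} i callee (λ _ → halt! i′ (refl , refl , refl))
      (λ where _ (refl , _) _ ())
      λ { {l₁} {w₁} {s₁} h (refl , refl , refl) → Runs-map (λ {l₃} {w₃} {s₃} h₃ →
          lower (ℕ.≤-trans (s≤s (ℕ.+-monoˡ-≤ s₃ (ℕ.⊔-lub (ℕ.m≤m+n s₁ 1) (ℕ.m≤n+m 1 s₁))))
                           (ℕ.≤-reflexive (cong suc (cong (ℕ._+ s₃) (ℕ.+-comm s₁ 1)))))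
                (subst (λ w → Q (l₁ ++ l₃) (suc w) (2 ℕ.+ (s₁ ℕ.+ s₃))) (cong (ℕ._+ w₃) (ℕ.+-comm 1 w₁)) h₃))
          (rest h) }

-- Binary trees of numbered nodes

1≤2^ : ∀ k → 1 ℕ.≤ 2 ^ k
1≤2^ k = ℕ.m^n>0 2 k

double : ∀ k → k ℕ.* 2 ≡ k ℕ.+ k
double = solve-∀

half-even : ∀ k → (k ℕ.+ k) ℕ./ 2 ≡ k
half-even k = trans (cong (ℕ._/ 2) (sym (double k))) (ℕ.m*n/n≡m k 2)

half-odd : ∀ k → suc (k ℕ.+ k) ℕ./ 2 ≡ k
half-odd k = trans (cong (λ z → suc z ℕ./ 2) (sym (double k)))
                   (trans (ℕ.+-distrib-/-∣ʳ 1 {k ℕ.* 2} {2} (divides k refl)) (ℕ.m*n/n≡m k 2))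

half-mid : ∀ lo k → (lo ℕ.+ (lo ℕ.+ k)) ℕ./ 2 ≡ lo ℕ.+ k ℕ./ 2
half-mid lo k = begin
  (lo ℕ.+ (lo ℕ.+ k)) ℕ./ 2       ≡⟨ cong (ℕ._/ 2) (ℕ.+-assoc lo lo k) ⟨
  (lo ℕ.+ lo ℕ.+ k) ℕ./ 2         ≡⟨ ℕ.+-distrib-/-∣ˡ {lo ℕ.+ lo} k {2} (divides lo (sym (double lo))) ⟩
  (lo ℕ.+ lo) ℕ./ 2 ℕ.+ k ℕ./ 2   ≡⟨ cong (ℕ._+ k ℕ./ 2) (half-even lo) ⟩
  lo ℕ.+ k ℕ./ 2                  ∎
  where open ≡-Reasoning

half-cases : ∀ k → (k ≡ k ℕ./ 2 ℕ.+ k ℕ./ 2) ⊎ (k ≡ suc (k ℕ./ 2 ℕ.+ k ℕ./ 2))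
half-cases k with k ℕ.% 2 in eq | ℕ.m%n<n k 2
... | 0 | _ = inj₁ (trans (ℕ.m≡m%n+[m/n]*n k 2) (trans (cong (ℕ._+ k ℕ./ 2 ℕ.* 2) eq) (double (k ℕ./ 2))))
... | 1 | _ = inj₂ (trans (ℕ.m≡m%n+[m/n]*n k 2) (trans (cong (ℕ._+ k ℕ./ 2 ℕ.* 2) eq) (cong suc (double (k ℕ./ 2)))))
... | suc (suc _) | s≤s (s≤s ())

half<2^ : ∀ {y} k → y ℕ.< 2 ^ suc k → y ℕ./ 2 ℕ.< 2 ^ k
half<2^ {y} k y< = ℕ.m<n*o⇒m/o<n (subst (y ℕ.<_) (ℕ.*-comm 2 (2 ^ k)) y<)

half-≤ : ∀ y → y ℕ./ 2 ℕ.≤ y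
half-≤ y = ℕ.m/n≤m y 2

2^-suc : ∀ k → 2 ^ suc k ≡ 2 ^ k ℕ.+ 2 ^ k
2^-suc k = cong (2 ^ k ℕ.+_) (ℕ.+-identityʳ _)

halve-≤ : ∀ {a p} → a ℕ.+ a ℕ.≤ p ℕ.+ p → a ℕ.≤ p
halve-≤ {a} {p} le with a ℕ.≤? p
... | yes a≤p = a≤p
... | no a≰p  = ⊥-elim (ℕ.<⇒≱ (ℕ.+-mono-< (ℕ.≰⇒> a≰p) (ℕ.≰⇒> a≰p)) le)

halve-< : ∀ {a p} → a ℕ.+ a ℕ.< p ℕ.+ p → a ℕ.< p
halve-< {a} {p} lt with suc a ℕ.≤? p
... | yes a<p = a<p
... | no a≮p  = ⊥-elim (ℕ.<⇒≱ lt (ℕ.+-mono-≤ (ℕ.≮⇒≥ a≮p) (ℕ.≮⇒≥ a≮p)))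

record Bisection (len f : ℕ) : Set where
  field
    {b}  : ℕ
    len≡ : len ≡ len ℕ./ 2 ℕ.+ b
    1≤a  : 1 ℕ.≤ len ℕ./ 2
    1≤b  : 1 ℕ.≤ b
    a≤   : len ℕ./ 2 ℕ.≤ 2 ^ f
    b≤   : b ℕ.≤ 2 ^ f

bisect : ∀ len f → 2 ℕ.≤ len → len ℕ.≤ 2 ^ suc f → Bisection len f
bisect len f 2≤ ≤2^ with half-cases len
... | inj₁ eq = record { len≡ = eq ; 1≤a = 1≤a ; 1≤b = 1≤a ; a≤ = a≤ ; b≤ = a≤ }
  where
  1≤a = ℕ.m≥n⇒m/n>0 {len} {2} 2≤
  a≤ = halve-≤ (subst₂ ℕ._≤_ eq (2^-suc f) ≤2^)
... | inj₂ eq = record { len≡ = trans eq (sym (ℕ.+-suc _ _)) ; 1≤a = ℕ.m≥n⇒m/n>0 {len} {2} 2≤ ; 1≤b = s≤s z≤n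
                       ; a≤ = ℕ.<⇒≤ a< ; b≤ = a< }
  where
  a< = halve-< (subst₂ ℕ._≤_ eq (2^-suc f) ≤2^)

record Desc (k x z : ℕ) : Set where
  constructor desc
  field
    lower : x ℕ.* 2 ^ k ℕ.≤ z
    upper : z ℕ.< suc x ℕ.* 2 ^ k

Under : ℕ → ℕ → Set
Under x z = ∃[ k ] Desc k x z

private
  even-2^ : ∀ x p → (x ℕ.+ x) ℕ.* p ≡ x ℕ.* (p ℕ.+ p)
  even-2^ = solve-∀

  odd-2^ : ∀ x p → suc (suc (x ℕ.+ x)) ℕ.* p ≡ suc x ℕ.* (p ℕ.+ p)
  odd-2^ = solve-∀

even-level : ∀ x k → (x ℕ.+ x) ℕ.* 2 ^ k ≡ x ℕ.* 2 ^ suc k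
even-level x k = trans (even-2^ x (2 ^ k)) (cong (x ℕ.*_) (sym (2^-suc k)))

odd-level : ∀ x k → suc (suc (x ℕ.+ x)) ℕ.* 2 ^ k ≡ suc x ℕ.* 2 ^ suc k
odd-level x k = trans (odd-2^ x (2 ^ k)) (cong (suc x ℕ.*_) (sym (2^-suc k)))

Desc-refl : ∀ x → Desc 0 x x
Desc-refl x = desc (ℕ.≤-reflexive (ℕ.*-identityʳ x)) $ ℕ.≤-reflexive (sym (ℕ.*-identityʳ (suc x)))

Desc-zero : ∀ {x z} → Desc 0 x z → z ≡ x
Desc-zero {x} {z} (desc lo hi) =
  ℕ.≤-antisym (ℕ.≤-pred (subst (suc z ℕ.≤_) (ℕ.*-identityʳ (suc x)) hi)) (subst (ℕ._≤ z) (ℕ.*-identityʳ x) lo)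

Desc-even : ∀ k {x z} → Desc k (x ℕ.+ x) z → Desc (suc k) x z
Desc-even k {x} {z} (desc lo hi) = desc
  (subst (ℕ._≤ z) (even-level x k) lo) $
  ℕ.<-≤-trans hi (ℕ.≤-trans (ℕ.*-monoˡ-≤ (2 ^ k) (ℕ.n≤1+n (suc (x ℕ.+ x)))) (ℕ.≤-reflexive (odd-level x k)))

Desc-odd : ∀ k {x z} → Desc k (suc (x ℕ.+ x)) z → Desc (suc k) x z
Desc-odd k {x} {z} (desc lo hi) = desc
  (ℕ.≤-trans (ℕ.≤-reflexive (sym (even-level x k))) (ℕ.≤-trans (ℕ.*-monoˡ-≤ (2 ^ k) (ℕ.n≤1+n (x ℕ.+ x))) lo)) $
  subst (z ℕ.<_) (odd-level x k) hi

Desc-suc : ∀ k {x z} → Desc (suc k) x z → Desc k (x ℕ.+ x) z ⊎ Desc k (suc (x ℕ.+ x)) z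
Desc-suc k {x} {z} (desc lo hi) with suc z ℕ.≤? suc (x ℕ.+ x) ℕ.* 2 ^ k
... | yes z< = inj₁ (desc (subst (ℕ._≤ z) (sym (even-level x k)) lo) z<)
... | no z≮  = inj₂ (desc (ℕ.≮⇒≥ z≮) $ subst (z ℕ.<_) (sym (odd-level x k)) hi)

Under-refl : ∀ x → Under x x
Under-refl x = 0 , Desc-refl x

Under-even : ∀ {x z} → Under (x ℕ.+ x) z → Under x z
Under-even (k , d) = suc k , Desc-even k d

Under-odd : ∀ {x z} → Under (suc (x ℕ.+ x)) z → Under x z
Under-odd (k , d) = suc k , Desc-odd k d

Under-cases : ∀ {x z} → Under x z → z ≡ x ⊎ Under (x ℕ.+ x) z ⊎ Under (suc (x ℕ.+ x)) z
Under-cases (zero , d) = inj₁ (Desc-zero d)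
Under-cases (suc k , d) with Desc-suc k d
... | inj₁ d′ = inj₂ (inj₁ (k , d′))
... | inj₂ d′ = inj₂ (inj₂ (k , d′))

Under⇒≤ : ∀ {x z} → Under x z → x ℕ.≤ z
Under⇒≤ {x} (k , desc lo _) = ℕ.≤-trans (ℕ.m≤m*n x (2 ^ k) {{ℕ.m^n≢0 2 k}}) lo

Under-disjoint : ∀ {x z} → 1 ℕ.≤ x → Under (x ℕ.+ x) z → ¬ Under (suc (x ℕ.+ x)) z
Under-disjoint {x} {z} 1≤x (k , desc lo hi) (l , desc lo′ hi′) with k ℕ.≤? l
... | yes k≤l = ℕ.<⇒≱ hi (ℕ.≤-trans (ℕ.*-monoʳ-≤ (suc (x ℕ.+ x)) (ℕ.^-monoʳ-≤ 2 k≤l)) lo′)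
... | no k≰l = ℕ.<⇒≱ hi′ (ℕ.≤-trans (ℕ.≤-trans (ℕ.*-monoˡ-≤ (2 ^ l) le)
                   (ℕ.≤-reflexive (ℕ.*-assoc (x ℕ.+ x) 2 (2 ^ l)))) (ℕ.≤-trans (ℕ.*-monoʳ-≤ (x ℕ.+ x) (ℕ.^-monoʳ-≤ 2 (ℕ.≰⇒> k≰l))) lo))
  where
  le : suc (suc (x ℕ.+ x)) ℕ.≤ (x ℕ.+ x) ℕ.* 2
  le = subst (suc (suc (x ℕ.+ x)) ℕ.≤_) (sym (double (x ℕ.+ x))) (ℕ.+-monoˡ-≤ (x ℕ.+ x) (ℕ.+-mono-≤ 1≤x 1≤x))

-- The subtree of x reaches down by k to the row of nodes p, ..., p + p - 1.
record Row (p k x : ℕ) : Set where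
  constructor row
  field
    lower : p ℕ.≤ x ℕ.* 2 ^ k
    upper : suc x ℕ.* 2 ^ k ℕ.≤ p ℕ.+ p

Row-even : ∀ {p} k {x} → Row p (suc k) x → Row p k (x ℕ.+ x)
Row-even {p} k {x} (row lo hi) = row
  (subst (p ℕ.≤_) (sym (even-level x k)) lo) $
  ℕ.≤-trans (ℕ.*-monoˡ-≤ (2 ^ k) (ℕ.n≤1+n (suc (x ℕ.+ x)))) (subst (ℕ._≤ p ℕ.+ p) (sym (odd-level x k)) hi)

Row-odd : ∀ {p} k {x} → Row p (suc k) x → Row p k (suc (x ℕ.+ x))
Row-odd {p} k {x} (row lo hi) = row
  (ℕ.≤-trans (subst (p ℕ.≤_) (sym (even-level x k)) lo) (ℕ.*-monoˡ-≤ (2 ^ k) (ℕ.n≤1+n (x ℕ.+ x)))) $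
  subst (ℕ._≤ p ℕ.+ p) (sym (odd-level x k)) hi

Row-zero : ∀ {p x} → Row p 0 x → p ℕ.≤ x
Row-zero {p} {x} (row lo _) = subst (p ℕ.≤_) (ℕ.*-identityʳ x) lo

Row-suc : ∀ {p} k {x} → Row p (suc k) x → x ℕ.< p
Row-suc {p} k {x} (row _ hi) = halve-≤ (ℕ.≤-trans
  (ℕ.≤-trans (ℕ.≤-reflexive (sym (double (suc x)))) (ℕ.*-monoʳ-≤ (suc x) (ℕ.m≤m*n 2 (2 ^ k) {{ℕ.m^n≢0 2 k}}))) hi)

Row-< : ∀ {p} k {x} → Row p k x → x ℕ.< p ℕ.+ p
Row-< k {x} (row _ hi) = ℕ.≤-trans (ℕ.m≤m*n (suc x) (2 ^ k) {{ℕ.m^n≢0 2 k}}) hi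

-- Compressed sparse rows; src j and tgt j are the ends of the edge at position j.
record CSR {c ℓ₁ ℓ₂} (K : OrderedField c ℓ₁ ℓ₂) : Set (c Level.⊔ ℓ₂ Level.⊔ ℓ₁) where
  open OrderedField K
  field
    n m h   : ℕ
    off tgt src : ℕ → ℕ
    wt      : ℕ → Carrier
    1≤h     : 1 ℕ.≤ h
    n≤N     : n ℕ.≤ 2 ^ h
    m≤N²    : m ℕ.≤ 2 ^ h ℕ.* 2 ^ h
    tgt<n   : ∀ {j} → j ℕ.< m → tgt j ℕ.< n
    src<n   : ∀ {j} → j ℕ.< m → src j ℕ.< n
    off-mono : ∀ {v} → v ℕ.< n → off v ℕ.≤ off (suc v)
    off-last : off n ≡ m
    off-src  : ∀ {j} → j ℕ.< m → off (src j) ℕ.≤ j × j ℕ.< off (suc (src j))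

  N N² N³ S H targets first bound : ℕ
  N = 2 ^ h
  N² = N ℕ.* N
  N³ = N² ℕ.* N
  S = N³ ℕ.+ N³
  H = suc (h ℕ.+ h ℕ.+ h)
  targets = 4 ℕ.+ n
  first = targets ℕ.+ m
  bound = first ℕ.+ N³ ℕ.+ N³ ℕ.+ S

  leaf : ℕ → ℕ
  leaf j = (N ℕ.+ tgt j) ℕ.* N² ℕ.+ j

  1≤N : 1 ℕ.≤ N
  1≤N = 1≤2^ h

  2≤N : 2 ℕ.≤ N
  2≤N = ℕ.≤-trans (ℕ.≤-reflexive (sym (ℕ.^-identityʳ 2))) (ℕ.^-monoʳ-≤ 2 1≤h)

  N≤N² : N ℕ.≤ N²
  N≤N² = ℕ.m≤m*n N N {{ℕ.>-nonZero 1≤N}}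

  N+N≤N² : N ℕ.+ N ℕ.≤ N²
  N+N≤N² = subst (ℕ._≤ N²) (double N) (ℕ.*-monoʳ-≤ N 2≤N)

  N²≤N³ : N² ℕ.≤ N³
  N²≤N³ = ℕ.m≤m*n N² N {{ℕ.>-nonZero 1≤N}}

  N≤N³ : N ℕ.≤ N³
  N≤N³ = ℕ.≤-trans N≤N² N²≤N³

  N³≤S : N³ ℕ.≤ S
  N³≤S = ℕ.m≤m+n N³ N³

  N²≡2^ : N² ≡ 2 ^ (h ℕ.+ h)
  N²≡2^ = sym (ℕ.^-distribˡ-+-* 2 h h)

  N³≡2^ : N³ ≡ 2 ^ (h ℕ.+ h ℕ.+ h)
  N³≡2^ = trans (cong (ℕ._* N) N²≡2^) (sym (ℕ.^-distribˡ-+-* 2 (h ℕ.+ h) h))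

  S≡2^H : S ≡ 2 ^ H
  S≡2^H = trans (cong₂ ℕ._+_ N³≡2^ N³≡2^) (sym (2^-suc (h ℕ.+ h ℕ.+ h)))

  N²N³ : N ℕ.* N² ≡ N³
  N²N³ = ℕ.*-comm N N²

  N³≤leaf : ∀ j → N³ ℕ.≤ leaf j
  N³≤leaf j = ℕ.≤-trans (ℕ.≤-trans (ℕ.≤-reflexive (sym N²N³)) (ℕ.*-monoˡ-≤ N² (ℕ.m≤m+n N (tgt j)))) (ℕ.m≤m+n _ j)

  leaf-desc : ∀ {j} → j ℕ.< m → Desc (h ℕ.+ h) (N ℕ.+ tgt j) (leaf j)
  leaf-desc {j} j<m = desc
    (subst (λ p → (N ℕ.+ tgt j) ℕ.* p ℕ.≤ leaf j) N²≡2^ (ℕ.m≤m+n _ j)) $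
    subst (λ p → leaf j ℕ.< suc (N ℕ.+ tgt j) ℕ.* p) N²≡2^
      (subst (leaf j ℕ.<_) (ℕ.+-comm _ N²) (ℕ.+-monoʳ-< ((N ℕ.+ tgt j) ℕ.* N²) (ℕ.<-≤-trans j<m m≤N²)))

  leaf<S : ∀ {j} → j ℕ.< m → leaf j ℕ.< S
  leaf<S {j} j<m = ℕ.<-≤-trans (Desc.upper (leaf-desc j<m))
    (ℕ.≤-trans (ℕ.*-mono-≤ (ℕ.+-monoʳ-< N (ℕ.<-≤-trans (tgt<n j<m) n≤N)) (ℕ.≤-reflexive (sym N²≡2^)))
               (ℕ.≤-reflexive (trans (ℕ.*-distribʳ-+ N² N N) (cong₂ ℕ._+_ N²N³ N²N³))))

  leaf-injective : ∀ {j j′} → j ℕ.< m → j′ ℕ.< m → leaf j ≡ leaf j′ → j ≡ j′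
  leaf-injective {j} {j′} j<m j′<m eq = begin
    j                ≡⟨ index j<m ⟨
    leaf j ℕ.% N²    ≡⟨ cong (ℕ._% N²) eq ⟩
    leaf j′ ℕ.% N²   ≡⟨ index j′<m ⟩
    j′               ∎
    where
    open ≡-Reasoning
    instance _ = ℕ.>-nonZero (ℕ.≤-trans 1≤N N≤N²)
    index : ∀ {j} → j ℕ.< m → leaf j ℕ.% N² ≡ j
    index {j} j<m = trans (cong (ℕ._% N²) (ℕ.+-comm _ j))
      (trans (ℕ.[m+kn]%n≡m%n j (N ℕ.+ tgt j) N²) (ℕ.m<n⇒m%n≡m (ℕ.<-≤-trans j<m m≤N²)))

  off-mono′ : ∀ {u v} → u ℕ.≤ v → v ℕ.≤ n → off u ℕ.≤ off v
  off-mono′ {u} {v} u≤v v≤n with ℕ.m≤n⇒m<n∨m≡n u≤v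
  ... | inj₂ refl = ℕ.≤-refl
  off-mono′ {u} {suc v} _ v≤n | inj₁ (s≤s u≤v) = ℕ.≤-trans (off-mono′ u≤v (ℕ.<⇒≤ v≤n)) (off-mono v≤n)

  off≤m : ∀ {v} → v ℕ.≤ n → off v ℕ.≤ m
  off≤m v≤n = subst (off _ ℕ.≤_) off-last (off-mono′ v≤n ℕ.≤-refl)

  src-unique : ∀ {j v} → j ℕ.< m → v ℕ.< n → off v ℕ.≤ j → j ℕ.< off (suc v) → src j ≡ v
  src-unique {j} {v} j<m v<n lo hi with off-src j<m
  ... | lo′ , hi′ = ℕ.≤-antisym (le (src<n j<m) lo′ hi) (le v<n lo hi′)
    where
    le : ∀ {a b} → a ℕ.< n → off a ℕ.≤ j → j ℕ.< off (suc b) → a ℕ.≤ b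
    le {a} {b} a<n l r = ℕ.≮⇒≥ λ b<a → ℕ.<⇒≱ r (ℕ.≤-trans (off-mono′ b<a (ℕ.<⇒≤ a<n)) l)

treeSum : ℕ → ℕ → (ℕ → ℕ) → ℕ
treeSum zero    x f = f x
treeSum (suc k) x f = treeSum k (x ℕ.+ x) f ℕ.+ treeSum k (suc (x ℕ.+ x)) f

treeSum-mono : ∀ k {x f g} → (∀ z → Desc k x z → f z ℕ.≤ g z) → treeSum k x f ℕ.≤ treeSum k x g
treeSum-mono zero le = le _ (Desc-refl _)
treeSum-mono (suc k) le = ℕ.+-mono-≤ (treeSum-mono k λ z d → le z (Desc-even k d)) (treeSum-mono k λ z d → le z (Desc-odd k d))

treeSum-+ : ∀ k {x} f g → treeSum k x f ℕ.+ treeSum k x g ≡ treeSum k x (λ z → f z ℕ.+ g z)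
treeSum-+ zero f g = refl
treeSum-+ (suc k) {x} f g = trans (swap (treeSum k (x ℕ.+ x) f) _ _ _) (cong₂ ℕ._+_ (treeSum-+ k f g) (treeSum-+ k f g))
  where
  swap : ∀ a b c d → a ℕ.+ b ℕ.+ (c ℕ.+ d) ≡ a ℕ.+ c ℕ.+ (b ℕ.+ d)
  swap = solve-∀

Row-inner : ∀ {p} k {x i y} → Row p k x → i ℕ.< k → Desc i x y → y ℕ.< p
Row-inner {p} k {x} {i} {y} (row _ hi) i<k (desc _ y<) = halve-< (begin-strict
  y ℕ.+ y                     <⟨ ℕ.+-mono-< y< y< ⟩
  q ℕ.+ q                     ≡⟨ double q ⟨
  suc x ℕ.* 2 ^ i ℕ.* 2       ≡⟨ ℕ.*-assoc (suc x) (2 ^ i) 2 ⟩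
  suc x ℕ.* (2 ^ i ℕ.* 2)     ≡⟨ cong (suc x ℕ.*_) (ℕ.*-comm (2 ^ i) 2) ⟩
  suc x ℕ.* 2 ^ suc i         ≤⟨ ℕ.*-monoʳ-≤ (suc x) (ℕ.^-monoʳ-≤ 2 i<k) ⟩
  suc x ℕ.* 2 ^ k             ≤⟨ hi ⟩
  p ℕ.+ p                     ∎)
  where
  open ℕ.≤-Reasoning
  q = suc x ℕ.* 2 ^ i

Row-bottom : ∀ {p} k {x z} → Row p k x → Desc k x z → p ℕ.≤ z × z ℕ.< p ℕ.+ p
Row-bottom k (row lo hi) (desc lo′ hi′) = ℕ.≤-trans lo lo′ , ℕ.<-≤-trans hi′ hi

telescope : ∀ k {p x} {f F : ℕ → ℕ} → Row p k x → (∀ z → p ℕ.≤ z → f z ℕ.+ F z ≡ F (suc z)) →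
            treeSum k x f ℕ.+ F (x ℕ.* 2 ^ k) ≡ F (suc x ℕ.* 2 ^ k)
telescope zero {x = x} {f} {F} r eq = trans (cong (λ y → f x ℕ.+ F y) (ℕ.*-identityʳ x))
  (trans (eq x (Row-zero r)) (cong F (sym (ℕ.*-identityʳ (suc x)))))
telescope (suc k) {x = x} {f} {F} r eq = begin
  l ℕ.+ t ℕ.+ F (x ℕ.* 2 ^ suc k)             ≡⟨ cong (λ y → l ℕ.+ t ℕ.+ F y) (even-level x k) ⟨
  l ℕ.+ t ℕ.+ F ((x ℕ.+ x) ℕ.* 2 ^ k)         ≡⟨ swap l t _ ⟩
  t ℕ.+ (l ℕ.+ F ((x ℕ.+ x) ℕ.* 2 ^ k))       ≡⟨ cong (t ℕ.+_) (telescope k (Row-even k r) eq) ⟩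
  t ℕ.+ F (suc (x ℕ.+ x) ℕ.* 2 ^ k)           ≡⟨ telescope k (Row-odd k r) eq ⟩
  F (suc (suc (x ℕ.+ x)) ℕ.* 2 ^ k)           ≡⟨ cong F (odd-level x k) ⟩
  F (suc x ℕ.* 2 ^ suc k)                     ∎
  where
  open ≡-Reasoning
  l = treeSum k (x ℕ.+ x) f
  t = treeSum k (suc (x ℕ.+ x)) f
  swap : ∀ a b c → a ℕ.+ b ℕ.+ c ≡ b ℕ.+ (a ℕ.+ c)
  swap = solve-∀

treeCount : ℕ → ℕ → (ℕ → ℕ) → ℕ
treeCount zero    x f = f x
treeCount (suc k) x f = f x ℕ.+ (treeCount k (x ℕ.+ x) f ℕ.+ treeCount k (suc (x ℕ.+ x)) f)

treeCount-cong : ∀ k {x f g} → (∀ z → Under x z → f z ≡ g z) → treeCount k x f ≡ treeCount k x g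
treeCount-cong zero eq = eq _ (Under-refl _)
treeCount-cong (suc k) eq = cong₂ ℕ._+_ (eq _ (Under-refl _))
  (cong₂ ℕ._+_ (treeCount-cong k λ z → eq z ∘ Under-even) (treeCount-cong k λ z → eq z ∘ Under-odd))

under-root : ∀ k {z} → 1 ℕ.≤ z → z ℕ.< 2 ^ k → Under 1 z
under-root zero 1≤z (s≤s z≤0) = ⊥-elim (ℕ.<⇒≱ 1≤z z≤0)
under-root (suc k) {z} 1≤z z< with suc z ℕ.≤? 2 ^ k
... | yes z<′ = under-root k 1≤z z<′
... | no z≮   = k , desc (ℕ.≤-trans (ℕ.≤-reflexive (ℕ.*-identityˡ (2 ^ k))) (ℕ.≮⇒≥ z≮)) z<

Desc-unique : ∀ k {x y z} → Desc k x z → Desc k y z → x ≡ y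
Desc-unique k {x} {y} {z} d e = ℕ.≤-antisym (le d e) (le e d)
  where
  le : ∀ {x y} → Desc k x z → Desc k y z → x ℕ.≤ y
  le {x} {y} (desc lo _) (desc _ hi) = ℕ.≤-pred (ℕ.*-cancelʳ-< (2 ^ k) x (suc y) (ℕ.≤-<-trans lo hi))

record Within (x f k : ℕ) : Set where
  constructor within
  field bounded : f ℕ.≤ k ℕ.* x

within-const : ∀ {x} → 1 ℕ.≤ x → ∀ k → Within x k k
within-const 1≤x k = within (ℕ.≤-trans (ℕ.≤-reflexive (sym (ℕ.*-identityʳ k))) (ℕ.*-monoʳ-≤ k 1≤x))

within-one : ∀ {x} → Within x x 1
within-one {x} = within (ℕ.≤-reflexive (sym (ℕ.*-identityˡ x)))

infixl 6 _⊕_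
_⊕_ : ∀ {x f g k l} → Within x f k → Within x g l → Within x (f ℕ.+ g) (k ℕ.+ l)
_⊕_ {x} {k = k} {l} (within p) (within q) = within (ℕ.≤-trans (ℕ.+-mono-≤ p q) (ℕ.≤-reflexive (sym (ℕ.*-distribʳ-+ x k l))))

infixl 7 _⊗_
_⊗_ : ∀ {x f k} → Within x f k → ∀ n → Within x (f ℕ.* n) (k ℕ.* n)
_⊗_ {x} {f} {k} (within p) n = within (ℕ.≤-trans (ℕ.*-monoˡ-≤ n p) (ℕ.≤-reflexive (swap k x n)))
  where
  swap : ∀ k x n → k ℕ.* x ℕ.* n ≡ k ℕ.* n ℕ.* x
  swap = solve-∀

within-*ˡ : ∀ {x} n {f k} → Within x f k → Within x (n ℕ.* f) (n ℕ.* k)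
within-*ˡ {x} n {f} {k} (within p) = within (ℕ.≤-trans (ℕ.*-monoʳ-≤ n p) (ℕ.≤-reflexive (sym (ℕ.*-assoc n k x))))

within-≤ : ∀ {x f g k} → f ℕ.≤ g → Within x g k → Within x f k
within-≤ p (within q) = within (ℕ.≤-trans p q)

within-product : ∀ {m h f g k l} → Within m f k → Within h g l → Within (m ℕ.* h) (f ℕ.* g) (k ℕ.* l)
within-product {m} {h} {k = k} {l} (within p) (within q) = within (ℕ.≤-trans (ℕ.*-mono-≤ p q) (ℕ.≤-reflexive (swap k m l h)))
  where
  swap : ∀ k m l h → k ℕ.* m ℕ.* (l ℕ.* h) ≡ k ℕ.* l ℕ.* (m ℕ.* h)
  swap = solve-∀

module Choice {c ℓ₁ ℓ₂} (K : OrderedField c ℓ₁ ℓ₂) where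
  open OrderedField K
  module Ord = IsDecTotalOrder isDecTotalOrder

  ≰⇒≥ : ∀ {x y} → ¬ x ≤ y → y ≤ x
  ≰⇒≥ {x} {y} x≰y = [ (λ x≤y → ⊥-elim (x≰y x≤y)) , id ]′ (Ord.total x y)

  min⁺ : Carrier → Carrier → Carrier
  min⁺ a b = if does (a ≤? 0#) then (if does (b ≤? 0#) then 0# else b)
             else (if does (b ≤? 0#) then a else (if does (a ≤? b) then a else b))

  pick : Carrier → Carrier → Carrier → Carrier
  pick c a b = if does (0# ≤? c) then min⁺ a b else c

  min⁺-nonNegative : ∀ a b → 0# ≤ min⁺ a b
  min⁺-nonNegative a b with a ≤? 0# | b ≤? 0#
  ... | yes _ | yes _ = Ord.refl
  ... | yes _ | no q  = ≰⇒≥ q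
  ... | no p  | yes _ = ≰⇒≥ p
  ... | no p  | no q with a ≤? b
  ...   | yes _ = ≰⇒≥ p
  ...   | no _  = ≰⇒≥ q

  pick-open : ∀ {c a b} → 0# ≤ c → pick c a b ≡ min⁺ a b
  pick-open {c} {a} {b} p = cong (if_then min⁺ a b else c) (dec-true (0# ≤? c) p)

  pick-closed : ∀ {c a b} → ¬ 0# ≤ c → pick c a b ≡ c
  pick-closed {c} {a} {b} p = cong (if_then min⁺ a b else c) (dec-false (0# ≤? c) p)

  pick-idem : ∀ c a b → pick (pick c a b) a b ≡ pick c a b
  pick-idem c a b with 0# ≤? c
  ... | yes p = pick-open (min⁺-nonNegative a b)
  ... | no p  = pick-closed p

module FieldOrder {c ℓ₁ ℓ₂} (K : OrderedField c ℓ₁ ℓ₂) where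
  open OrderedField K
  open Choice K
  module R = CommutativeRing commutativeRing

  +-mono-≤ : ∀ {a b x y} → a ≤ b → x ≤ y → a + x ≤ b + y
  +-mono-≤ {a} {b} {x} {y} a≤b x≤y = Ord.trans (+-monoˡ-≤ x a≤b)
    (Ord.trans (Ord.reflexive (R.+-comm b x)) (Ord.trans (+-monoˡ-≤ b x≤y) (Ord.reflexive (R.+-comm y b))))

  ≤-+ʳ : ∀ {a} b → 0# ≤ a → b ≤ a + b
  ≤-+ʳ b 0≤a = Ord.trans (Ord.reflexive (R.sym (R.+-identityˡ b))) (+-monoˡ-≤ b 0≤a)

  ≤-+ˡ : ∀ {a} b → 0# ≤ a → b ≤ b + a
  ≤-+ˡ b 0≤a = Ord.trans (≤-+ʳ b 0≤a) (Ord.reflexive (R.+-comm _ b))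

  +-positive : ∀ {a b} → 0# ≤ a → ¬ b ≤ 0# → ¬ a + b ≤ 0#
  +-positive {a} {b} 0≤a b>0 le = b>0 (Ord.trans (≤-+ʳ b 0≤a) le)

  negated : ∀ {w} → ¬ w ≤ 0# → ¬ 0# ≤ 0# + (- w)
  negated {w} w>0 le = w>0 (Ord.trans (≤-+ʳ w le) (Ord.reflexive
    (R.trans (R.+-cong (R.+-identityˡ (- w)) R.refl) (R.-‿inverseˡ w))))

  pick-zero : pick 0# 0# 0# ≡ 0#
  pick-zero = trans (pick-open Ord.refl) zero-min
    where
    zero-min : min⁺ 0# 0# ≡ 0#
    zero-min with 0# ≤? 0#
    ... | yes _ = refl
    ... | no p  = ⊥-elim (p Ord.refl)

  min⁺-witness : ∀ {a b} → ¬ min⁺ a b ≤ 0# → (min⁺ a b ≡ a × ¬ a ≤ 0#) ⊎ (min⁺ a b ≡ b × ¬ b ≤ 0#)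
  min⁺-witness {a} {b} p with a ≤? 0# | b ≤? 0#
  ... | yes _ | yes _ = ⊥-elim (p Ord.refl)
  ... | yes _ | no q  = inj₂ (refl , q)
  ... | no q  | yes _ = inj₁ (refl , q)
  ... | no q  | no r with a ≤? b
  ...   | yes _ = inj₁ (refl , q)
  ...   | no _  = inj₂ (refl , r)

  min⁺-leftmost : ∀ {a b} → ¬ a ≤ 0# → ¬ min⁺ a b ≤ 0# × min⁺ a b ≤ a
  min⁺-leftmost {a} {b} p with a ≤? 0# | b ≤? 0#
  ... | yes q | _     = ⊥-elim (p q)
  ... | no q  | yes _ = q , Ord.refl
  ... | no q  | no r with a ≤? b
  ...   | yes _ = q , Ord.refl
  ...   | no t  = r , ≰⇒≥ t

  min⁺-rightmost : ∀ {a b} → ¬ b ≤ 0# → ¬ min⁺ a b ≤ 0# × min⁺ a b ≤ b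
  min⁺-rightmost {a} {b} p with a ≤? 0# | b ≤? 0#
  ... | _     | yes q = ⊥-elim (p q)
  ... | yes _ | no r  = r , Ord.refl
  ... | no q  | no r with a ≤? b
  ...   | yes t = q , t
  ...   | no _  = r , Ord.refl

  Minima : (ℕ → Carrier) → ℕ → ℕ → Set c
  Minima g k x = ∀ i y → i ℕ.< k → Desc i x y → g y ≡ min⁺ (g (y ℕ.+ y)) (g (suc (y ℕ.+ y)))

  module _ {g : ℕ → Carrier} where

    minima-even : ∀ {k x} → Minima g (suc k) x → Minima g k (x ℕ.+ x)
    minima-even t i y i<k d = t (suc i) y (s≤s i<k) (Desc-even i d)

    minima-odd : ∀ {k x} → Minima g (suc k) x → Minima g k (suc (x ℕ.+ x))
    minima-odd t i y i<k d = t (suc i) y (s≤s i<k) (Desc-odd i d)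

    minimum-attained : ∀ k {x} → Minima g k x → ¬ g x ≤ 0# → ∃[ z ] (Desc k x z × g x ≡ g z)
    minimum-attained zero {x} t p = x , Desc-refl x , refl
    minimum-attained (suc k) {x} t p
      with eq ← t 0 x (s≤s z≤n) (Desc-refl x)
      with min⁺-witness (subst (λ v → ¬ v ≤ 0#) eq p)
    ... | inj₁ (eq′ , q) = let z , d , eq″ = minimum-attained k (minima-even t) q in z , Desc-even k d , trans eq (trans eq′ eq″)
    ... | inj₂ (eq′ , q) = let z , d , eq″ = minimum-attained k (minima-odd t) q in z , Desc-odd k d , trans eq (trans eq′ eq″)

    minimum-below : ∀ k {x z} → Minima g k x → Desc k x z → ¬ g z ≤ 0# → ¬ g x ≤ 0# × g x ≤ g z
    minimum-below zero t d p with refl ← Desc-zero d = p , Ord.refl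
    minimum-below (suc k) {x} {z} t d p with t 0 x (s≤s z≤n) (Desc-refl x) | Desc-suc k d
    ... | eq | inj₁ d′ = let q , le = minimum-below k (minima-even t) d′ p ; q′ , le′ = min⁺-leftmost q in
      subst (λ v → ¬ v ≤ 0# × v ≤ g z) (sym eq) (q′ , Ord.trans le′ le)
    ... | eq | inj₂ d′ = let q , le = minimum-below k (minima-odd t) d′ p ; q′ , le′ = min⁺-rightmost q in
      subst (λ v → ¬ v ≤ 0# × v ≤ g z) (sym eq) (q′ , Ord.trans le′ le)

-- Shortest-path distances as far as the algorithm is concerned.  In a
-- shortest walk to v, cross is the first edge leaving a set P of vertices.
record Distances {c ℓ₁ ℓ₂} (K : OrderedField c ℓ₁ ℓ₂) (G : CSR K) : Set (Level.suc ℓ₂ Level.⊔ c Level.⊔ ℓ₁) where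
  open OrderedField K
  open CSR G
  field
    s        : ℕ
    s<n      : s ℕ.< n
    d        : ℕ → Carrier
    w D      : Carrier
    w>0      : ¬ w ≤ 0#
    w≤wt     : ∀ {j} → j ℕ.< m → w ≤ wt j
    wt-min   : ∃[ j ] (j ℕ.< m × wt j ≤ w)
    d≥0      : ∀ {v} → v ℕ.< n → 0# ≤ d v
    d≤D      : ∀ {v} → v ℕ.< n → d v ≤ D
    d-source : d s ≈ 0#
    d-edge   : ∀ {j} → j ℕ.< m → d (tgt j) ≤ d (src j) + wt j
    cross    : ∀ (P : ℕ → Set ℓ₂) → (∀ v → Dec (P v)) → P s → ∀ {v} → v ℕ.< n → ¬ P v →
               ∃[ j ] (j ℕ.< m × P (src j) × ¬ P (tgt j) ×
                 ((tgt j ≡ v × d (src j) + wt j ≤ d v) ⊎ d (src j) + wt j + w ≤ d v))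

-- The procedures of the program

module Verification {c ℓ₁ ℓ₂} (K : OrderedField c ℓ₁ ℓ₂) (bits : ℕ) (G : CSR K) (bound< : CSR.bound G ℕ.< 2 ^ bits) where
  open OrderedField K
  open Choice K
  open FieldOrder K
  open CSR G public
  open Machine K bits sealed public hiding (input; output)
  open Rules K bits sealed sssp sealed≡ (CSR.bound G) bound< public
  open Memory public

  words-other : ∀ l M {a} → (∀ v → ¬ write (wordCell a) v ∈ l) → words (apply l M) a ≡ words M a
  words-other l M {a} ∉l = cong (λ { (word v) → v }) (get-apply-other l M ∉l)

  weights-other : ∀ l M {a} → (∀ v → ¬ write (weightCell a) v ∈ l) → weights (apply l M) a ≡ weights M a
  weights-other l M {a} ∉l = cong (λ { (weight v) → v }) (get-apply-other l M ∉l)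

  -- Accesses that leave the input alone.
  data Static : Access → Set c where
    reads   : ∀ {x} → Static (read x)
    word    : ∀ {a v} → first ℕ.≤ a → Static (write (wordCell a) v)
    weight  : ∀ {a v} → m ℕ.≤ a → Static (write (weightCell a) v)

  record Input (M : Memory) : Set c where
    field
      off-read : ∀ {v} → v ℕ.≤ n → Memory.words M (3 ℕ.+ v) ≡ off v
      tgt-read : ∀ {j} → j ℕ.< m → Memory.words M (targets ℕ.+ j) ≡ tgt j
      wt-read  : ∀ {j} → j ℕ.< m → Memory.weights M j ≡ wt j

  open Input public

  Input-apply : ∀ {l M} → All Static l → Input M → Input (apply l M)
  Input-apply {l} {M} static i = record
    { off-read = λ v≤n → trans (words-other l M λ _ w → no-word (All.lookup static w)
                   (ℕ.≤-trans (ℕ.+-monoʳ-≤ 4 v≤n) (ℕ.m≤m+n targets m))) (off-read i v≤n)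
    ; tgt-read = λ j<m → trans (words-other l M λ _ w → no-word (All.lookup static w)
                   (ℕ.+-monoʳ-< targets j<m)) (tgt-read i j<m)
    ; wt-read  = λ j<m → trans (weights-other l M λ _ w → no-weight (All.lookup static w) j<m) (wt-read i j<m)
    }
    where
    no-word : ∀ {a v} → Static (write (wordCell a) v) → ¬ a ℕ.< first
    no-word (word first≤a) a< = ℕ.<⇒≱ a< first≤a
    no-weight : ∀ {a v} → Static (write (weightCell a) v) → ¬ a ℕ.< m
    no-weight (weight m≤a) a< = ℕ.<⇒≱ a< m≤a

  Env : ℕ → (Register → ℕ) → Set
  Env base ρ = ρ 0ʳ ≡ 0 × ρ 1ʳ ≡ 1 × ρ 2ʳ ≡ 2 × ρ 3ʳ ≡ 3 × ρ mʳ ≡ m × ρ Nʳ ≡ N × ρ N²ʳ ≡ N² × ρ N³ʳ ≡ N³ ×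
               ρ targetsʳ ≡ targets × ρ baseʳ ≡ base

  module Tree (base : ℕ) (first≤base : first ℕ.≤ base) (base+S≤bound : base ℕ.+ S ℕ.≤ bound) where

    node≤bound : ∀ {z} → z ℕ.≤ S → base ℕ.+ z ℕ.≤ bound
    node≤bound z≤S = ℕ.≤-trans (ℕ.+-monoʳ-≤ base z≤S) base+S≤bound

    ≤S⇒≤bound : ∀ {z} → z ℕ.≤ S → z ℕ.≤ bound
    ≤S⇒≤bound z≤S = ℕ.≤-trans z≤S (ℕ.m≤n+m S (first ℕ.+ N³ ℕ.+ N³))

    base≤bound : base ℕ.≤ bound
    base≤bound = ℕ.≤-trans (ℕ.m≤m+n base S) base+S≤bound

    node : ℕ → Cell
    node z = weightCell (base ℕ.+ z)

    flag : ℕ → Cell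
    flag z = wordCell (base ℕ.+ z)

    mark : ℕ → Access
    mark z = write (flag z) (word 1)

    node-injective : ∀ {y z} → node y ≡ node z → y ≡ z
    node-injective {y} {z} eq = ℕ.+-cancelˡ-≡ base y z (cong (λ { (weightCell a) → a ; (wordCell a) → a }) eq)

    flag-injective : ∀ {y z} → flag y ≡ flag z → y ≡ z
    flag-injective {y} {z} eq = ℕ.+-cancelˡ-≡ base y z (cong (λ { (weightCell a) → a ; (wordCell a) → a }) eq)

    cell : Access → Cell
    cell (read x)    = x
    cell (write x _) = x

    mark-injective : ∀ {y z} → mark y ≡ mark z → y ≡ z
    mark-injective eq = flag-injective (cong cell eq)

    -- Consequently a node without a mark heads an unchanged subtree.
    record Marked (l : Log) : Set c where
      field
        up  : ∀ {z} → mark z ∈ l → 1 ℕ.≤ z ℕ./ 2 → mark (z ℕ./ 2) ∈ l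
        own : ∀ {z v} → write (node z) v ∈ l → mark z ∈ l

    open Marked public

    Marked-[] : Marked []
    Marked-[] = record { up = λ () ; own = λ () }

    Marked-++ : ∀ {l l′} → Marked l → Marked l′ → Marked (l ++ l′)
    Marked-++ {l} {l′} a b = record
      { up  = λ w p → [ (λ w → ∈-++⁺ˡ (up a w p)) , (λ w → ∈-++⁺ʳ l (up b w p)) ]′ (∈-++⁻ l w)
      ; own = λ w → [ (λ w → ∈-++⁺ˡ (own a w)) , (λ w → ∈-++⁺ʳ l (own b w)) ]′ (∈-++⁻ l w) }

    Marked-read : ∀ {x l} → Marked l → Marked (read x ∷ l)
    Marked-read a = record
      { up = λ { (there w) p → there (up a w p) } ; own = λ { (there w) → there (own a w) } }

    Marked-write : ∀ {z v l} → mark z ∈ l → Marked l → Marked (write (node z) v ∷ l)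
    Marked-write {z} {v} {l} mz a = record
      { up = λ { (there w) p → there (up a w p) }
      ; own = λ { (there w) → there (own a w)
                ; (here eq) → there (subst (λ z → mark z ∈ l) (sym (node-injective (cong cell eq))) mz) } }

    Marked-output : ∀ {a v l} → a ℕ.< base → Marked l → Marked (write (weightCell a) v ∷ l)
    Marked-output a< x = record
      { up = λ { (there w) p → there (up x w p) }
      ; own = λ { (there w) → there (own x w)
                ; {z} (here eq) → ⊥-elim (ℕ.<⇒≱ a< (subst (base ℕ.≤_)
                    (cong (λ { (weightCell a) → a ; (wordCell a) → a }) (cong cell eq)) (ℕ.m≤m+n base z))) } }

    -- A phase settles the vertices v in V at distance dist v, relaxes the
    -- edges in J and reads the nodes in R.
    module Phase (dist : ℕ → Carrier) (closing : Carrier) where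

      data Allowed {p} (R : ℕ → Set) (V J : ℕ → Set p) : Access → Set (c Level.⊔ p) where
        inputʷ : ∀ {a} → a ℕ.< first → Allowed R V J (read (wordCell a))
        inputᵂ : ∀ {a} → a ℕ.< m → Allowed R V J (read (weightCell a))
        nodes  : ∀ {z} → R z → Allowed R V J (read (node z))
        marks  : ∀ {z} → 1 ℕ.≤ z → z ℕ.< S → Allowed R V J (mark z)
        result : ∀ {v} → V v → v ℕ.< n → Allowed R V J (write (weightCell (m ℕ.+ v)) (weight (dist v)))
        close  : ∀ {v} → V v → v ℕ.< n → Allowed R V J (write (node (N ℕ.+ v)) (weight closing))
        leaves : ∀ {j} → J j → j ℕ.< m →
                 Allowed R V J (write (node (leaf j)) (weight (dist (src j) + wt j)))

      Allowed-map : ∀ {p p′} {R R′} {V J : ℕ → Set p} {V′ J′ : ℕ → Set p′} → (∀ {z} → R z → R′ z) → (∀ {v} → V v → V′ v) → (∀ {j} → j ℕ.< m → J j → J′ j) →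
                    ∀ {e} → Allowed R V J e → Allowed R′ V′ J′ e
      Allowed-map r v j (inputʷ x)    = inputʷ x
      Allowed-map r v j (inputᵂ x)    = inputᵂ x
      Allowed-map r v j (nodes x)     = nodes (r x)
      Allowed-map r v j (marks x y)   = marks x y
      Allowed-map r v j (result x y)  = result (v x) y
      Allowed-map r v j (close x y)   = close (v x) y
      Allowed-map r v j (leaves x y)  = leaves (j y x) y

      m+n≤base : m ℕ.+ n ℕ.≤ base
      m+n≤base = ℕ.≤-trans (ℕ.≤-trans (ℕ.≤-reflexive (ℕ.+-comm m n)) (ℕ.m≤n+m (n ℕ.+ m) 4)) first≤base

      output<base : ∀ {v} → v ℕ.< n → m ℕ.+ v ℕ.< base
      output<base v<n = ℕ.<-≤-trans (ℕ.+-monoʳ-< m v<n) m+n≤base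

      Static-allowed : ∀ {p R} {V J : ℕ → Set p} {e} → Allowed R V J e → Static e
      Static-allowed (inputʷ _)       = reads
      Static-allowed (inputᵂ _)       = reads
      Static-allowed (nodes _)        = reads
      Static-allowed (marks _ _)      = word (ℕ.≤-trans first≤base (ℕ.m≤m+n base _))
      Static-allowed (result _ _)     = weight (ℕ.m≤m+n m _)
      Static-allowed (close _ _)      = weight (ℕ.≤-trans (ℕ.≤-trans (ℕ.m≤m+n m n) m+n≤base) (ℕ.m≤m+n base _))
      Static-allowed (leaves _ _)     = weight (ℕ.≤-trans (ℕ.≤-trans (ℕ.m≤m+n m n) m+n≤base) (ℕ.m≤m+n base _))

      weight≢ : ∀ {a b} → a ≢ b → weightCell a ≢ weightCell b
      weight≢ a≢b refl = a≢b refl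

      node≢ : ∀ {y z} → y ≢ z → node y ≢ node z
      node≢ y≢z = y≢z ∘ node-injective

      below : ∀ {a z} → a ℕ.< base → a ≢ base ℕ.+ z
      below {a} {z} a< refl = ℕ.<⇒≱ a< (ℕ.m≤m+n base z)

      m≤base : m ℕ.≤ base
      m≤base = ℕ.≤-trans (ℕ.m≤m+n m n) m+n≤base

      top≢leaf : ∀ {z j} → z ℕ.< N ℕ.+ N → z ≢ leaf j
      top≢leaf {z} {j} z< refl = ℕ.<⇒≱ z< (ℕ.≤-trans (ℕ.≤-trans N+N≤N² N²≤N³) (N³≤leaf j))

      vertex<N+N : ∀ {v} → v ℕ.< n → N ℕ.+ v ℕ.< N ℕ.+ N
      vertex<N+N v<n = ℕ.+-monoʳ-< N (ℕ.<-≤-trans v<n n≤N)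

      module _ {p p′} {R R′ : ℕ → Set} {V J : ℕ → Set p} {V′ J′ : ℕ → Set p′} (top : ∀ {z} → R z → z ℕ.< N ℕ.+ N) (top′ : ∀ {z} → R′ z → z ℕ.< N ℕ.+ N)
               (R#V : ∀ {v} → R (N ℕ.+ v) → ¬ V′ v) (V#R : ∀ {v} → V v → ¬ R′ (N ℕ.+ v))
               (V#V : ∀ {v} → V v → ¬ V′ v) (J#J : ∀ {j} → J j → ¬ J′ j) where

        independent-read : ∀ {x e} → Allowed R V J (read x) → Allowed R′ V′ J′ e → Independent (read x) e
        independent-read a (inputʷ _) = read-read
        independent-read a (inputᵂ _) = read-read
        independent-read a (nodes _)  = read-read
        independent-read (inputʷ x) (marks _ _)  = read-write λ where refl → ℕ.<⇒≱ x (ℕ.≤-trans first≤base (ℕ.m≤m+n base _))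
        independent-read (inputʷ x) (result _ _) = read-write λ ()
        independent-read (inputʷ x) (close _ _)  = read-write λ ()
        independent-read (inputʷ x) (leaves _ _) = read-write λ ()
        independent-read (inputᵂ x) (marks _ _)  = read-write λ ()
        independent-read (inputᵂ x) (result _ _) = read-write λ where refl → ℕ.<⇒≱ x (ℕ.m≤m+n m _)
        independent-read (inputᵂ x) (close _ _)  = read-write (weight≢ (below (ℕ.<-≤-trans x m≤base)))
        independent-read (inputᵂ x) (leaves _ _) = read-write (weight≢ (below (ℕ.<-≤-trans x m≤base)))
        independent-read (nodes x) (marks _ _)   = read-write λ ()
        independent-read (nodes x) (result _ y)  = read-write (weight≢ (≢-sym (below (output<base y))))
        independent-read (nodes x) (close y _)   =
          read-write (node≢ λ where refl → R#V x y)
        independent-read (nodes x) (leaves {j} _ _)  = read-write (node≢ (top≢leaf {j = j} (top x)))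

        independent-write : ∀ {x u y v} → Allowed R V J (write x u) → Allowed R′ V′ J′ (write y v) →
                            Independent (write x u) (write y v)
        independent-write (marks {z} _ _) (marks {z′} _ _) with z ℕ.≟ z′
        ... | yes refl = same-write
        ... | no z≢z′  = write-write (z≢z′ ∘ flag-injective)
        independent-write (marks _ _) (result _ _)  = write-write λ ()
        independent-write (marks _ _) (close _ _)   = write-write λ ()
        independent-write (marks _ _) (leaves _ _)  = write-write λ ()
        independent-write (result _ _) (marks _ _)  = write-write λ ()
        independent-write (close _ _) (marks _ _)   = write-write λ ()
        independent-write (leaves _ _) (marks _ _)  = write-write λ ()
        independent-write (result {v} x _) (result {v′} y _) =
          write-write (weight≢ λ eq → V#V x (subst V′ (sym (ℕ.+-cancelˡ-≡ m v v′ eq)) y))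
        independent-write (result _ x) (close _ _)  = write-write (weight≢ (below (output<base x)))
        independent-write (result _ x) (leaves _ _) = write-write (weight≢ (below (output<base x)))
        independent-write (close _ _) (result _ x)  = write-write (weight≢ (≢-sym (below (output<base x))))
        independent-write (leaves _ _) (result _ x) = write-write (weight≢ (≢-sym (below (output<base x))))
        independent-write (close {v} x _) (close {v′} y _) =
          write-write (node≢ λ eq → V#V x (subst V′ (sym (ℕ.+-cancelˡ-≡ N v v′ eq)) y))
        independent-write (close _ x) (leaves {j} _ _) = write-write (node≢ (top≢leaf {j = j} (vertex<N+N x)))
        independent-write (leaves {j} _ _) (close _ x) = write-write (node≢ (≢-sym (top≢leaf {j = j} (vertex<N+N x))))
        independent-write (leaves x p) (leaves y q) =
          write-write (node≢ λ eq → J#J x (subst J′ (sym (leaf-injective p q eq)) y))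

      allowed-independent : ∀ {p p′} {R R′ : ℕ → Set} {V J : ℕ → Set p} {V′ J′ : ℕ → Set p′} → (∀ {z} → R z → z ℕ.< N ℕ.+ N) → (∀ {z} → R′ z → z ℕ.< N ℕ.+ N) →
                            (∀ {v} → R (N ℕ.+ v) → ¬ V′ v) → (∀ {v} → V v → ¬ R′ (N ℕ.+ v)) →
                            (∀ {v} → V v → ¬ V′ v) → (∀ {j} → J j → ¬ J′ j) →
                            ∀ {l l′} → All (Allowed R V J) l → All (Allowed R′ V′ J′) l′ → Compatible l l′
      allowed-independent {R = R} {R′} {V} {J} {V′} {J′} t t′ rv vr vv jj as bs x y = go _ _ (All.lookup as x) (All.lookup bs y)
        where
        go : ∀ e e′ → Allowed R V J e → Allowed R′ V′ J′ e′ → Independent e e′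
        go (read _) e′ a b = independent-read {V = V} {J = J} {J′ = J′} t t′ rv vr vv jj a b
        go (write _ _) (read _) a b = Independent-sym
          (independent-read {J = J′} {J′ = J} t′ t (λ r v → vr v r) (λ v r → rv r v) (λ v v′ → vv v′ v) (λ j j′ → jj j′ j) b a)
        go (write _ _) (write _ _) a b = independent-write t t′ rv vr vv jj a b

      flags-marked : ∀ {p R} {V J : ℕ → Set p} {l z u} → All (Allowed R V J) l → write (flag z) u ∈ l → u ≡ word 1
      flags-marked {R = R} {V} {J} {z = z} {u} all w = go (All.lookup all w) refl refl
        where
        go : ∀ {e} → Allowed R V J e → e ≡ write (flag z) u → cell e ≡ flag z → u ≡ word 1
        go (marks _ _) eq eq′ with refl ← flag-injective eq′ with refl ← eq = refl

      ∅ : ℕ → Set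
      ∅ _ = ⊥

      mark-runs : ∀ k {y ρ ω M} → Env base ρ → ρ yʳ ≡ y → 1 ℕ.≤ y → y ℕ.< 2 ^ k → y ℕ.< S →
                  Runs (thread MARK ρ ω) M λ l w s →
                    All (Allowed ∅ ∅ ∅) l × mark y ∈ l × Marked l × w ℕ.≤ 1 ℕ.+ k ℕ.* 4 × s ℕ.≤ 1 ℕ.+ k ℕ.* 4
      mark-runs zero env refl 1≤y (s≤s y≤0) y<S = ⊥-elim (ℕ.<⇒≱ 1≤y y≤0)
      mark-runs (suc k) {y} {ρ} env@(_ , e1 , e2 , _ , _ , _ , _ , _ , _ , eb) refl 1≤y y<2^ y<S =
        add! refl (cong (ℕ._+ y) eb) (node≤bound (ℕ.<⇒≤ y<S)) $
        store! refl refl e1 $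
        half! refl e2 refl $
        (case 1 ℕ.≤? y ℕ./ 2 of λ where
          (yes p) →
            jump≤-yes! refl (subst (ℕ._≤ y ℕ./ 2) (sym e1) p) $
            Runs-map (λ { (all , my , mk , w≤ , s≤) →
                marks 1≤y y<S ∷ all , here refl
                , record { up = λ { (here eq) p → there (subst (λ z → mark (z ℕ./ 2) ∈ _) (sym (mark-injective eq)) my)
                                  ; (there w) p → there (up mk w p) }
                         ; own = λ { (there w) → there (own mk w) } }
                , s≤s (s≤s (s≤s (s≤s w≤))) , s≤s (s≤s (s≤s (s≤s s≤))) }) $
            mark-runs k env refl p (half<2^ k y<2^) (ℕ.≤-<-trans (half-≤ y) y<S)
          (no p) →
            jump≤-no! refl (subst (y ℕ./ 2 ℕ.<_) (sym e1) (ℕ.≰⇒> p)) $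
            halt! refl $
              marks 1≤y y<S ∷ [] , here refl
              , record { up = λ { (here eq) q → ⊥-elim (p (subst (λ z → 1 ℕ.≤ z ℕ./ 2) (mark-injective eq) q)) }
                       ; own = λ { (there ()) } }
              , s≤s (s≤s (s≤s (s≤s (s≤s z≤n)))) , s≤s (s≤s (s≤s (s≤s (s≤s z≤n)))))

  module Relaxation (base : ℕ) (first≤base : first ℕ.≤ base) (base+S≤bound : base ℕ.+ S ℕ.≤ bound)
                    (dist : ℕ → Carrier) (closing : Carrier) where
    open Tree base first≤base base+S≤bound public
    open Phase dist closing public

    β Γ σ : ℕ
    β = 13 ℕ.+ H ℕ.* 4
    Γ = β ℕ.+ 11
    σ = 11 ℕ.+ (β ℕ.+ (h ℕ.+ h) ℕ.* 9)

    Range : ℕ → ℕ → ℕ → Set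
    Range lo hi j = lo ℕ.≤ j × j ℕ.< hi

    relax : ℕ → Access
    relax j = write (node (leaf j)) (weight (dist (src j) + wt j))

    InsertsRange : ℕ → ℕ → ℕ → ℕ → Log → ℕ → ℕ → Set c
    InsertsRange lo hi W B l w s =
      All (Allowed ∅ ∅ (Range lo hi)) l × (∀ j → Range lo hi j → relax j ∈ l) × Marked l ×
      w ℕ.+ 11 ℕ.≤ W × s ℕ.≤ B

    private
      work-fork : ∀ {w₁ w₂ p q} → w₁ ℕ.+ 11 ℕ.≤ 2 ℕ.+ p → w₂ ℕ.+ 11 ℕ.≤ 2 ℕ.+ q →
                  5 ℕ.+ suc (w₁ ℕ.+ w₂ ℕ.+ 1) ℕ.+ 11 ℕ.≤ p ℕ.+ q
      work-fork {w₁} {w₂} {p} {q} a b = ℕ.+-cancelˡ-≤ 4 _ _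
        (subst₂ ℕ._≤_ (lhs w₁ w₂) (rhs p q) (ℕ.+-mono-≤ a b))
        where
        lhs : ∀ w₁ w₂ → w₁ ℕ.+ 11 ℕ.+ (w₂ ℕ.+ 11) ≡ 4 ℕ.+ (5 ℕ.+ suc (w₁ ℕ.+ w₂ ℕ.+ 1) ℕ.+ 11)
        lhs = solve-∀
        rhs : ∀ p q → 2 ℕ.+ p ℕ.+ (2 ℕ.+ q) ≡ 4 ℕ.+ (p ℕ.+ q)
        rhs = solve-∀

      span-fork : ∀ {s₁ s₂} b f → s₁ ℕ.≤ 2 ℕ.+ (b ℕ.+ f ℕ.* 9) → s₂ ℕ.≤ 2 ℕ.+ (b ℕ.+ f ℕ.* 9) →
                  5 ℕ.+ suc (s₁ ℕ.⊔ s₂ ℕ.+ 1) ℕ.≤ b ℕ.+ suc f ℕ.* 9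
      span-fork {s₁} {s₂} b f p q = ℕ.≤-trans
        (ℕ.+-monoʳ-≤ 6 (ℕ.+-monoˡ-≤ 1 (ℕ.⊔-lub p q))) (ℕ.≤-reflexive (eq b f))
        where
        eq : ∀ b f → 6 ℕ.+ (2 ℕ.+ (b ℕ.+ f ℕ.* 9) ℕ.+ 1) ≡ b ℕ.+ suc f ℕ.* 9
        eq = solve-∀

    private
      single-work : ∀ {w} b → w ℕ.≤ b → 3 ℕ.+ w ℕ.+ 11 ℕ.≤ 1 ℕ.* (3 ℕ.+ b ℕ.+ 11)
      single-work b w≤ = ℕ.≤-trans (ℕ.+-monoˡ-≤ 11 (ℕ.+-monoʳ-≤ 3 w≤)) (ℕ.≤-reflexive (sym (ℕ.*-identityˡ (3 ℕ.+ b ℕ.+ 11))))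

      single-span : ∀ {s} b f → s ℕ.≤ b → 3 ℕ.+ s ℕ.≤ 3 ℕ.+ b ℕ.+ f
      single-span b f s≤ = ℕ.≤-trans (ℕ.+-monoʳ-≤ 3 s≤) (ℕ.m≤m+n (3 ℕ.+ b) f)

    m≤S : m ℕ.≤ S
    m≤S = ℕ.≤-trans (ℕ.≤-trans m≤N² N²≤N³) N³≤S

    m+m≤S : m ℕ.+ m ℕ.≤ S
    m+m≤S = ℕ.+-mono-≤ (ℕ.≤-trans m≤N² N²≤N³) (ℕ.≤-trans m≤N² N²≤N³)

    N+N≤S : N ℕ.+ N ℕ.≤ S
    N+N≤S = ℕ.+-mono-≤ N≤N³ N≤N³

    insert-runs : ∀ {lo ρ ω M} → Env base ρ → ρ loʳ ≡ lo → ω aᵂ ≡ dist (src lo) → lo ℕ.< m → Input M →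
                  Runs (thread INSERT ρ ω) M λ l w s →
                    All (Allowed ∅ ∅ (lo ≡_)) l × relax lo ∈ l × Marked l ×
                    w ℕ.≤ 10 ℕ.+ H ℕ.* 4 × s ℕ.≤ 10 ℕ.+ H ℕ.* 4
    insert-runs {lo} {ρ} {ω} {M} env@(_ , _ , _ , _ , _ , eN , eN² , _ , et , eb) refl eδ lo<m input =
      add! refl (cong (ℕ._+ lo) et) (ℕ.≤-trans (ℕ.≤-trans (ℕ.+-monoʳ-≤ targets (ℕ.<⇒≤ lo<m)) first≤base) base≤bound) $
      load! refl refl (tgt-read input lo<m) $
      add! refl (cong (ℕ._+ tgt lo) eN) (≤S⇒≤bound (ℕ.≤-trans (ℕ.+-monoʳ-≤ N (ℕ.≤-trans (ℕ.<⇒≤ (tgt<n lo<m)) n≤N)) N+N≤S)) $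
      mul! refl (cong ((N ℕ.+ tgt lo) ℕ.*_) eN²) (≤S⇒≤bound (ℕ.≤-trans (ℕ.m≤m+n _ lo) leaf≤S)) $
      add! {z = leaf lo} refl refl (≤S⇒≤bound leaf≤S) $
      add! refl (cong (ℕ._+ leaf lo) eb) (node≤bound leaf≤S) $
      loadᵂ! refl refl (wt-read input lo<m) $
      addᵂ! refl $
      storeᵂ! refl refl (cong (_+ wt lo) eδ) $
      Runs-map (λ { (all , my , mk , w≤ , s≤) →
          inputʷ (ℕ.+-monoʳ-< targets lo<m) ∷ inputᵂ lo<m ∷ leaves refl lo<m ∷
            All.map (Allowed-map id (λ ()) (λ _ ())) all
          , there (there (here refl))
          , Marked-read (Marked-read (Marked-write my mk))
          , ℕ.+-monoʳ-≤ 9 w≤ , ℕ.+-monoʳ-≤ 9 s≤ }) $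
      mark-runs H env refl (ℕ.≤-trans (ℕ.≤-trans 1≤N N≤N³) (N³≤leaf lo)) (subst (leaf lo ℕ.<_) S≡2^H (leaf<S lo<m)) (leaf<S lo<m)
      where
      leaf≤S = ℕ.<⇒≤ (leaf<S lo<m)

    edges-runs⁺ : ∀ f {lo len δ ρ ω M} → Env base ρ → ρ loʳ ≡ lo → ρ hiʳ ≡ lo ℕ.+ len → ω aᵂ ≡ δ →
                  1 ℕ.≤ len → len ℕ.≤ 2 ^ f → lo ℕ.+ len ℕ.≤ m → Input M →
                  (∀ {j} → Range lo (lo ℕ.+ len) j → dist (src j) ≡ δ) →
                  Runs (thread EDGES ρ ω) M (InsertsRange lo (lo ℕ.+ len) (len ℕ.* Γ) (β ℕ.+ f ℕ.* 9))
    edges-runs⁺ f {lo} {len} {δ} {ρ} {ω} {M} env@(e0 , e1 , e2 , _) refl ehi eδ 1≤len len≤ hi≤m input eqδ =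
      jump≤-no! refl (subst (lo ℕ.<_) (sym ehi) lo<hi) $
      add! {z = suc lo} refl (trans (cong (lo ℕ.+_) e1) (ℕ.+-comm lo 1))
           (≤S⇒≤bound (ℕ.≤-trans lo<hi (ℕ.≤-trans hi≤m m≤S))) $
      (case 2 ℕ.≤? len of λ where
        (no p) → singleton (ℕ.≤-antisym (ℕ.≤-pred (ℕ.≰⇒> p)) 1≤len)
        (yes p) →
          jump≤-no! refl (subst (suc lo ℕ.<_) (sym ehi) (subst (ℕ._≤ lo ℕ.+ len) (ℕ.+-comm lo 2) (ℕ.+-monoʳ-≤ lo p))) $
          add! {z = lo ℕ.+ (lo ℕ.+ len)} refl (cong (lo ℕ.+_) ehi)
               (≤S⇒≤bound (ℕ.≤-trans (ℕ.+-mono-≤ (ℕ.≤-trans (ℕ.m≤m+n lo len) hi≤m) hi≤m) m+m≤S)) $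
          half! refl e2 (half-mid lo len) $
          halves f p len≤)
      where
      lo<hi : lo ℕ.< lo ℕ.+ len
      lo<hi = subst (ℕ._≤ lo ℕ.+ len) (ℕ.+-comm lo 1) (ℕ.+-monoʳ-≤ lo 1≤len)

      post : ℕ → Log → ℕ → ℕ → Set c
      post f = InsertsRange lo (lo ℕ.+ len) (len ℕ.* Γ) (β ℕ.+ f ℕ.* 9)

      singleton : len ≡ 1 → Runs (thread 95 (ρ [ tʳ ≔ suc lo ]) ω) M (tick (tick (post f)))
      singleton len≡1 =
        jump≤-yes! refl (ℕ.≤-reflexive (trans ehi hi≡)) $
        Runs-map inserted $
        insert-runs env refl (trans eδ (sym (eqδ (ℕ.≤-refl , lo<hi)))) (ℕ.<-≤-trans lo<hi hi≤m) input
        where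
        hi≡ : lo ℕ.+ len ≡ suc lo
        hi≡ = trans (cong (lo ℕ.+_) len≡1) (ℕ.+-comm lo 1)
        inserted : ∀ {l w s} →
                   All (Allowed ∅ ∅ (lo ≡_)) l × relax lo ∈ l × Marked l × w ℕ.≤ 10 ℕ.+ H ℕ.* 4 × s ℕ.≤ 10 ℕ.+ H ℕ.* 4 →
                   post f l (3 ℕ.+ w) (3 ℕ.+ s)
        inserted {l} {w} (all , my , mk , w≤ , s≤) =
          All.map (Allowed-map id id λ _ lo≡j → ℕ.≤-reflexive lo≡j , subst (ℕ._< lo ℕ.+ len) lo≡j lo<hi) all
          , (λ j (lo≤j , j<hi) → subst (λ j → relax j ∈ l) (ℕ.≤-antisym lo≤j (ℕ.≤-pred (ℕ.<-≤-trans j<hi (ℕ.≤-reflexive hi≡)))) my)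
          , mk
          , subst (λ len → 3 ℕ.+ w ℕ.+ 11 ℕ.≤ len ℕ.* Γ) (sym len≡1) (single-work (10 ℕ.+ H ℕ.* 4) w≤)
          , single-span (10 ℕ.+ H ℕ.* 4) (f ℕ.* 9) s≤

      halves : ∀ f → 2 ℕ.≤ len → len ℕ.≤ 2 ^ f →
               Runs (thread 98 (ρ [ tʳ ≔ suc lo ] [ tʳ ≔ lo ℕ.+ (lo ℕ.+ len) ] [ tʳ ≔ lo ℕ.+ len ℕ./ 2 ]) ω) M
                 (tick (tick (tick (tick (tick (post f))))))
      halves zero p q = ⊥-elim (ℕ.<⇒≱ p q)
      halves (suc f) p q =
        fork! {Q₁ = InsertsRange lo mid (2 ℕ.+ a ℕ.* Γ) (2 ℕ.+ (β ℕ.+ f ℕ.* 9))}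
              {Q₂ = λ _ → InsertsRange mid (mid ℕ.+ b) (2 ℕ.+ b ℕ.* Γ) (2 ℕ.+ (β ℕ.+ f ℕ.* 9))} refl
          (sub! refl (cong (mid ℕ.∸_) e0) $
           jump! refl $
           Runs-map (λ { (all , my , mk , w≤ , s≤) → all , my , mk , ℕ.+-monoʳ-≤ 2 w≤ , ℕ.+-monoʳ-≤ 2 s≤ }) $
           edges-runs⁺ f {lo} {a} env refl refl eδ 1≤a a≤ (ℕ.≤-trans (ℕ.m≤m+n mid b) hi≤m′) input
             λ where (x , y) → eqδ (x , ℕ.<-≤-trans y mid≤))
          (λ where
            (all , _) →
              sub! refl (cong (mid ℕ.∸_) e0) $
              jump! refl $
              Runs-map (λ { (all , my , mk , w≤ , s≤) → all , my , mk , ℕ.+-monoʳ-≤ 2 w≤ , ℕ.+-monoʳ-≤ 2 s≤ }) $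
              edges-runs⁺ f {mid} {b} env refl (trans ehi hi≡) eδ 1≤b b≤ hi≤m′ (Input-apply (All.map Static-allowed all) input)
                λ where (x , y) → eqδ (ℕ.≤-trans (ℕ.m≤m+n lo a) x , ℕ.<-≤-trans y (ℕ.≤-reflexive (sym hi≡))))
          (λ (all₁ , _) (all₂ , _) → allowed-independent (λ ()) (λ ()) (λ ()) (λ ()) (λ ())
              (λ where (_ , j<) (≤j , _) → ℕ.<⇒≱ j< ≤j) all₁ all₂)
          (λ {l₁} {w₁} {s₁} {l₂} {w₂} {s₂} (all₁ , my₁ , mk₁ , w₁≤ , s₁≤) (all₂ , my₂ , mk₂ , w₂≤ , s₂≤) → halt! refl $
              All.++⁺ (All.map (Allowed-map id id λ where _ (x , y) → x , ℕ.<-≤-trans y mid≤) all₁)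
                      (All.++⁺ (All.map (Allowed-map id id λ where _ (x , y) → ℕ.≤-trans (ℕ.m≤m+n lo a) x , ℕ.<-≤-trans y (ℕ.≤-reflexive (sym hi≡))) all₂) [])
              , (λ j (x , y) → case suc j ℕ.≤? mid of λ where
                    (yes j<) → ∈-++⁺ˡ (my₁ j (x , j<))
                    (no j≮)  → ∈-++⁺ʳ l₁ (∈-++⁺ˡ (my₂ j (ℕ.≮⇒≥ j≮ , subst (j ℕ.<_) hi≡ y))))
              , Marked-++ mk₁ (Marked-++ mk₂ Marked-[])
              , subst (λ z → 5 ℕ.+ suc (w₁ ℕ.+ w₂ ℕ.+ 1) ℕ.+ 11 ℕ.≤ z)
                  (trans (sym (ℕ.*-distribʳ-+ Γ a b)) (cong (ℕ._* Γ) (sym len≡)))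
                  (work-fork {w₁} {w₂} w₁≤ w₂≤)
              , span-fork {s₁} {s₂} β f s₁≤ s₂≤)
        where
        open Bisection (bisect len f p q)
        a = len ℕ./ 2
        mid = lo ℕ.+ a
        hi≡ : lo ℕ.+ len ≡ mid ℕ.+ b
        hi≡ = trans (cong (lo ℕ.+_) len≡) (sym (ℕ.+-assoc lo a b))
        hi≤m′ : mid ℕ.+ b ℕ.≤ m
        hi≤m′ = subst (ℕ._≤ m) hi≡ hi≤m
        mid≤ : mid ℕ.≤ lo ℕ.+ len
        mid≤ = subst (mid ℕ.≤_) (sym hi≡) (ℕ.m≤m+n mid b)

    edges-runs : ∀ {lo hi δ ρ ω M} → Env base ρ → ρ loʳ ≡ lo → ρ hiʳ ≡ hi → ω aᵂ ≡ δ →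
                 lo ℕ.≤ hi → hi ℕ.≤ m → Input M →
                 (∀ {j} → Range lo hi j → dist (src j) ≡ δ) →
                 Runs (thread EDGES ρ ω) M λ l w s →
                   All (Allowed ∅ ∅ (Range lo hi)) l × (∀ j → Range lo hi j → relax j ∈ l) × Marked l ×
                   w ℕ.≤ 2 ℕ.+ (hi ℕ.∸ lo) ℕ.* Γ × s ℕ.≤ β ℕ.+ (h ℕ.+ h) ℕ.* 9
    edges-runs {lo} {hi} {ρ = ρ} env elo ehi eδ lo≤hi hi≤m input eqδ with ℕ.m≤n⇒m<n∨m≡n lo≤hi
    ... | inj₂ refl =
      jump≤-yes! refl (ℕ.≤-reflexive (trans ehi (sym elo))) $
      halt! refl ([] , (λ _ (x , y) → ⊥-elim (ℕ.<⇒≱ y x)) , Marked-[] , ℕ.m≤m+n 2 _ , s≤s (s≤s z≤n))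
    ... | inj₁ lo<hi =
      Runs-map (λ {l} {w} (all , my , mk , w≤ , s≤) →
          subst (λ hi → All (Allowed ∅ ∅ (Range lo hi)) l) hi≡ all
          , (λ j r → my j (subst (λ hi → Range lo hi j) (sym hi≡) r))
          , mk , ℕ.≤-trans (ℕ.≤-trans (ℕ.m≤m+n w 11) w≤) (ℕ.m≤n+m _ 2) , s≤) $
      edges-runs⁺ (h ℕ.+ h) env elo (trans ehi (sym hi≡)) eδ (ℕ.m<n⇒0<n∸m lo<hi)
        (ℕ.≤-trans (ℕ.m∸n≤m hi lo) (ℕ.≤-trans hi≤m (ℕ.≤-trans m≤N² (ℕ.≤-reflexive N²≡2^))))
        (subst (ℕ._≤ m) (sym hi≡) hi≤m) input (λ (x , y) → eqδ (x , ℕ.<-≤-trans y (ℕ.≤-reflexive hi≡)))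
      where
      hi≡ : lo ℕ.+ (hi ℕ.∸ lo) ≡ hi
      hi≡ = ℕ.m+[n∸m]≡n lo≤hi

  module Settlement (base : ℕ) (first≤base : first ℕ.≤ base) (base+S≤bound : base ℕ.+ S ℕ.≤ bound)
                    (dist : ℕ → Carrier) (closing : Carrier) where
    open Relaxation base first≤base base+S≤bound dist closing public

    deg : ℕ → ℕ
    deg v = off (suc v) ℕ.∸ off v

    record Settled (v : ℕ) (l : Log) : Set c where
      field
        result∈ : write (weightCell (m ℕ.+ v)) (weight (dist v)) ∈ l
        close∈  : write (node (N ℕ.+ v)) (weight closing) ∈ l
        relax∈  : ∀ j → j ℕ.< m → src j ≡ v → relax j ∈ l

    open Settled public

    Settled-++ˡ : ∀ {v l l′} → Settled v l → Settled v (l ++ l′)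
    Settled-++ˡ s = record { result∈ = ∈-++⁺ˡ (result∈ s) ; close∈ = ∈-++⁺ˡ (close∈ s)
                           ; relax∈ = λ j p q → ∈-++⁺ˡ (relax∈ s j p q) }

    Settled-++ʳ : ∀ {v} l {l′} → Settled v l′ → Settled v (l ++ l′)
    Settled-++ʳ l s = record { result∈ = ∈-++⁺ʳ l (result∈ s) ; close∈ = ∈-++⁺ʳ l (close∈ s)
                             ; relax∈ = λ j p q → ∈-++⁺ʳ l (relax∈ s j p q) }

    record Settles (v W B : ℕ) (l : Log) (w s : ℕ) : Set c where
      field
        allowed : All (Allowed ∅ (_≡ v) (λ j → src j ≡ v)) l
        settled : Settled v l
        marked  : Marked l
        work≤   : w ℕ.≤ W
        span≤   : s ℕ.≤ B

    open Settles

    private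
      settle-work : ∀ {w₁ w₂} d → w₁ ℕ.≤ 3 ℕ.+ H ℕ.* 4 → w₂ ℕ.≤ 2 ℕ.+ d ℕ.* Γ →
                    9 ℕ.+ suc (w₁ ℕ.+ w₂ ℕ.+ 1) ℕ.≤ suc d ℕ.* Γ
      settle-work {w₁} {w₂} d p q = ℕ.≤-trans (ℕ.+-monoʳ-≤ 10 (ℕ.+-monoˡ-≤ 1 (ℕ.+-mono-≤ p q)))
        (ℕ.≤-trans (ℕ.m≤n+m _ 8) (ℕ.≤-reflexive (eq (H ℕ.* 4) (d ℕ.* Γ))))
        where
        eq : ∀ x y → 8 ℕ.+ (10 ℕ.+ (3 ℕ.+ x ℕ.+ (2 ℕ.+ y) ℕ.+ 1)) ≡ 13 ℕ.+ x ℕ.+ 11 ℕ.+ y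
        eq = solve-∀

      settle-span : ∀ {s₁ s₂} → s₁ ℕ.≤ 3 ℕ.+ H ℕ.* 4 → s₂ ℕ.≤ β ℕ.+ (h ℕ.+ h) ℕ.* 9 →
                    9 ℕ.+ suc (s₁ ℕ.⊔ s₂ ℕ.+ 1) ℕ.≤ σ
      settle-span {s₁} {s₂} p q = ℕ.≤-trans
        (ℕ.+-monoʳ-≤ 10 (ℕ.+-monoˡ-≤ 1 (ℕ.⊔-lub (ℕ.≤-trans p (ℕ.≤-trans (ℕ.+-monoˡ-≤ (H ℕ.* 4) (ℕ.m≤m+n 3 10)) (ℕ.m≤m+n β _))) q)))
        (ℕ.≤-reflexive (cong (10 ℕ.+_) (ℕ.+-comm _ 1)))

    settle-runs : ∀ {v ρ ω M} → v ℕ.< n → Env base ρ → ρ xʳ ≡ N ℕ.+ v → ω aᵂ ≡ dist v → ω closedᵂ ≡ closing → Input M →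
                  Runs (thread SETTLE ρ ω) M (Settles v (suc (deg v) ℕ.* Γ) σ)
    settle-runs {v} {ρ} {ω} {M} v<n env@(e0 , e1 , e2 , e3 , em , eN , _ , _ , _ , eb) ex ea ec input =
      sub! refl (trans (cong₂ ℕ._∸_ ex eN) (ℕ.m+n∸m≡n N v)) $
      add! {z = 3 ℕ.+ v} refl (cong (ℕ._+ v) e3) (ℕ.≤-trans (ℕ.n≤1+n _) v+4≤bound) $
      load! refl refl (off-read input (ℕ.<⇒≤ v<n)) $
      add! {z = 3 ℕ.+ suc v} refl (trans (cong (3 ℕ.+ v ℕ.+_) e1) (ℕ.+-comm (3 ℕ.+ v) 1)) v+4≤bound $
      load! refl refl (off-read input v<n) $
      add! {z = m ℕ.+ v} refl (cong (ℕ._+ v) em) (ℕ.≤-trans (ℕ.<⇒≤ (output<base v<n)) base≤bound) $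
      storeᵂ! refl refl ea $
      add! {z = base ℕ.+ (N ℕ.+ v)} refl (cong₂ ℕ._+_ eb ex) (node≤bound (ℕ.<⇒≤ x<S)) $
      storeᵂ! refl refl ec $
      fork! {Q₁ = λ l w s → All (Allowed ∅ ∅ ∅) l × mark (N ℕ.+ v) ∈ l × Marked l × w ℕ.≤ 3 ℕ.+ H ℕ.* 4 × s ℕ.≤ 3 ℕ.+ H ℕ.* 4}
            {Q₂ = λ _ l w s → All (Allowed ∅ ∅ (Range lo hi)) l × (∀ j → Range lo hi j → relax j ∈ l) × Marked l ×
                   w ℕ.≤ 2 ℕ.+ (hi ℕ.∸ lo) ℕ.* Γ × s ℕ.≤ β ℕ.+ (h ℕ.+ h) ℕ.* 9} refl
        (sub! {z = N ℕ.+ v} refl (cong₂ ℕ._∸_ ex e0) $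
         jump! refl $
         Runs-map (λ { (all , my , mk , w≤ , s≤) → all , my , mk , ℕ.+-monoʳ-≤ 2 w≤ , ℕ.+-monoʳ-≤ 2 s≤ }) $
         mark-runs H env refl (ℕ.≤-trans 1≤N (ℕ.m≤m+n N v)) (subst (N ℕ.+ v ℕ.<_) S≡2^H x<S) x<S)
        (λ (all , _) → edges-runs env refl refl ea (off-mono v<n) (off≤m v<n)
           (Input-apply (All.map Static-allowed all) (Input-apply (Static-allowed writes-out ∷ Static-allowed writes-node ∷ []) input))
           λ (x , y) → cong dist (src-unique (ℕ.<-≤-trans y (off≤m v<n)) v<n x y))
        (λ (all₁ , _) (all₂ , _) → allowed-independent (λ ()) (λ ()) (λ ()) (λ ()) (λ ()) (λ ()) all₁ all₂)
        (λ {l₁} {w₁} {s₁} {l₂} {w₂} {s₂} (all₁ , my₁ , mk₁ , w₁≤ , s₁≤) (all₂ , my₂ , mk₂ , w₂≤ , s₂≤) → halt! refl $ record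
          { allowed = inputʷ (ℕ.≤-trans (ℕ.+-monoʳ-≤ 4 (ℕ.<⇒≤ v<n)) (ℕ.m≤m+n targets m))
                    ∷ inputʷ (ℕ.≤-trans (ℕ.+-monoʳ-≤ 4 v<n) (ℕ.m≤m+n targets m))
                    ∷ result refl v<n ∷ close refl v<n
                    ∷ All.++⁺ (All.map (Allowed-map id (λ ()) (λ _ ())) all₁)
                        (All.++⁺ (All.map (Allowed-map id (λ ()) λ j<m (x , y) → src-unique j<m v<n x y) all₂) [])
          ; settled = record
              { result∈ = there (there (here refl))
              ; close∈ = there (there (there (here refl)))
              ; relax∈ = λ j j<m eq → there (there (there (there (∈-++⁺ʳ l₁ (∈-++⁺ˡ (my₂ j
                  (subst (λ v → Range (off v) (off (suc v)) j) eq (off-src j<m))))))))  }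
          ; marked = Marked-read (Marked-read (Marked-output (output<base v<n)
              (Marked-write (∈-++⁺ˡ my₁) (Marked-++ mk₁ (Marked-++ mk₂ Marked-[])))))
          ; work≤ = settle-work {w₁} {w₂} (deg v) w₁≤ w₂≤
          ; span≤ = settle-span {s₁} {s₂} s₁≤ s₂≤ })
      where
      lo = off v
      hi = off (suc v)
      x<S : N ℕ.+ v ℕ.< S
      x<S = ℕ.<-≤-trans (vertex<N+N v<n) N+N≤S
      v+4≤bound : 4 ℕ.+ v ℕ.≤ bound
      v+4≤bound = ℕ.≤-trans (ℕ.+-monoʳ-≤ 4 (ℕ.<⇒≤ v<n)) (ℕ.≤-trans (ℕ.≤-trans (ℕ.m≤m+n targets m) first≤base) base≤bound)
      writes-out : Allowed ∅ (_≡ v) ∅ (write (weightCell (m ℕ.+ v)) (weight (dist v)))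
      writes-out = result refl v<n
      writes-node : Allowed ∅ (_≡ v) ∅ (write (node (N ℕ.+ v)) (weight closing))
      writes-node = close refl v<n

  module Extraction (base : ℕ) (first≤base : first ℕ.≤ base) (base+S≤bound : base ℕ.+ S ℕ.≤ bound)
                    (g : ℕ → Carrier) (limit closing : Carrier) where
    open Settlement base first≤base base+S≤bound (λ v → g (N ℕ.+ v)) closing public

    Live : ℕ → Set ℓ₂
    Live z = ¬ g z ≤ 0# × g z ≤ limit

    live? : ∀ z → Dec (Live z)
    live? z with g z ≤? 0# | g z ≤? limit
    ... | yes p | _     = no λ (q , _) → q p
    ... | no p  | yes q = yes (p , q)
    ... | no p  | no q  = no λ (_ , r) → q r

    record Heap : Set ℓ₂ where
      field
        live-up   : ∀ {z} → 1 ℕ.≤ z → z ℕ.< N → Live (z ℕ.+ z) ⊎ Live (suc (z ℕ.+ z)) → Live z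
        live-down : ∀ {z} → 1 ℕ.≤ z → z ℕ.< N → Live z → Live (z ℕ.+ z) ⊎ Live (suc (z ℕ.+ z))
        live-leaf : ∀ {v} → v ℕ.< N → Live (N ℕ.+ v) → v ℕ.< n

    cost : ℕ → ℕ
    cost z = if does (live? z) then suc (deg (z ℕ.∸ N)) else 0

    cost-live : ∀ {z} → Live z → cost z ≡ suc (deg (z ℕ.∸ N))
    cost-live {z} p = cong (if_then suc (deg (z ℕ.∸ N)) else 0) (dec-true (live? z) p)

    cost-dead : ∀ {z} → ¬ Live z → cost z ≡ 0
    cost-dead {z} p = cong (if_then suc (deg (z ℕ.∸ N)) else 0) (dec-false (live? z) p)

    Below : ℕ → ℕ → Set ℓ₂
    Below x v = Under x (N ℕ.+ v) × Live (N ℕ.+ v)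

    Top : ℕ → ℕ → Set
    Top x z = Under x z × z ℕ.< N ℕ.+ N

    record Extracts (x k W B : ℕ) (l : Log) (w s : ℕ) : Set (c Level.⊔ ℓ₂) where
      field
        allowed : All (Allowed (Top x) (Below x) (Below x ∘ src)) l
        settled : ∀ v → Desc k x (N ℕ.+ v) → Live (N ℕ.+ v) → Settled v l
        marked  : Marked l
        work≤   : w ℕ.≤ W
        span≤   : s ℕ.≤ B

    extractWork extractSpan : ℕ → ℕ → ℕ
    extractWork k x = 5 ℕ.+ treeSum k x cost ℕ.* (Γ ℕ.+ k ℕ.* 17)
    extractSpan k x = 5 ℕ.+ σ ℕ.+ k ℕ.* 10

    not-written : ∀ {p R} {V J : ℕ → Set p} {l z} → All (Allowed R V J) l → z ℕ.< N ℕ.+ N → (∀ {v} → V v → z ≢ N ℕ.+ v) →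
                  ∀ u → ¬ write (node z) u ∈ l
    not-written {R = R} {V} {J} {z = z} all z< V# u w = go (All.lookup all w) refl
      where
      go : ∀ {x u} → Allowed R V J (write x u) → x ≢ node z
      go (result _ y) eq       = weight≢ (below (output<base y)) eq
      go (close x _) eq        = V# x (sym (node-injective eq))
      go (leaves {j} _ _) eq   = top≢leaf {j = j} z< (sym (node-injective eq))

    module _ (heap : Heap) where
      open Heap heap

      live-ancestor : ∀ k {x z} → 1 ℕ.≤ x → Row N k x → Desc k x z → Live z → Live x
      live-ancestor zero 1≤x r d p = subst Live (Desc-zero d) p
      live-ancestor (suc k) {x} 1≤x r d p with Desc-suc k d
      ... | inj₁ d′ = live-up 1≤x (Row-suc k r) (inj₁ (live-ancestor k (ℕ.≤-trans 1≤x (ℕ.m≤m+n x x)) (Row-even k r) d′ p))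
      ... | inj₂ d′ = live-up 1≤x (Row-suc k r) (inj₂ (live-ancestor k (s≤s z≤n) (Row-odd k r) d′ p))

      cost-positive : ∀ k {x} → 1 ℕ.≤ x → Row N k x → Live x → 1 ℕ.≤ treeSum k x cost
      cost-positive zero 1≤x r p = subst (1 ℕ.≤_) (sym (cost-live p)) (s≤s z≤n)
      cost-positive (suc k) {x} 1≤x r p with live-down 1≤x (Row-suc k r) p
      ... | inj₁ p′ = ℕ.≤-trans (cost-positive k (ℕ.≤-trans 1≤x (ℕ.m≤m+n x x)) (Row-even k r) p′) (ℕ.m≤m+n _ _)
      ... | inj₂ p′ = ℕ.≤-trans (cost-positive k (s≤s z≤n) (Row-odd k r) p′) (ℕ.m≤n+m _ _)

      private
        fork-work : ∀ {w₁ w₂} a b k → w₁ ℕ.≤ 2 ℕ.+ (5 ℕ.+ a ℕ.* (Γ ℕ.+ k ℕ.* 17)) → w₂ ℕ.≤ 3 ℕ.+ (5 ℕ.+ b ℕ.* (Γ ℕ.+ k ℕ.* 17)) →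
                    1 ℕ.≤ a ℕ.+ b → 5 ℕ.+ suc (w₁ ℕ.+ w₂ ℕ.+ 1) ℕ.≤ 5 ℕ.+ (a ℕ.+ b) ℕ.* (Γ ℕ.+ suc k ℕ.* 17)
        fork-work {w₁} {w₂} a b k p q 1≤ = ℕ.+-monoʳ-≤ 5 (begin
          suc (w₁ ℕ.+ w₂ ℕ.+ 1)                                             ≤⟨ ℕ.+-monoʳ-≤ 1 (ℕ.+-monoˡ-≤ 1 (ℕ.+-mono-≤ p q)) ⟩
          suc (2 ℕ.+ (5 ℕ.+ a ℕ.* e) ℕ.+ (3 ℕ.+ (5 ℕ.+ b ℕ.* e)) ℕ.+ 1)       ≡⟨ eq₁ a b e ⟩
          (a ℕ.+ b) ℕ.* e ℕ.+ 1 ℕ.* 17                                       ≤⟨ ℕ.+-monoʳ-≤ ((a ℕ.+ b) ℕ.* e) (ℕ.*-monoˡ-≤ 17 1≤) ⟩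
          (a ℕ.+ b) ℕ.* e ℕ.+ (a ℕ.+ b) ℕ.* 17                               ≡⟨ eq₂ (a ℕ.+ b) Γ k ⟩
          (a ℕ.+ b) ℕ.* (Γ ℕ.+ suc k ℕ.* 17)                                 ∎)
          where
          open ℕ.≤-Reasoning
          e = Γ ℕ.+ k ℕ.* 17
          eq₁ : ∀ a b e → suc (2 ℕ.+ (5 ℕ.+ a ℕ.* e) ℕ.+ (3 ℕ.+ (5 ℕ.+ b ℕ.* e)) ℕ.+ 1) ≡ (a ℕ.+ b) ℕ.* e ℕ.+ 1 ℕ.* 17
          eq₁ = solve-∀
          eq₂ : ∀ t g k → t ℕ.* (g ℕ.+ k ℕ.* 17) ℕ.+ t ℕ.* 17 ≡ t ℕ.* (g ℕ.+ suc k ℕ.* 17)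
          eq₂ = solve-∀

        fork-span : ∀ {s₁ s₂} e k → s₁ ℕ.≤ 2 ℕ.+ (e ℕ.+ k ℕ.* 10) → s₂ ℕ.≤ 3 ℕ.+ (e ℕ.+ k ℕ.* 10) →
                    5 ℕ.+ suc (s₁ ℕ.⊔ s₂ ℕ.+ 1) ℕ.≤ e ℕ.+ suc k ℕ.* 10
        fork-span {s₁} {s₂} e k p q = ℕ.≤-trans
          (ℕ.+-monoʳ-≤ 6 (ℕ.+-monoˡ-≤ 1 (ℕ.⊔-lub (ℕ.≤-trans p (ℕ.n≤1+n _)) q))) (ℕ.≤-reflexive (eq e k))
          where
          eq : ∀ e k → 6 ℕ.+ (3 ℕ.+ (e ℕ.+ k ℕ.* 10) ℕ.+ 1) ≡ e ℕ.+ suc k ℕ.* 10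
          eq = solve-∀

      extract-runs : ∀ k {x ρ ω M} → Env base ρ → ρ xʳ ≡ x → 1 ℕ.≤ x → Row N k x →
                     ω 0ᵂ ≡ 0# → ω closedᵂ ≡ closing → ω limitᵂ ≡ limit →
                     Input M → (∀ z → Top x z → weights M (base ℕ.+ z) ≡ g z) →
                     Runs (thread EXTRACT ρ ω) M (Extracts x k (extractWork k x) (extractSpan k x))
      extract-runs k {x} {ρ} {ω} {M} env@(e0 , e1 , e2 , e3 , em , eN , _ , _ , _ , eb) refl 1≤x r eZ eC eL input agree =
        add! refl (cong (ℕ._+ x) eb) (node≤bound (ℕ.≤-trans (ℕ.<⇒≤ x<N+N) N+N≤S)) $
        loadᵂ! refl refl (agree x (Under-refl x , x<N+N)) $
        (case g x ≤? 0# of λ where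
          (yes p) → jump≤ᵂ-yes! refl (subst (g x ≤_) (sym eZ) p) $ halt! refl $ skip (λ q → proj₁ q p) (s≤s (s≤s (s≤s (s≤s z≤n)))) (s≤s (s≤s (s≤s (s≤s z≤n))))
          (no p) → jump≤ᵂ-no! refl (λ q → p (subst (g x ≤_) eZ q)) $
            (case g x ≤? limit of λ where
              (no q) → jump≤ᵂ-no! refl (λ q′ → q (subst (g x ≤_) eL q′)) $ halt! refl $ skip (λ z → q (proj₂ z)) (s≤s (s≤s (s≤s (s≤s (s≤s z≤n))))) (s≤s (s≤s (s≤s (s≤s (s≤s z≤n)))))
              (yes q) → jump≤ᵂ-yes! refl (subst (g x ≤_) (sym eL) q) $ descend k r (p , q)))
        where
        x<N+N = Row-< k r

        top-read : Allowed (Top x) (Below x) (Below x ∘ src) (read (node x))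
        top-read = nodes (Under-refl x , x<N+N)

        skip : ¬ Live x → ∀ {w s} → w ℕ.≤ 5 → s ℕ.≤ 5 → Extracts x k (extractWork k x) (extractSpan k x) (read (node x) ∷ []) w s
        skip dead w≤ s≤ = record
          { allowed = top-read ∷ []
          ; settled = λ v d p → ⊥-elim (dead (live-ancestor k 1≤x r d p))
          ; marked  = Marked-read Marked-[]
          ; work≤   = ℕ.≤-trans w≤ (ℕ.m≤m+n 5 _)
          ; span≤   = ℕ.≤-trans s≤ (ℕ.m≤m+n 5 _) }

        descend : ∀ k → Row N k x → Live x →
                  Runs (thread DESCEND (ρ [ pʳ ≔ base ℕ.+ x ]) (ω [ aᵂ ≔ g x ])) M
                    λ l w s → Extracts x k (extractWork k x) (extractSpan k x) (read (node x) ∷ l) (4 ℕ.+ w) (4 ℕ.+ s)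
        descend zero r live =
          jump≤-yes! refl (subst (ℕ._≤ x) (sym eN) N≤x) $
          Runs-map single $
          settle-runs (live-leaf (ℕ.+-cancelˡ-< N _ _ (subst (ℕ._< N ℕ.+ N) (sym x≡) x<N+N)) (subst Live (sym x≡) live)) env (sym x≡) (cong g (sym x≡)) eC input
          where
          open Settles
          N≤x = Row-zero r
          x≡ : N ℕ.+ (x ℕ.∸ N) ≡ x
          x≡ = ℕ.m+[n∸m]≡n N≤x
          below′ : Below x (x ℕ.∸ N)
          below′ = subst (Under x) (sym x≡) (Under-refl x) , subst Live (sym x≡) live
          vertex : ∀ {v} → Desc 0 x (N ℕ.+ v) → v ≡ x ℕ.∸ N
          vertex {v} d = trans (sym (ℕ.m+n∸m≡n N v)) (cong (ℕ._∸ N) (Desc-zero d))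
          there′ : ∀ {v e l} → Settled v l → Settled v (e ∷ l)
          there′ s = Settled-++ʳ (_ ∷ []) s
          single : ∀ {l w s} → Settles (x ℕ.∸ N) (suc (deg (x ℕ.∸ N)) ℕ.* Γ) σ l w s →
                   Extracts x zero (extractWork zero x) (extractSpan zero x) (read (node x) ∷ l) (5 ℕ.+ w) (5 ℕ.+ s)
          single e = record
            { allowed = top-read ∷ All.map (Allowed-map (λ ()) (λ eq → subst (Below x) (sym eq) below′) (λ _ eq → subst (Below x) (sym eq) below′)) (allowed e)
            ; settled = λ v d p → there′ (subst (λ v → Settled v _) (sym (vertex d)) (settled e))
            ; marked  = Marked-read (marked e)
            ; work≤   = ℕ.+-monoʳ-≤ 5 (ℕ.≤-trans (work≤ e) (ℕ.≤-reflexive (cong₂ ℕ._*_ (sym (cost-live live)) (sym (ℕ.+-identityʳ Γ)))))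
            ; span≤   = ℕ.≤-trans (ℕ.+-monoʳ-≤ 5 (span≤ e)) (ℕ.m≤m+n (5 ℕ.+ σ) 0) }
        descend (suc k) r live =
          jump≤-no! refl (subst (x ℕ.<_) (sym eN) x<N) $
          fork! {Q₁ = Extracts (x ℕ.+ x) k (2 ℕ.+ extractWork k (x ℕ.+ x)) (2 ℕ.+ extractSpan k (x ℕ.+ x))}
                {Q₂ = λ _ → Extracts (suc (x ℕ.+ x)) k (3 ℕ.+ extractWork k (suc (x ℕ.+ x))) (3 ℕ.+ extractSpan k (suc (x ℕ.+ x)))} refl
            (add! refl refl x+x≤bound $
             jump! refl $
             Runs-map (slower 2) $
             extract-runs k env refl (ℕ.≤-trans 1≤x (ℕ.m≤m+n x x)) (Row-even k r) eZ eC eL input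
               λ z (u , z<) → agree z (Under-even u , z<))
            (λ {l₁} e₁ →
             add! refl refl x+x≤bound $
             add! {z = suc (x ℕ.+ x)} refl (trans (cong (x ℕ.+ x ℕ.+_) e1) (ℕ.+-comm (x ℕ.+ x) 1)) x+x+1≤bound $
             jump! refl $
             Runs-map (slower 3) $
             extract-runs k env refl (s≤s z≤n) (Row-odd k r) eZ eC eL (Input-apply (All.map Static-allowed (allowed e₁)) input)
               λ z (u , z<) → trans (weights-other l₁ M (not-written (allowed e₁) z< λ where (u′ , _) refl → Under-disjoint 1≤x u′ u))
                                    (agree z (Under-odd u , z<)))
            (λ e₁ e₂ → allowed-independent proj₂ proj₂
               (λ (u , _) (u′ , _) → Under-disjoint 1≤x u u′) (λ (u , _) (u′ , _) → Under-disjoint 1≤x u u′)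
               (λ (u , _) (u′ , _) → Under-disjoint 1≤x u u′) (λ (u , _) (u′ , _) → Under-disjoint 1≤x u u′)
               (allowed e₁) (allowed e₂))
            λ {l₁} {w₁} {s₁} {l₂} {w₂} {s₂} e₁ e₂ → halt! refl record
              { allowed = top-read ∷ All.++⁺ (All.map (Allowed-map (λ (u , z<) → Under-even u , z<) (λ (u , p) → Under-even u , p) (λ _ (u , p) → Under-even u , p)) (allowed e₁))
                  (All.++⁺ (All.map (Allowed-map (λ (u , z<) → Under-odd u , z<) (λ (u , p) → Under-odd u , p) (λ _ (u , p) → Under-odd u , p)) (allowed e₂)) [])
              ; settled = λ v d p → Settled-++ʳ (_ ∷ []) (case Desc-suc k d of λ where
                  (inj₁ d′) → Settled-++ˡ (settled e₁ v d′ p)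
                  (inj₂ d′) → Settled-++ʳ l₁ (Settled-++ˡ (settled e₂ v d′ p)))
              ; marked = Marked-read (Marked-++ (marked e₁) (Marked-++ (marked e₂) Marked-[]))
              ; work≤ = fork-work {w₁} {w₂} (treeSum k (x ℕ.+ x) cost) (treeSum k (suc (x ℕ.+ x)) cost) k (work≤ e₁) (work≤ e₂)
                          (cost-positive (suc k) 1≤x r live)
              ; span≤ = fork-span {s₁} {s₂} (5 ℕ.+ σ) k (span≤ e₁) (span≤ e₂) }
          where
          open Extracts
          x<N = Row-suc k r
          x+x+1≤S : suc (x ℕ.+ x) ℕ.≤ S
          x+x+1≤S = ℕ.≤-trans (ℕ.≤-trans (ℕ.n≤1+n _) (subst (ℕ._≤ N ℕ.+ N) (cong suc (ℕ.+-suc x x)) (ℕ.+-mono-≤ x<N x<N))) N+N≤S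
          x+x+1≤bound = ≤S⇒≤bound x+x+1≤S
          x+x≤bound : x ℕ.+ x ℕ.≤ bound
          x+x≤bound = ℕ.≤-trans (ℕ.n≤1+n _) x+x+1≤bound
          slower : ∀ d {y j W B l w s} → Extracts y j W B l w s → Extracts y j (d ℕ.+ W) (d ℕ.+ B) l (d ℕ.+ w) (d ℕ.+ s)
          slower d e = record { allowed = allowed e ; settled = settled e ; marked = marked e
                              ; work≤ = ℕ.+-monoʳ-≤ d (work≤ e) ; span≤ = ℕ.+-monoʳ-≤ d (span≤ e) }

  module Repair (base : ℕ) (first≤base : first ℕ.≤ base) (base+S≤bound : base ℕ.+ S ℕ.≤ bound) where
    open Tree base first≤base base+S≤bound public

    val : Memory → ℕ → Carrier
    val M z = weights M (base ℕ.+ z)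

    dirt : Memory → ℕ → ℕ
    dirt M z = words M (base ℕ.+ z)

    Tidy : (ℕ → Carrier) → ℕ → Set c
    Tidy g z = g z ≡ pick (g z) (g (z ℕ.+ z)) (g (suc (z ℕ.+ z)))

    count : ℕ → ℕ → Memory → ℕ
    count k x M = treeCount k x (λ z → dirt M z ℕ.⊓ 1)

    Hits : (x a : ℕ) → ℕ → Set
    Hits x a i = (i ≡ 0) ⊎ (i ≡ 1 × ∃[ z ] (Under x z × base ℕ.+ z ≡ a))

    count-set : ∀ k {x} a v M → 1 ℕ.≤ x → ∃[ i ] (count k x (set (wordCell a) v M) ℕ.≤ i ℕ.+ count k x M × Hits x a i)
    count-set k {x} a (word v) M 1≤x = go k 1≤x
      where
      here′ : ∀ x → ∃[ i ] (dirt (set (wordCell a) (word v) M) x ℕ.⊓ 1 ℕ.≤ i ℕ.+ dirt M x ℕ.⊓ 1 ×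
                            ((i ≡ 0) ⊎ (i ≡ 1 × base ℕ.+ x ≡ a)))
      here′ x with base ℕ.+ x ℕ.≟ a
      ... | yes eq = 1 , ℕ.≤-trans (ℕ.m⊓n≤n _ 1) (ℕ.m≤m+n 1 _) , inj₂ (refl , eq)
      ... | no ≢a  = 0 , ℕ.≤-reflexive (cong (λ b → (if b then v else dirt M x) ℕ.⊓ 1) (dec-false (base ℕ.+ x ℕ.≟ a) ≢a)) , inj₁ refl
      swap : ∀ i j k x y z → (i ℕ.+ x) ℕ.+ ((j ℕ.+ y) ℕ.+ (k ℕ.+ z)) ≡ (i ℕ.+ (j ℕ.+ k)) ℕ.+ (x ℕ.+ (y ℕ.+ z))
      swap = solve-∀
      go : ∀ k {x} → 1 ℕ.≤ x → ∃[ i ] (count k x (set (wordCell a) (word v) M) ℕ.≤ i ℕ.+ count k x M × Hits x a i)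
      go zero {x} 1≤x with here′ x
      ... | i , le , inj₁ eq        = i , le , inj₁ eq
      ... | i , le , inj₂ (eq , eq′) = i , le , inj₂ (eq , x , Under-refl x , eq′)
      go (suc k) {x} 1≤x with here′ x | go k {x ℕ.+ x} (ℕ.≤-trans 1≤x (ℕ.m≤m+n x x)) | go k {suc (x ℕ.+ x)} (s≤s z≤n)
      ... | i , le , hi | i₁ , le₁ , hi₁ | i₂ , le₂ , hi₂ =
        i ℕ.+ (i₁ ℕ.+ i₂) , ℕ.≤-trans (ℕ.+-mono-≤ le (ℕ.+-mono-≤ le₁ le₂)) (ℕ.≤-reflexive (swap i i₁ i₂ _ _ _)) , hits hi hi₁ hi₂
        where
        x≢ : ∀ {z} → base ℕ.+ x ≡ a → base ℕ.+ z ≡ a → x ≢ z → ⊥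
        x≢ {z} p q x≢z = x≢z (ℕ.+-cancelˡ-≡ base x z (trans p (sym q)))
        x<2x : x ℕ.< x ℕ.+ x
        x<2x = ℕ.m<m+n x 1≤x
        hits : ((i ≡ 0) ⊎ (i ≡ 1 × base ℕ.+ x ≡ a)) → Hits (x ℕ.+ x) a i₁ → Hits (suc (x ℕ.+ x)) a i₂ → Hits x a (i ℕ.+ (i₁ ℕ.+ i₂))
        hits (inj₁ refl) (inj₁ refl) (inj₁ refl) = inj₁ refl
        hits (inj₁ refl) (inj₁ refl) (inj₂ (refl , z , u , p)) = inj₂ (refl , z , Under-odd u , p)
        hits (inj₁ refl) (inj₂ (refl , z , u , p)) (inj₁ refl) = inj₂ (refl , z , Under-even u , p)
        hits (inj₁ refl) (inj₂ (refl , z , u , p)) (inj₂ (refl , z′ , u′ , p′)) =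
          ⊥-elim (Under-disjoint 1≤x u (subst (Under (suc (x ℕ.+ x))) (ℕ.+-cancelˡ-≡ base z′ z (trans p′ (sym p))) u′))
        hits (inj₂ (refl , p)) (inj₁ refl) (inj₁ refl) = inj₂ (refl , x , Under-refl x , p)
        hits (inj₂ (refl , p)) (inj₂ (_ , z , u , p′)) _ = ⊥-elim (x≢ p p′ λ where refl → ℕ.<⇒≱ x<2x (Under⇒≤ u))
        hits (inj₂ (refl , p)) _ (inj₂ (_ , z , u , p′)) = ⊥-elim (x≢ p p′ λ where refl → ℕ.<⇒≱ x<2x (ℕ.≤-trans (ℕ.n≤1+n _) (Under⇒≤ u)))

    count-apply : ∀ k {x} l M → 1 ℕ.≤ x → count k x (apply l M) ℕ.≤ length l ℕ.+ count k x M
    count-apply k [] M 1≤x = ℕ.≤-refl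
    count-apply k (read _ ∷ l) M 1≤x = ℕ.m≤n⇒m≤1+n (count-apply k l M 1≤x)
    count-apply k (write (weightCell a) (weight v) ∷ l) M 1≤x = ℕ.m≤n⇒m≤1+n (count-apply k l _ 1≤x)
    count-apply k {x} (write (wordCell a) v ∷ l) M 1≤x with count-set k a v M 1≤x
    ... | i , le , hits = begin
      count k x (apply l (set (wordCell a) v M))        ≤⟨ count-apply k l _ 1≤x ⟩
      length l ℕ.+ count k x (set (wordCell a) v M)     ≤⟨ ℕ.+-monoʳ-≤ (length l) (ℕ.≤-trans le (ℕ.+-monoˡ-≤ (count k x M) (i≤1 hits))) ⟩
      length l ℕ.+ suc (count k x M)                    ≡⟨ ℕ.+-suc (length l) _ ⟩
      suc (length l ℕ.+ count k x M)                    ∎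
      where
      open ℕ.≤-Reasoning
      i≤1 : ∀ {i} → Hits x a i → i ℕ.≤ 1
      i≤1 (inj₁ refl)       = z≤n
      i≤1 (inj₂ (refl , _)) = ℕ.≤-refl

    data Local (x : ℕ) : Access → Set c where
      read-flag  : ∀ {z} → Under x z → z ℕ.< S → Local x (read (flag z))
      read-node  : ∀ {z} → Under x z → z ℕ.< S → Local x (read (node z))
      write-flag : ∀ {z v} → Under x z → z ℕ.< S → Local x (write (flag z) v)
      write-node : ∀ {z v} → Under x z → z ℕ.< S → Local x (write (node z) v)

    Local-map : ∀ {x y e} → (∀ {z} → Under x z → Under y z) → Local x e → Local y e
    Local-map f (read-flag u p)  = read-flag (f u) p
    Local-map f (read-node u p)  = read-node (f u) p
    Local-map f (write-flag u p) = write-flag (f u) p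
    Local-map f (write-node u p) = write-node (f u) p

    first≤node : ∀ z → first ℕ.≤ base ℕ.+ z
    first≤node z = ℕ.≤-trans first≤base (ℕ.m≤m+n base z)

    Static-local : ∀ {x e} → Local x e → Static e
    Static-local (read-flag _ _)  = reads
    Static-local (read-node _ _)  = reads
    Static-local (write-flag {z} _ _) = word (first≤node z)
    Static-local (write-node {z} _ _) = weight (ℕ.≤-trans (ℕ.m≤n+m m targets) (first≤node z))

    local-independent : ∀ {x y l l′} → (∀ {z} → Under x z → ¬ Under y z) → All (Local x) l → All (Local y) l′ → Compatible l l′
    local-independent {x} {y} disjoint as bs p q = go (All.lookup as p) (All.lookup bs q)
      where
      node≢ : ∀ {a b} → Under x a → Under y b → node a ≢ node b
      node≢ u u′ eq = disjoint u (subst (Under y) (sym (node-injective eq)) u′)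
      flag≢ : ∀ {a b} → Under x a → Under y b → flag a ≢ flag b
      flag≢ u u′ eq = disjoint u (subst (Under y) (sym (flag-injective eq)) u′)
      go : ∀ {e e′} → Local x e → Local y e′ → Independent e e′
      go (read-flag _ _) (read-flag _ _)   = read-read
      go (read-flag _ _) (read-node _ _)   = read-read
      go (read-node _ _) (read-flag _ _)   = read-read
      go (read-node _ _) (read-node _ _)   = read-read
      go (read-flag u _) (write-flag u′ _) = read-write (flag≢ u u′)
      go (read-flag _ _) (write-node _ _)  = read-write λ ()
      go (read-node _ _) (write-flag _ _)  = read-write λ ()
      go (read-node u _) (write-node u′ _) = read-write (node≢ u u′)
      go (write-flag u _) (read-flag u′ _) = write-read (flag≢ u u′)
      go (write-flag _ _) (read-node _ _)  = write-read λ ()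
      go (write-node _ _) (read-flag _ _)  = write-read λ ()
      go (write-node u _) (read-node u′ _) = write-read (node≢ u u′)
      go (write-flag u _) (write-flag u′ _) = write-write (flag≢ u u′)
      go (write-flag _ _) (write-node _ _)  = write-write λ ()
      go (write-node _ _) (write-flag _ _)  = write-write λ ()
      go (write-node u _) (write-node u′ _) = write-write (node≢ u u′)

    local-node : ∀ {x l z} → All (Local x) l → ¬ Under x z → ∀ M → val (apply l M) z ≡ val M z
    local-node {x} {l} {z} all z∉ M = weights-other l M λ v w → go (All.lookup all w) refl
      where
      go : ∀ {y v} → Local x (write y v) → y ≢ node z
      go (write-node u _) eq = z∉ (subst (Under x) (node-injective eq) u)

    local-flag : ∀ {x l z} → All (Local x) l → ¬ Under x z → ∀ M → dirt (apply l M) z ≡ dirt M z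
    local-flag {x} {l} {z} all z∉ M = words-other l M λ v w → go (All.lookup all w) refl
      where
      go : ∀ {y v} → Local x (write y v) → y ≢ flag z
      go (write-flag u _) eq = z∉ (subst (Under x) (flag-injective eq) u)

    choose-runs : ∀ {a b c x ρ ω M} → ω 0ᵂ ≡ 0# → ω aᵂ ≡ a → ω bᵂ ≡ b → ω cᵂ ≡ c → ρ pʳ ≡ base ℕ.+ x →
                  Runs (thread 49 ρ ω) M λ l w s →
                    ((l ≡ [] × c ≡ pick c a b) ⊎ (l ≡ write (node x) (weight (pick c a b)) ∷ [])) × w ℕ.≤ 6 × s ℕ.≤ 6
    choose-runs {ω = ω} eZ refl refl refl ep with 0# ≤? ω cᵂ
    ... | no p = jump≤ᵂ-no! refl (λ q → p (subst (_≤ ω cᵂ) eZ q)) $ halt! refl (inj₁ (refl , refl) , small , small)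
      where small = s≤s (s≤s z≤n)
    ... | yes p with ω aᵂ ≤? 0# | ω bᵂ ≤? 0#
    ...   | yes q | yes r = jump≤ᵂ-yes! refl (subst (_≤ ω cᵂ) (sym eZ) p) $
      jump≤ᵂ-yes! refl (subst (ω aᵂ ≤_) (sym eZ) q) $ jump≤ᵂ-yes! refl (subst (ω bᵂ ≤_) (sym eZ) r) $
      storeᵂ! refl ep eZ $ halt! refl (inj₂ refl , small , small)
      where small = s≤s (s≤s (s≤s (s≤s (s≤s z≤n))))
    ...   | yes q | no r  = jump≤ᵂ-yes! refl (subst (_≤ ω cᵂ) (sym eZ) p) $
      jump≤ᵂ-yes! refl (subst (ω aᵂ ≤_) (sym eZ) q) $ jump≤ᵂ-no! refl (λ r′ → r (subst (ω bᵂ ≤_) eZ r′)) $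
      jump! refl $ storeᵂ! refl ep refl $ halt! refl (inj₂ refl , ℕ.≤-refl , ℕ.≤-refl)
    ...   | no q  | yes r = jump≤ᵂ-yes! refl (subst (_≤ ω cᵂ) (sym eZ) p) $
      jump≤ᵂ-no! refl (λ q′ → q (subst (ω aᵂ ≤_) eZ q′)) $ jump≤ᵂ-yes! refl (subst (ω bᵂ ≤_) (sym eZ) r) $
      storeᵂ! refl ep refl $ halt! refl (inj₂ refl , small , small)
      where small = s≤s (s≤s (s≤s (s≤s (s≤s z≤n))))
    ...   | no q  | no r with ω aᵂ ≤? ω bᵂ
    ...     | yes t = jump≤ᵂ-yes! refl (subst (_≤ ω cᵂ) (sym eZ) p) $
      jump≤ᵂ-no! refl (λ q′ → q (subst (ω aᵂ ≤_) eZ q′)) $ jump≤ᵂ-no! refl (λ r′ → r (subst (ω bᵂ ≤_) eZ r′)) $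
      jump≤ᵂ-yes! refl t $ storeᵂ! refl ep refl $ halt! refl (inj₂ refl , ℕ.≤-refl , ℕ.≤-refl)
    ...     | no t  = jump≤ᵂ-yes! refl (subst (_≤ ω cᵂ) (sym eZ) p) $
      jump≤ᵂ-no! refl (λ q′ → q (subst (ω aᵂ ≤_) eZ q′)) $ jump≤ᵂ-no! refl (λ r′ → r (subst (ω bᵂ ≤_) eZ r′)) $
      jump≤ᵂ-no! refl t $ storeᵂ! refl ep refl $ halt! refl (inj₂ refl , ℕ.≤-refl , ℕ.≤-refl)

  module Repairing (base : ℕ) (first≤base : first ℕ.≤ base) (base+S≤bound : base ℕ.+ S ℕ.≤ bound) where
    open Repair base first≤base base+S≤bound public

    record Repairable (x : ℕ) (M : Memory) : Set c where
      field
        binary : ∀ z → Under x z → z ℕ.< S → dirt M z ≡ 0 ⊎ dirt M z ≡ 1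
        closed : ∀ z → Under x z → z ℕ.< N³ → dirt M z ≡ 0 →
                 dirt M (z ℕ.+ z) ≡ 0 × dirt M (suc (z ℕ.+ z)) ≡ 0 × Tidy (val M) z

    record Repairs (x W B : ℕ) (M : Memory) (l : Log) (w s : ℕ) : Set (c Level.⊔ ℓ₂) where
      field
        local : All (Local x) l
        clean : ∀ z → Under x z → z ℕ.< S → dirt (apply l M) z ≡ 0
        tidy  : ∀ z → Under x z → z ℕ.< N³ → Tidy (val (apply l M)) z
        kept  : ∀ z → Under x z → z ℕ.< S →
                val (apply l M) z ≡ val M z ⊎ (z ℕ.< N³ × 0# ≤ val M z × 0# ≤ val (apply l M) z)
        work≤ : w ℕ.≤ W
        span≤ : s ℕ.≤ B

    child<S : ∀ {z} → z ℕ.< N³ → suc (z ℕ.+ z) ℕ.< S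
    child<S {z} z< = subst (ℕ._≤ S) (cong suc (ℕ.+-suc z z)) (ℕ.+-mono-≤ z< z<)

    even<S : ∀ {z} → z ℕ.< N³ → z ℕ.+ z ℕ.< S
    even<S z< = ℕ.<-trans (ℕ.n<1+n _) (child<S z<)

    inner : ∀ {x z} → Under (x ℕ.+ x) z ⊎ Under (suc (x ℕ.+ x)) z → z ℕ.< S → x ℕ.< N³
    inner (inj₁ u) z< = halve-< (ℕ.≤-<-trans (Under⇒≤ u) z<)
    inner (inj₂ u) z< = halve-< (ℕ.<-trans (Under⇒≤ u) z<)

    Under-evenʳ : ∀ {x z} → Under x z → Under x (z ℕ.+ z)
    Under-evenʳ {x} {z} (k , d) = suc k , go k d
      where
      go : ∀ k {x} → Desc k x z → Desc (suc k) x (z ℕ.+ z)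
      go zero {x} d with refl ← Desc-zero d = Desc-even 0 (Desc-refl (z ℕ.+ z))
      go (suc k) d with Desc-suc k d
      ... | inj₁ d′ = Desc-even (suc k) (go k d′)
      ... | inj₂ d′ = Desc-odd (suc k) (go k d′)

    Under-oddʳ : ∀ {x z} → Under x z → Under x (suc (z ℕ.+ z))
    Under-oddʳ {x} {z} (k , d) = suc k , go k d
      where
      go : ∀ k {x} → Desc k x z → Desc (suc k) x (suc (z ℕ.+ z))
      go zero {x} d with refl ← Desc-zero d = Desc-odd 0 (Desc-refl (suc (z ℕ.+ z)))
      go (suc k) d with Desc-suc k d
      ... | inj₁ d′ = Desc-even (suc k) (go k d′)
      ... | inj₂ d′ = Desc-odd (suc k) (go k d′)

    Tidy-cong : ∀ {g g′ : ℕ → Carrier} {z} → (∀ y → y ≡ z ⊎ y ≡ z ℕ.+ z ⊎ y ≡ suc (z ℕ.+ z) → g′ y ≡ g y) → Tidy g z → Tidy g′ z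
    Tidy-cong {g} {g′} {z} eq t =
      trans e₀ (trans t (sym (trans (cong₂ (pick (g′ z)) e₁ e₂) (cong (λ c → pick c _ _) e₀))))
      where
      e₀ = eq z (inj₁ refl)
      e₁ = eq (z ℕ.+ z) (inj₂ (inj₁ refl))
      e₂ = eq (suc (z ℕ.+ z)) (inj₂ (inj₂ refl))

    Tidy-under : ∀ {x M M′ z} → (∀ y → Under x y → val M′ y ≡ val M y) → Under x z → Tidy (val M) z → Tidy (val M′) z
    Tidy-under {M = M} {M′} {z} eq u = Tidy-cong {val M} {val M′} λ where
      y (inj₁ refl)        → eq y u
      y (inj₂ (inj₁ refl)) → eq y (Under-evenʳ u)
      y (inj₂ (inj₂ refl)) → eq y (Under-oddʳ u)

    Repairable-cong : ∀ {x M M′} → (∀ z → Under x z → dirt M′ z ≡ dirt M z) → (∀ z → Under x z → val M′ z ≡ val M z) →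
                      Repairable x M → Repairable x M′
    Repairable-cong {x} {M} {M′} d v r = record
      { binary = λ z u z< → subst (λ i → i ≡ 0 ⊎ i ≡ 1) (sym (d z u)) (binary z u z<)
      ; closed = λ z u z< eq → let p , q , t = closed z u z< (trans (sym (d z u)) eq) in
          trans (d _ (Under-evenʳ u)) p , trans (d _ (Under-oddʳ u)) q , Tidy-under {x} {M} {M′} v u t }
      where open Repairable r

    Repairable-map : ∀ {x y M} → (∀ {z} → Under y z → Under x z) → Repairable x M → Repairable y M
    Repairable-map f r = record { binary = λ z u → binary z (f u) ; closed = λ z u → closed z (f u) }
      where open Repairable r

    module _ {M : Memory} where
      clean-below : ∀ k {x z} → Repairable x M → dirt M x ≡ 0 → Desc k x z → z ℕ.< S → dirt M z ≡ 0 × (z ℕ.< N³ → Tidy (val M) z)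
      clean-below zero {x} r eq d z< with refl ← Desc-zero d =
        eq , λ x< → proj₂ (proj₂ (Repairable.closed r x (Under-refl x) x< eq))
      clean-below (suc k) {x} r eq d z< with Desc-suc k d
      ... | inj₁ d′ = clean-below k (Repairable-map Under-even r)
                        (proj₁ (Repairable.closed r x (Under-refl x) (inner (inj₁ (k , d′)) z<) eq)) d′ z<
      ... | inj₂ d′ = clean-below k (Repairable-map Under-odd r)
                        (proj₁ (proj₂ (Repairable.closed r x (Under-refl x) (inner (inj₂ (k , d′)) z<) eq))) d′ z<

    private
      ¬even : ∀ {x} → 1 ℕ.≤ x → ¬ Under (x ℕ.+ x) x
      ¬even {x} 1≤x u = ℕ.<⇒≱ (ℕ.m<m+n x 1≤x) (Under⇒≤ u)

      ¬odd : ∀ {x} → ¬ Under (suc (x ℕ.+ x)) x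
      ¬odd {x} u = ℕ.<⇒≱ (s≤s (ℕ.m≤m+n x x)) (Under⇒≤ u)

      fork-work : ∀ {w₁ w₂ w₃} a b → w₁ ℕ.≤ 2 ℕ.+ (4 ℕ.+ a ℕ.* 34) → w₂ ℕ.≤ 3 ℕ.+ (4 ℕ.+ b ℕ.* 34) → w₃ ℕ.≤ 12 →
                  5 ℕ.+ suc (w₁ ℕ.+ w₂ ℕ.+ w₃) ℕ.≤ 4 ℕ.+ (1 ℕ.+ (a ℕ.+ b)) ℕ.* 34
      fork-work a b p q r = ℕ.≤-trans (ℕ.+-monoʳ-≤ 6 (ℕ.+-mono-≤ (ℕ.+-mono-≤ p q) r))
        (ℕ.≤-trans (ℕ.m≤n+m _ 7) (ℕ.≤-reflexive (eq a b)))
        where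
        eq : ∀ a b → 7 ℕ.+ (6 ℕ.+ (2 ℕ.+ (4 ℕ.+ a ℕ.* 34) ℕ.+ (3 ℕ.+ (4 ℕ.+ b ℕ.* 34)) ℕ.+ 12)) ≡ 4 ℕ.+ (1 ℕ.+ (a ℕ.+ b)) ℕ.* 34
        eq = solve-∀

      fork-span : ∀ {s₁ s₂ s₃} k → s₁ ℕ.≤ 2 ℕ.+ (6 ℕ.+ k ℕ.* 21) → s₂ ℕ.≤ 3 ℕ.+ (6 ℕ.+ k ℕ.* 21) → s₃ ℕ.≤ 12 →
                  5 ℕ.+ suc (s₁ ℕ.⊔ s₂ ℕ.+ s₃) ℕ.≤ 6 ℕ.+ suc k ℕ.* 21
      fork-span k p q r = ℕ.≤-trans (ℕ.+-monoʳ-≤ 6 (ℕ.+-mono-≤ (ℕ.⊔-lub (ℕ.≤-trans p (ℕ.n≤1+n _)) q) r)) (ℕ.≤-reflexive (eq k))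
        where
        eq : ∀ k → 6 ℕ.+ (3 ℕ.+ (6 ℕ.+ k ℕ.* 21) ℕ.+ 12) ≡ 6 ℕ.+ suc k ℕ.* 21
        eq = solve-∀

    module Join {x : ℕ} (1≤x : 1 ℕ.≤ x) (x<N³ : x ℕ.< N³) (M : Memory) where

      M₁ : Memory
      M₁ = set (flag x) (word 0) M

      dirt-M₁ : ∀ {z} → z ≢ x → dirt M₁ z ≡ dirt M z
      dirt-M₁ z≢x = words-other (write (flag x) (word 0) ∷ []) M λ where
        _ (here eq) → z≢x (flag-injective (cong cell eq))

      left-ready : Repairable x M → Repairable (x ℕ.+ x) M₁
      left-ready r = Repairable-cong {M = M} (λ z u → dirt-M₁ λ where refl → ¬even 1≤x u) (λ _ _ → refl) (Repairable-map Under-even r)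

      module _ {l₁ W₁ B₁ w₁ s₁} (r₁ : Repairs (x ℕ.+ x) W₁ B₁ M₁ l₁ w₁ s₁) where
        private module Left = Repairs r₁

        M₂ : Memory
        M₂ = apply l₁ M₁

        dirt-M₂ : ∀ z → Under (suc (x ℕ.+ x)) z → dirt M₂ z ≡ dirt M z
        dirt-M₂ z u = trans (local-flag Left.local (λ u′ → Under-disjoint 1≤x u′ u) M₁) (dirt-M₁ λ where refl → ¬odd u)

        val-M₂ : ∀ z → Under (suc (x ℕ.+ x)) z → val M₂ z ≡ val M z
        val-M₂ z u = local-node Left.local (λ u′ → Under-disjoint 1≤x u′ u) M₁

        right-ready : Repairable x M → Repairable (suc (x ℕ.+ x)) M₂
        right-ready r = Repairable-cong {M = M} dirt-M₂ val-M₂ (Repairable-map Under-odd r)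

        module _ {l₂ W₂ B₂ w₂ s₂} (r₂ : Repairs (suc (x ℕ.+ x)) W₂ B₂ M₂ l₂ w₂ s₂) where
          private module Right = Repairs r₂

          M₃ : Memory
          M₃ = apply l₂ M₂

          val-x : val M₃ x ≡ val M x
          val-x = trans (local-node Right.local ¬odd M₂) (local-node Left.local (¬even 1≤x) M₁)

          chosen : Carrier
          chosen = pick (val M x) (val M₃ (x ℕ.+ x)) (val M₃ (suc (x ℕ.+ x)))

          joined : ∀ {l W B w s} →
                   ((l ≡ [] × val M x ≡ chosen) ⊎ l ≡ write (node x) (weight chosen) ∷ []) → w ℕ.≤ W → s ℕ.≤ B →
                   Repairs x W B M (read (flag x) ∷ write (flag x) (word 0) ∷ l₁ ++ l₂ ++
                     (read (node (x ℕ.+ x)) ∷ read (node (suc (x ℕ.+ x))) ∷ read (node x) ∷ l)) w s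
          joined {l} choice w≤ s≤ = record
            { local = read-flag (Under-refl x) x<S ∷ write-flag (Under-refl x) x<S ∷
                All.++⁺ (All.map (Local-map Under-even) Left.local) (All.++⁺ (All.map (Local-map Under-odd) Right.local)
                  (read-node (Under-even (Under-refl _)) (even<S x<N³) ∷ read-node (Under-odd (Under-refl _)) (child<S x<N³) ∷
                   read-node (Under-refl x) x<S ∷ local₄ choice))
            ; clean = λ z u z< → trans (cong (λ M → dirt M z) final) (trans (dirt₄ choice z) (clean₃ z z< (Under-cases u)))
            ; tidy  = λ z u z< → subst (λ M → Tidy (val M) z) (sym final) (tidy₄ z z< (Under-cases u))
            ; kept  = λ z u z< → subst (λ M′ → val M′ z ≡ val M z ⊎ (z ℕ.< N³ × 0# ≤ val M z × 0# ≤ val M′ z)) (sym final)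
                        (kept₄ z z< (Under-cases u))
            ; work≤ = w≤ ; span≤ = s≤ }
            where
            x<S = ℕ.<-≤-trans x<N³ N³≤S

            M₄ : Memory
            M₄ = apply l M₃

            final : apply (l₁ ++ l₂ ++ (read (node (x ℕ.+ x)) ∷ read (node (suc (x ℕ.+ x))) ∷ read (node x) ∷ l)) M₁ ≡ M₄
            final = trans (apply-++ l₁ _ M₁) (apply-++ l₂ _ M₂)

            Choice′ : Set c
            Choice′ = (l ≡ [] × val M x ≡ chosen) ⊎ l ≡ write (node x) (weight chosen) ∷ []

            local₄ : Choice′ → All (Local x) l
            local₄ (inj₁ (refl , _)) = []
            local₄ (inj₂ refl)       = write-node (Under-refl x) x<S ∷ []

            dirt₄ : Choice′ → ∀ z → dirt M₄ z ≡ dirt M₃ z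
            dirt₄ (inj₁ (refl , _)) z = refl
            dirt₄ (inj₂ refl)       z = refl

            val₄ : Choice′ → ∀ {z} → z ≢ x → val M₄ z ≡ val M₃ z
            val₄ (inj₁ (refl , _)) z≢x = refl
            val₄ (inj₂ refl)       z≢x = weights-other (write (node x) (weight chosen) ∷ []) M₃ λ where
              _ (here eq) → z≢x (node-injective (cong cell eq))

            val₄-x : Choice′ → val M₄ x ≡ chosen
            val₄-x (inj₁ (refl , eq)) = trans val-x eq
            val₄-x (inj₂ refl)        = cong (λ { (weight v) → v }) (get-set-same (node x) (weight chosen) M₃)

            clean₃ : ∀ z → z ℕ.< S → z ≡ x ⊎ Under (x ℕ.+ x) z ⊎ Under (suc (x ℕ.+ x)) z → dirt M₃ z ≡ 0
            clean₃ z z< (inj₁ refl) = trans (local-flag Right.local ¬odd M₂) (trans (local-flag Left.local (¬even 1≤x) M₁)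
              (cong (λ { (word v) → v }) (get-set-same (flag x) (word 0) M)))
            clean₃ z z< (inj₂ (inj₁ u)) = trans (local-flag Right.local (Under-disjoint 1≤x u) M₂) (Left.clean z u z<)
            clean₃ z z< (inj₂ (inj₂ u)) = Right.clean z u z<

            val-left : ∀ z → Under (x ℕ.+ x) z → val M₄ z ≡ val M₂ z
            val-left z u = trans (val₄ choice λ where refl → ¬even 1≤x u) (local-node Right.local (Under-disjoint 1≤x u) M₂)

            val-right : ∀ z → Under (suc (x ℕ.+ x)) z → val M₄ z ≡ val M₃ z
            val-right z u = val₄ choice λ where refl → ¬odd u

            tidy-x : Tidy (val M₄) x
            tidy-x = trans (val₄-x choice) (sym (trans
              (cong₂ (pick (val M₄ x)) (val₄ choice λ eq → ¬even 1≤x (subst (Under (x ℕ.+ x)) eq (Under-refl _)))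
                                       (val₄ choice λ eq → ¬odd (subst (Under (suc (x ℕ.+ x))) eq (Under-refl _))))
              (trans (cong (λ c → pick c (val M₃ (x ℕ.+ x)) (val M₃ (suc (x ℕ.+ x)))) (val₄-x choice)) (pick-idem (val M x) _ _))))

            tidy₄ : ∀ z → z ℕ.< N³ → z ≡ x ⊎ Under (x ℕ.+ x) z ⊎ Under (suc (x ℕ.+ x)) z → Tidy (val M₄) z
            tidy₄ z z< (inj₁ eq) = subst (Tidy (val M₄)) (sym eq) tidy-x
            tidy₄ z z< (inj₂ (inj₁ u)) = Tidy-under {M = M₂} {M₄} val-left u (Left.tidy z u z<)
            tidy₄ z z< (inj₂ (inj₂ u)) = Tidy-under {M = M₃} {M₄} val-right u (Right.tidy z u z<)

            kept-x : val M₄ x ≡ val M x ⊎ (x ℕ.< N³ × 0# ≤ val M x × 0# ≤ val M₄ x)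
            kept-x = case 0# ≤? val M x of λ where
              (yes p) → inj₂ (x<N³ , p , subst (0# ≤_) (sym (trans (val₄-x choice) (pick-open p))) (min⁺-nonNegative _ _))
              (no p)  → inj₁ (trans (val₄-x choice) (pick-closed p))

            kept₄ : ∀ z → z ℕ.< S → z ≡ x ⊎ Under (x ℕ.+ x) z ⊎ Under (suc (x ℕ.+ x)) z →
                    val M₄ z ≡ val M z ⊎ (z ℕ.< N³ × 0# ≤ val M z × 0# ≤ val M₄ z)
            kept₄ z z< (inj₁ eq) = subst (λ z → val M₄ z ≡ val M z ⊎ (z ℕ.< N³ × 0# ≤ val M z × 0# ≤ val M₄ z)) (sym eq) kept-x
            kept₄ z z< (inj₂ (inj₁ u)) = subst (λ v → v ≡ val M z ⊎ (z ℕ.< N³ × 0# ≤ val M z × 0# ≤ v)) (sym (val-left z u)) (Left.kept z u z<)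
            kept₄ z z< (inj₂ (inj₂ u)) = subst₂ (λ v v′ → v ≡ v′ ⊎ (z ℕ.< N³ × 0# ≤ v′ × 0# ≤ v))
              (sym (val-right z u)) (val-M₂ z u) (Right.kept z u z<)

    repairWork : ℕ → ℕ → Memory → ℕ
    repairWork k x M = 4 ℕ.+ count k x M ℕ.* 34

    repairSpan : ℕ → ℕ
    repairSpan k = 6 ℕ.+ k ℕ.* 21

    repair-runs : ∀ k {x ρ ω M} → Env base ρ → ρ xʳ ≡ x → 1 ℕ.≤ x → Row N³ k x → ω 0ᵂ ≡ 0# → Repairable x M →
                  Runs (thread REPAIR ρ ω) M (Repairs x (repairWork k x M) (repairSpan k) M)
    repair-runs k {x} {ρ} {ω} {M} env@(e0 , e1 , _ , _ , _ , _ , _ , e³ , _ , eb) refl 1≤x r eZ ready =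
      add! refl (cong (ℕ._+ x) eb) (node≤bound (ℕ.<⇒≤ x<S)) $
      load! refl refl refl $
      (case Repairable.binary ready x (Under-refl x) x<S of λ where
        (inj₁ eq) → jump≤-no! refl (subst₂ ℕ._<_ (sym eq) (sym e1) (s≤s z≤n)) $ halt! refl record
          { local = read-flag (Under-refl x) x<S ∷ []
          ; clean = λ z (k , d) z< → proj₁ (clean-below k ready eq d z<)
          ; tidy  = λ z (k , d) z< → proj₂ (clean-below k ready eq d (ℕ.<-≤-trans z< N³≤S)) z<
          ; kept  = λ _ _ _ → inj₁ refl
          ; work≤ = ℕ.m≤m+n 4 _
          ; span≤ = ℕ.≤-trans (s≤s (s≤s (s≤s (s≤s z≤n)))) (ℕ.m≤m+n 6 _) }
        (inj₂ eq) → jump≤-yes! refl (subst₂ ℕ._≤_ (sym e1) (sym eq) (s≤s z≤n)) $ store! refl refl e0 $ dirty k r eq)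
      where
      x<S = Row-< k r

      dirty : ∀ k → Row N³ k x → dirt M x ≡ 1 →
              Runs (thread 41 (ρ [ pʳ ≔ base ℕ.+ x ] [ tʳ ≔ dirt M x ]) ω) (set (flag x) (word 0) M)
                λ l w s → Repairs x (repairWork k x M) (repairSpan k) M (read (flag x) ∷ write (flag x) (word 0) ∷ l) (4 ℕ.+ w) (4 ℕ.+ s)
      dirty zero r eq = jump≤-yes! refl (subst (ℕ._≤ x) (sym e³) (Row-zero r)) $ halt! refl record
        { local = read-flag (Under-refl x) x<S ∷ write-flag (Under-refl x) x<S ∷ []
        ; clean = λ z u z< → case Under-cases u of λ where
            (inj₁ refl) → cong (λ { (word v) → v }) (get-set-same (flag x) (word 0) M)
            (inj₂ u′)   → ⊥-elim (ℕ.<⇒≱ (inner u′ z<) (Row-zero r))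
        ; tidy  = λ z u z< → ⊥-elim (ℕ.<⇒≱ z< (ℕ.≤-trans (Row-zero r) (Under⇒≤ u)))
        ; kept  = λ _ _ _ → inj₁ refl
        ; work≤ = subst (λ d → 6 ℕ.≤ 4 ℕ.+ d ℕ.⊓ 1 ℕ.* 34) (sym eq) (ℕ.m≤m+n 6 32)
        ; span≤ = ℕ.≤-refl }
      dirty (suc k) r eq =
        jump≤-no! refl (subst (x ℕ.<_) (sym e³) x<N³) $
        fork! {Q₁ = Repairs (x ℕ.+ x) (2 ℕ.+ repairWork k (x ℕ.+ x) M₁) (2 ℕ.+ repairSpan k) M₁}
              {Q₂ = λ l₁ → Repairs (suc (x ℕ.+ x)) (3 ℕ.+ repairWork k (suc (x ℕ.+ x)) (apply l₁ M₁)) (3 ℕ.+ repairSpan k) (apply l₁ M₁)} refl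
          (add! refl refl x+x≤bound $
           jump! refl $
           Runs-map (slower 2) $
           repair-runs k env refl (ℕ.≤-trans 1≤x (ℕ.m≤m+n x x)) (Row-even k r) eZ (left-ready ready))
          (λ r₁ →
           add! refl refl x+x≤bound $
           add! {z = suc (x ℕ.+ x)} refl (trans (cong (x ℕ.+ x ℕ.+_) e1) (ℕ.+-comm (x ℕ.+ x) 1)) x+x+1≤bound $
           jump! refl $
           Runs-map (slower 3) $
           repair-runs k env refl (s≤s z≤n) (Row-odd k r) eZ (right-ready r₁ ready))
          (λ r₁ r₂ → local-independent (Under-disjoint 1≤x) (Repairs.local r₁) (Repairs.local r₂))
          λ {l₁} {w₁} {s₁} {l₂} {w₂} {s₂} r₁ r₂ →
            add! refl refl x+x≤bound $
            add! {z = base ℕ.+ (x ℕ.+ x)} refl (cong (ℕ._+ (x ℕ.+ x)) eb) (node≤bound (ℕ.<⇒≤ (even<S x<N³))) $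
            loadᵂ! refl refl refl $
            add! {z = base ℕ.+ suc (x ℕ.+ x)} refl
              (trans (cong (base ℕ.+ (x ℕ.+ x) ℕ.+_) e1) (trans (ℕ.+-comm _ 1) (sym (ℕ.+-suc base _)))) (node≤bound x+x+1≤S) $
            loadᵂ! refl refl refl $
            loadᵂ! refl refl (val-x r₁ r₂) $
            Runs-map (λ {l} {w} {s} (choice , w≤ , s≤) → joined r₁ r₂ choice
                (ℕ.≤-trans (fork-work {w₁} {w₂} {6 ℕ.+ w} (count k (x ℕ.+ x) M) (count k (suc (x ℕ.+ x)) M)
                    (subst (λ i → w₁ ℕ.≤ 2 ℕ.+ (4 ℕ.+ i ℕ.* 34))
                      (treeCount-cong k λ z u → cong (ℕ._⊓ 1) (dirt-M₁ λ where refl → ¬even 1≤x u)) (Repairs.work≤ r₁))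
                    (subst (λ i → w₂ ℕ.≤ 3 ℕ.+ (4 ℕ.+ i ℕ.* 34))
                      (treeCount-cong k λ z u → cong (ℕ._⊓ 1) (dirt-M₂ r₁ z u)) (Repairs.work≤ r₂))
                    (ℕ.+-monoʳ-≤ 6 w≤))
                  (ℕ.≤-reflexive (cong (λ d → 4 ℕ.+ (d ℕ.⊓ 1 ℕ.+ (count k (x ℕ.+ x) M ℕ.+ count k (suc (x ℕ.+ x)) M)) ℕ.* 34) (sym eq))))
                (fork-span {s₁} {s₂} {6 ℕ.+ s} k (Repairs.span≤ r₁) (Repairs.span≤ r₂) (ℕ.+-monoʳ-≤ 6 s≤))) $
            choose-runs {x = x} eZ refl refl refl refl
        where
        x<N³ = Row-suc k r
        open Join 1≤x x<N³ M
        x+x+1≤S : suc (x ℕ.+ x) ℕ.≤ S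
        x+x+1≤S = ℕ.<⇒≤ (child<S x<N³)
        x+x+1≤bound = ≤S⇒≤bound x+x+1≤S
        x+x≤bound : x ℕ.+ x ℕ.≤ bound
        x+x≤bound = ℕ.≤-trans (ℕ.n≤1+n _) x+x+1≤bound
        slower : ∀ d {y W B M l w s} → Repairs y W B M l w s → Repairs y (d ℕ.+ W) (d ℕ.+ B) M l (d ℕ.+ w) (d ℕ.+ s)
        slower d e = record { local = local e ; clean = clean e ; tidy = tidy e ; kept = kept e
                            ; work≤ = ℕ.+-monoʳ-≤ d (work≤ e) ; span≤ = ℕ.+-monoʳ-≤ d (span≤ e) }
          where open Repairs

    under-root-S : ∀ {z} → 1 ℕ.≤ z → z ℕ.< S → Under 1 z
    under-root-S 1≤z z<S = under-root H 1≤z (ℕ.<-≤-trans z<S (ℕ.≤-reflexive S≡2^H))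

    written? : ∀ l x → (∃[ v ] write x v ∈ l) ⊎ (∀ v → ¬ write x v ∈ l)
    written? [] x = inj₂ λ _ ()
    written? (read y ∷ l) x with written? l x
    ... | inj₁ (v , w) = inj₁ (v , there w)
    ... | inj₂ ∉l      = inj₂ λ { v (there w) → ∉l v w }
    written? (write y u ∷ l) x with y ≟ᶜ x | written? l x
    ... | yes refl | _            = inj₁ (u , here refl)
    ... | no _     | inj₁ (v , w) = inj₁ (v , there w)
    ... | no y≢x   | inj₂ ∉l      = inj₂ λ { v (here refl) → y≢x refl ; v (there w) → ∉l v w }

    module _ {M l} (clean : ∀ z → 1 ℕ.≤ z → z ℕ.< S → dirt M z ≡ 0) (tidy : ∀ z → 1 ℕ.≤ z → z ℕ.< N³ → Tidy (val M) z)
             (flag-write : ∀ {z u} → write (flag z) u ∈ l → u ≡ word 1) (marked : Marked l) where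

      private
        M₁ : Memory
        M₁ = apply l M

        marked-dirt : ∀ {z} → mark z ∈ l → dirt M₁ z ≡ 1
        marked-dirt w = cong (λ { (word v) → v }) (get-apply-write l M w flag-write)

        unmarked-dirt : ∀ {z} → ¬ mark z ∈ l → dirt M₁ z ≡ dirt M z
        unmarked-dirt {z} ∉l = words-other l M λ v w → ∉l (subst (λ v → write (flag z) v ∈ l) (flag-write w) w)

        unmarked-val : ∀ {z} → ¬ mark z ∈ l → val M₁ z ≡ val M z
        unmarked-val {z} ∉l = weights-other l M λ v w → ∉l (own marked w)

      marked-repairable : Repairable 1 M₁
      marked-repairable = record { binary = binary ; closed = closed-up }
        where
        binary : ∀ z → Under 1 z → z ℕ.< S → dirt M₁ z ≡ 0 ⊎ dirt M₁ z ≡ 1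
        binary z u z< with written? l (flag z)
        ... | inj₁ (v , w) = inj₂ (marked-dirt (subst (λ v → write (flag z) v ∈ l) (flag-write w) w))
        ... | inj₂ ∉l      = inj₁ (trans (words-other l M ∉l) (clean z (Under⇒≤ u) z<))
        closed-up : ∀ z → Under 1 z → z ℕ.< N³ → dirt M₁ z ≡ 0 →
                    dirt M₁ (z ℕ.+ z) ≡ 0 × dirt M₁ (suc (z ℕ.+ z)) ≡ 0 × Tidy (val M₁) z
        closed-up z u z< eq =
          trans (unmarked-dirt ∉ₑ) (clean (z ℕ.+ z) (ℕ.≤-trans 1≤z (ℕ.m≤m+n z z)) (even<S z<)) ,
          trans (unmarked-dirt ∉ₒ) (clean (suc (z ℕ.+ z)) (s≤s z≤n) (child<S z<)) ,
          Tidy-cong {val M} {val M₁} {z} (λ where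
            y (inj₁ refl)        → unmarked-val ∉z
            y (inj₂ (inj₁ refl)) → unmarked-val ∉ₑ
            y (inj₂ (inj₂ refl)) → unmarked-val ∉ₒ) (tidy z 1≤z z<)
          where
          1≤z = Under⇒≤ u
          ∉z : ¬ mark z ∈ l
          ∉z w with () ← trans (sym eq) (marked-dirt w)
          ∉ₑ : ¬ mark (z ℕ.+ z) ∈ l
          ∉ₑ w = ∉z (subst (λ y → mark y ∈ l) (half-even z) (up marked w (subst (1 ℕ.≤_) (sym (half-even z)) 1≤z)))
          ∉ₒ : ¬ mark (suc (z ℕ.+ z)) ∈ l
          ∉ₒ w = ∉z (subst (λ y → mark y ∈ l) (half-odd z) (up marked w (subst (1 ℕ.≤_) (sym (half-odd z)) 1≤z)))

    blank-tidy : ∀ {M} → (∀ z → z ℕ.< S → val M z ≡ 0#) → ∀ z → 1 ℕ.≤ z → z ℕ.< N³ → Tidy (val M) z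
    blank-tidy blank z _ z< = trans (blank z (ℕ.<-≤-trans z< N³≤S)) (sym (trans
      (cong₂ (λ a b → pick a b _) (blank z (ℕ.<-≤-trans z< N³≤S)) (blank _ (even<S z<)))
      (trans (cong (pick 0# 0#) (blank _ (child<S z<))) pick-zero)))

    H′ : ℕ
    H′ = h ℕ.+ h ℕ.+ h

    leaf-row : Row N³ H′ 1
    leaf-row = row (ℕ.≤-reflexive (trans N³≡2^ (sym (ℕ.*-identityˡ _))))
                   (ℕ.≤-reflexive (trans (cong (2 ^ H′ ℕ.+_) (ℕ.+-identityʳ _)) (sym (cong₂ ℕ._+_ N³≡2^ N³≡2^))))

    count-clean : ∀ k {x M} → Row N³ k x → (∀ z → Under x z → z ℕ.< S → dirt M z ≡ 0) → count k x M ≡ 0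
    count-clean zero r eq = cong (ℕ._⊓ 1) (eq _ (Under-refl _) (Row-< 0 r))
    count-clean (suc k) {M = M} r eq = cong₂ ℕ._+_ (cong (ℕ._⊓ 1) (eq _ (Under-refl _) (Row-< (suc k) r)))
      (cong₂ ℕ._+_ (count-clean k {M = M} (Row-even k r) λ z → eq z ∘ Under-even) (count-clean k {M = M} (Row-odd k r) λ z → eq z ∘ Under-odd))

    count-core : ∀ {M} → (∀ z → 1 ℕ.≤ z → z ℕ.< S → dirt M z ≡ 0) → ∀ l → count H′ 1 (apply l M) ℕ.≤ length l
    count-core {M} clean l = ℕ.≤-trans (count-apply H′ l M ℕ.≤-refl) (ℕ.≤-reflexive (trans
      (cong (length l ℕ.+_) (count-clean H′ {M = M} leaf-row λ z u z< → clean z (Under⇒≤ u) z<)) (ℕ.+-identityʳ _)))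

    repair-after : ∀ {M l W w w₁ A} → (∀ z → 1 ℕ.≤ z → z ℕ.< S → dirt M z ≡ 0) → w ℕ.≤ repairWork H′ 1 (apply l M) →
                   length l ℕ.≤ w₁ → w₁ ℕ.≤ A → W ≡ 4 ℕ.+ A ℕ.* 34 → w ℕ.≤ W
    repair-after {M} {l} clean w≤ len w₁≤ refl = ℕ.≤-trans w≤ (ℕ.+-monoʳ-≤ 4 (ℕ.*-monoˡ-≤ 34
      (ℕ.≤-trans (count-core {M} clean l) (ℕ.≤-trans len w₁≤))))

  -- The invariant of the phases

  module Invariants (base : ℕ) (first≤base : first ℕ.≤ base) (base+S≤bound : base ℕ.+ S ℕ.≤ bound)
                    (Δ : Distances K G) where
    open Repairing base first≤base base+S≤bound public
    open Distances Δ public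

    settled : Memory → ℕ → Set ℓ₂
    settled M v = ¬ 0# ≤ val M (N ℕ.+ v)

    record Core (M : Memory) : Set (c Level.⊔ ℓ₁ Level.⊔ ℓ₂) where
      field
        input     : Input M
        clean     : ∀ z → 1 ℕ.≤ z → z ℕ.< S → dirt M z ≡ 0
        tidy      : ∀ z → 1 ℕ.≤ z → z ℕ.< N³ → Tidy (val M) z
        closed    : ∀ z → 1 ℕ.≤ z → z ℕ.< N³ → ¬ 0# ≤ val M z → ∃[ v ] (v ℕ.< n × z ≡ N ℕ.+ v)
        done      : ∀ v → v ℕ.< n → settled M v → weights M (m ℕ.+ v) ≈ d v
        leaf-edge : ∀ j → j ℕ.< m → settled M (src j) → val M (leaf j) ≈ d (src j) + wt j
        leaf-only : ∀ z → N³ ℕ.≤ z → z ℕ.< S → ¬ val M z ≤ 0# → ∃[ j ] (j ℕ.< m × z ≡ leaf j × settled M (src j))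

    vertex<S : ∀ {v} → v ℕ.< n → N ℕ.+ v ℕ.< S
    vertex<S v<n = ℕ.<-≤-trans (ℕ.+-monoʳ-< N (ℕ.<-≤-trans v<n n≤N)) (ℕ.+-mono-≤ N≤N³ N≤N³)

    vertex<N³ : ∀ {v} → v ℕ.< n → N ℕ.+ v ℕ.< N³
    vertex<N³ v<n = ℕ.<-≤-trans (ℕ.+-monoʳ-< N (ℕ.<-≤-trans v<n n≤N)) (ℕ.≤-trans N+N≤N² N²≤N³)

    closed-kept : ∀ {l W B M w s} → Repairs 1 W B M l w s → ∀ {z} → 1 ℕ.≤ z → z ℕ.< S → ¬ 0# ≤ val (apply l M) z → val (apply l M) z ≡ val M z
    closed-kept r {z} 1≤z z<S neg = [ id , (λ (_ , _ , p) → ⊥-elim (neg p)) ]′ (Repairs.kept r z (under-root-S 1≤z z<S) z<S)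

    module Step {p} {X : ℕ → Set p} {R : ℕ → Set} {dist : ℕ → Carrier} {closing : Carrier}
                (closing<0 : ¬ 0# ≤ closing) (dist≈ : ∀ v → v ℕ.< n → X v → dist v ≈ d v)
                {M : Memory} (core : Core M) {l₁ : Log} where
      open Core core
      open Settlement base first≤base base+S≤bound dist closing
        using (Allowed; result; close; leaves; Settled; result∈; close∈; relax∈;
               weight≢; node≢; below; output<base; top≢leaf; vertex<N+N; Static-allowed; flags-marked)

      module _ (allowed : All (Allowed R X (X ∘ src)) l₁) (all-settled : ∀ v → v ℕ.< n → X v → Settled v l₁) (marked : Marked l₁) where

        M₁ : Memory
        M₁ = apply l₁ M

        data NodeWrite (z : ℕ) (u : Content (node z)) : Set (c Level.⊔ p) where
          closes : ∀ {v} → X v → v ℕ.< n → z ≡ N ℕ.+ v → u ≡ weight closing → NodeWrite z u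
          sets   : ∀ {j} → X (src j) → j ℕ.< m → z ≡ leaf j → u ≡ weight (dist (src j) + wt j) → NodeWrite z u

        node-write : ∀ {z u} → write (node z) u ∈ l₁ → NodeWrite z u
        node-write {z} {u} w = go (All.lookup allowed w) refl refl
          where
          go : ∀ {e} → Allowed R X (X ∘ src) e → e ≡ write (node z) u → cell e ≡ node z → NodeWrite z u
          go (result _ v<n) eq eq′ = ⊥-elim (weight≢ (below (output<base v<n)) eq′)
          go (close x v<n) eq eq′ with refl ← node-injective eq′ with refl ← eq = closes x v<n refl refl
          go (leaves x j<m) eq eq′ with refl ← node-injective eq′ with refl ← eq = sets x j<m refl refl

        weight-value : ∀ {a v} → get M₁ (weightCell a) ≡ weight v → weights M₁ a ≡ v
        weight-value = cong λ { (weight v) → v }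

        closed₁ : ∀ v → v ℕ.< n → X v → val M₁ (N ℕ.+ v) ≡ closing
        closed₁ v v<n x = weight-value (get-apply-write l₁ M (close∈ (all-settled v v<n x)) λ w → case node-write w of λ where
          (closes _ _ _ eq)     → eq
          (sets {j} _ _ eq _)   → ⊥-elim (top≢leaf {j = j} (vertex<N+N v<n) eq))

        leaf₁ : ∀ j → j ℕ.< m → X (src j) → val M₁ (leaf j) ≡ dist (src j) + wt j
        leaf₁ j j<m x = weight-value (get-apply-write l₁ M (relax∈ (all-settled (src j) (src<n j<m) x) j j<m refl) λ w → case node-write w of λ where
          (closes _ v<n eq _)      → ⊥-elim (top≢leaf {j = j} (vertex<N+N v<n) (sym eq))
          (sets {j′} _ j′<m eq eq′) → trans eq′ (cong (λ j → weight (dist (src j) + wt j)) (sym (leaf-injective j<m j′<m eq))))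

        result₁ : ∀ v → v ℕ.< n → X v → weights M₁ (m ℕ.+ v) ≡ dist v
        result₁ v v<n x = weight-value (get-apply-write l₁ M (result∈ (all-settled v v<n x)) λ w → go (All.lookup allowed w) refl refl)
          where
          go : ∀ {e u} → Allowed R X (X ∘ src) e → e ≡ write (weightCell (m ℕ.+ v)) u → cell e ≡ weightCell (m ℕ.+ v) → u ≡ weight (dist v)
          go (result {v′} _ _) eq eq′ with refl ← ℕ.+-cancelˡ-≡ m v′ v (cong (λ { (weightCell a) → a ; (wordCell a) → a }) eq′) with refl ← eq = refl
          go (close _ _) eq eq′  = ⊥-elim (weight≢ (below (output<base v<n)) (sym eq′))
          go (leaves _ _) eq eq′ = ⊥-elim (weight≢ (below (output<base v<n)) (sym eq′))

        result-other : ∀ v → v ℕ.< n → ¬ X v → weights M₁ (m ℕ.+ v) ≡ weights M (m ℕ.+ v)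
        result-other v v<n ¬x = weights-other l₁ M λ u w → go (All.lookup allowed w) refl
          where
          go : ∀ {x u} → Allowed R X (X ∘ src) (write x u) → x ≢ weightCell (m ℕ.+ v)
          go (result {v′} x _) eq = ¬x (subst X (ℕ.+-cancelˡ-≡ m v′ v (cong (λ { (weightCell a) → a ; (wordCell a) → a }) eq)) x)
          go (close _ _) eq       = weight≢ (below (output<base v<n)) (sym eq)
          go (leaves _ _) eq      = weight≢ (below (output<base v<n)) (sym eq)

        -- Whether v has just been settled shows in the log.
        X? : ∀ v → v ℕ.< n → X v ⊎ (¬ X v × val M₁ (N ℕ.+ v) ≡ val M (N ℕ.+ v))
        X? v v<n with written? l₁ (node (N ℕ.+ v))
        ... | inj₁ (u , w) = case node-write w of λ where
          (closes x _ eq _)   → inj₁ (subst X (sym (ℕ.+-cancelˡ-≡ N _ _ eq)) x)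
          (sets {j} _ _ eq _) → ⊥-elim (top≢leaf {j = j} (vertex<N+N v<n) eq)
        ... | inj₂ ∉l₁ = inj₂ ((λ x → ∉l₁ _ (close∈ (all-settled v v<n x))) , weights-other l₁ M ∉l₁)

        leaf-other : ∀ j → j ℕ.< m → ¬ X (src j) → val M₁ (leaf j) ≡ val M (leaf j)
        leaf-other j j<m ¬x = weights-other l₁ M λ u w → case node-write w of λ where
          (closes _ v<n eq _)      → top≢leaf {j = j} (vertex<N+N v<n) (sym eq)
          (sets {j′} x j′<m eq _) → ¬x (subst (X ∘ src) (sym (leaf-injective j<m j′<m eq)) x)

        repairable : Repairable 1 M₁
        repairable = marked-repairable clean tidy (flags-marked allowed) marked

        module _ {l₂ W B w s} (r : Repairs 1 W B M₁ l₂ w s) where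

          M₃ : Memory
          M₃ = apply l₂ M₁

          weights-below : ∀ {a} → a ℕ.< base → weights M₃ a ≡ weights M₁ a
          weights-below {a} a< = weights-other l₂ M₁ λ v w → go (All.lookup (Repairs.local r) w) refl
            where
            go : ∀ {x v} → Local 1 (write x v) → x ≢ weightCell a
            go (write-node {z} _ _) eq = weight≢ (below a<) (sym eq)

          leaf-kept : ∀ {z} → N³ ℕ.≤ z → z ℕ.< S → val M₃ z ≡ val M₁ z
          leaf-kept {z} N³≤z z<S =
            [ id , (λ (z< , _) → ⊥-elim (ℕ.<⇒≱ z< N³≤z)) ]′
              (Repairs.kept r z (under-root-S (ℕ.≤-trans (ℕ.≤-trans 1≤N N≤N³) N³≤z) z<S) z<S)

          kept-vertex : ∀ {v} → v ℕ.< n → settled M₃ v → val M₃ (N ℕ.+ v) ≡ val M₁ (N ℕ.+ v)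
          kept-vertex {v} v<n = closed-kept r (ℕ.≤-trans 1≤N (ℕ.m≤m+n N v)) (vertex<S v<n)

          negative-kept : ∀ v → v ℕ.< n → ¬ 0# ≤ val M₁ (N ℕ.+ v) → settled M₃ v
          negative-kept v v<n neg p =
            [ (λ eq → neg (subst (0# ≤_) eq p)) , (λ (_ , q , _) → neg q) ]′
              (Repairs.kept r _ (under-root-S (ℕ.≤-trans 1≤N (ℕ.m≤m+n N v)) (vertex<S v<n)) (vertex<S v<n))

          X-settled : ∀ v → v ℕ.< n → X v → settled M₃ v
          X-settled v v<n x = negative-kept v v<n λ p → closing<0 (subst (0# ≤_) (closed₁ v v<n x) p)

          still-settled : ∀ v → v ℕ.< n → settled M v → settled M₃ v
          still-settled v v<n st with X? v v<n
          ... | inj₁ x        = X-settled v v<n x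
          ... | inj₂ (_ , eq) = negative-kept v v<n λ p → st (subst (0# ≤_) eq p)

          core′ : Core M₃
          core′ = record
            { input     = Input-apply (All.map Static-local (Repairs.local r)) (Input-apply (All.map Static-allowed allowed) input)
            ; clean     = λ z 1≤z z< → Repairs.clean r z (under-root-S 1≤z z<) z<
            ; tidy      = λ z 1≤z z< → Repairs.tidy r z (under-root-S 1≤z (ℕ.<-≤-trans z< N³≤S)) z<
            ; closed    = closed-only
            ; done      = done′
            ; leaf-edge = leaf-edge′
            ; leaf-only = leaf-only′ }
            where
            closed-only : ∀ z → 1 ℕ.≤ z → z ℕ.< N³ → ¬ 0# ≤ val M₃ z → ∃[ v ] (v ℕ.< n × z ≡ N ℕ.+ v)
            closed-only z 1≤z z< neg with written? l₁ (node z)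
            ... | inj₁ (v , w) = case node-write w of λ where
              (closes _ v<n eq _) → _ , v<n , eq
              (sets {j} _ _ eq _) → ⊥-elim (ℕ.<⇒≱ z< (ℕ.≤-trans (N³≤leaf j) (ℕ.≤-reflexive (sym eq))))
            ... | inj₂ ∉l₁ = closed z 1≤z z< λ p → neg (subst (0# ≤_)
              (sym (trans (closed-kept r 1≤z (ℕ.<-≤-trans z< N³≤S) neg) (weights-other l₁ M ∉l₁))) p)

            done′ : ∀ v → v ℕ.< n → settled M₃ v → weights M₃ (m ℕ.+ v) ≈ d v
            done′ v v<n st with X? v v<n
            ... | inj₁ x = subst (_≈ d v) (sym (trans (weights-below (output<base v<n)) (result₁ v v<n x))) (dist≈ v v<n x)
            ... | inj₂ (¬x , eq) = subst (_≈ d v) (sym (trans (weights-below (output<base v<n)) (result-other v v<n ¬x)))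
              (done v v<n λ p → st (subst (0# ≤_) (sym (trans (kept-vertex v<n st) eq)) p))

            leaf-edge′ : ∀ j → j ℕ.< m → settled M₃ (src j) → val M₃ (leaf j) ≈ d (src j) + wt j
            leaf-edge′ j j<m st with X? (src j) (src<n j<m)
            ... | inj₁ x = subst (_≈ d (src j) + wt j) (sym (trans (leaf-kept (N³≤leaf j) (leaf<S j<m)) (leaf₁ j j<m x)))
              (R.+-cong (dist≈ (src j) (src<n j<m) x) R.refl)
            ... | inj₂ (¬x , eq) = subst (_≈ d (src j) + wt j) (sym (trans (leaf-kept (N³≤leaf j) (leaf<S j<m)) (leaf-other j j<m ¬x)))
              (leaf-edge j j<m λ p → st (subst (0# ≤_) (sym (trans (kept-vertex (src<n j<m) st) eq)) p))

            leaf-only′ : ∀ z → N³ ℕ.≤ z → z ℕ.< S → ¬ val M₃ z ≤ 0# → ∃[ j ] (j ℕ.< m × z ≡ leaf j × settled M₃ (src j))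
            leaf-only′ z N³≤z z<S pos with written? l₁ (node z)
            ... | inj₁ (v , w) = case node-write w of λ where
              (closes _ v<n eq _) → ⊥-elim (ℕ.<⇒≱ (vertex<N³ v<n) (ℕ.≤-trans N³≤z (ℕ.≤-reflexive eq)))
              (sets x j<m eq _)   → _ , j<m , eq , X-settled _ (src<n j<m) x
            ... | inj₂ ∉l₁ =
              let j , j<m , eq , st = leaf-only z N³≤z z<S (subst (λ v → ¬ v ≤ 0#) (trans (leaf-kept N³≤z z<S) (weights-other l₁ M ∉l₁)) pos) in
              j , j<m , eq , still-settled (src j) (src<n j<m) st

  module Dijkstra (base : ℕ) (first≤base : first ℕ.≤ base) (base+S≤bound : base ℕ.+ S ℕ.≤ bound)
                  (Δ : Distances K G) where
    open Invariants base first≤base base+S≤bound Δ public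

    root-row : Row N h 1
    root-row = row (ℕ.≤-reflexive (sym (ℕ.*-identityˡ N))) (ℕ.≤-reflexive (cong (N ℕ.+_) (ℕ.+-identityʳ N)))

    vertex-row : ∀ {v} → v ℕ.< N → Row N³ (h ℕ.+ h) (N ℕ.+ v)
    vertex-row {v} v<N = row
      (ℕ.≤-trans (ℕ.≤-reflexive (trans (sym N²N³) (cong (N ℕ.*_) N²≡2^))) (ℕ.*-monoˡ-≤ (2 ^ (h ℕ.+ h)) (ℕ.m≤m+n N v)))
      (ℕ.≤-trans (ℕ.*-monoˡ-≤ (2 ^ (h ℕ.+ h)) (ℕ.+-monoʳ-< N v<N))
        (ℕ.≤-reflexive (trans (cong ((N ℕ.+ N) ℕ.*_) (sym N²≡2^)) (trans (ℕ.*-distribʳ-+ N² N N) (cong₂ ℕ._+_ N²N³ N²N³)))))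

    root-vertex : ∀ {v} → v ℕ.< N → Desc h 1 (N ℕ.+ v)
    root-vertex {v} v<N = desc (ℕ.≤-trans (ℕ.≤-reflexive (ℕ.*-identityˡ N)) (ℕ.m≤m+n N v))
      (ℕ.<-≤-trans (ℕ.+-monoʳ-< N v<N) (ℕ.≤-reflexive (sym (cong (N ℕ.+_) (ℕ.+-identityʳ N)))))

    settled? : ∀ M v → Dec (settled M v)
    settled? M v = ¬? (0# ≤? val M (N ℕ.+ v))

    w≥0 : 0# ≤ w
    w≥0 = ≰⇒≥ w>0

    module _ {M : Memory} (core : Core M) where
      open Core core

      open-node : ∀ {y} → 1 ℕ.≤ y → y ℕ.< N³ → (∀ v → v ℕ.< n → y ≢ N ℕ.+ v) → val M y ≡ min⁺ (val M (y ℕ.+ y)) (val M (suc (y ℕ.+ y)))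
      open-node {y} 1≤y y< other = trans (tidy y 1≤y y<) (pick-open (decidable-stable (0# ≤? val M y)
        λ neg → let v , v<n , eq = closed y 1≤y y< neg in other v v<n eq))

      root-minima : Minima (val M) h 1
      root-minima i y i<h d = open-node (Under⇒≤ (i , d)) (ℕ.<-≤-trans y<N N≤N³)
        λ v _ eq → ℕ.<⇒≱ y<N (ℕ.≤-trans (ℕ.m≤m+n N v) (ℕ.≤-reflexive (sym eq)))
        where y<N = Row-inner h root-row i<h d

      vertex-minima : ∀ {v} → v ℕ.< N → ¬ settled M v → Minima (val M) (h ℕ.+ h) (N ℕ.+ v)
      vertex-minima {v} v<N unsettled zero y i<k d with refl ← Desc-zero d =
        trans (tidy y (ℕ.≤-trans 1≤N (ℕ.m≤m+n N v)) (Row-inner (h ℕ.+ h) (vertex-row v<N) i<k d))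
              (pick-open (decidable-stable (0# ≤? val M y) unsettled))
      vertex-minima {v} v<N unsettled (suc i) y i<k d@(desc lo _) =
        open-node (ℕ.≤-trans (ℕ.≤-trans 1≤N (ℕ.m≤m+n N N)) N+N≤y) (Row-inner (h ℕ.+ h) (vertex-row v<N) i<k d)
          λ u u<n eq → ℕ.<⇒≱ (ℕ.+-monoʳ-< N (ℕ.<-≤-trans u<n n≤N)) (ℕ.≤-trans N+N≤y (ℕ.≤-reflexive eq))
        where
        N+N≤y : N ℕ.+ N ℕ.≤ y
        N+N≤y = ℕ.≤-trans (ℕ.≤-reflexive (sym (double N))) (ℕ.≤-trans (ℕ.*-mono-≤ (ℕ.m≤m+n N v) (ℕ.^-monoʳ-≤ 2 (s≤s (z≤n {i})))) lo)

      positive-vertex : ∀ {v} → v ℕ.< N → ¬ val M (N ℕ.+ v) ≤ 0# →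
                        ∃[ j ] (j ℕ.< m × tgt j ≡ v × settled M (src j) × val M (N ℕ.+ v) ≈ d (src j) + wt j)
      positive-vertex {v} v<N pos =
        let z , desc-z , eq = minimum-attained (h ℕ.+ h) (vertex-minima v<N λ neg → neg (≰⇒≥ pos)) pos
            N³≤z , z<S = Row-bottom (h ℕ.+ h) (vertex-row v<N) desc-z
            j , j<m , z≡ , st = leaf-only z N³≤z z<S (subst (λ v → ¬ v ≤ 0#) eq pos)
        in j , j<m
           , ℕ.+-cancelˡ-≡ N _ _ (Desc-unique (h ℕ.+ h) (subst (Desc (h ℕ.+ h) (N ℕ.+ tgt j)) (sym z≡) (leaf-desc j<m)) desc-z)
           , st , subst (_≈ d (src j) + wt j) (sym (trans eq (cong (val M) z≡))) (leaf-edge j j<m st)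

      key-lower : ∀ {v} → v ℕ.< N → ¬ val M (N ℕ.+ v) ≤ 0# → d v ≤ val M (N ℕ.+ v)
      key-lower {v} v<N pos =
        let j , j<m , eq , _ , key = positive-vertex v<N pos in
        Ord.trans (subst (λ v → d v ≤ d (src j) + wt j) eq (d-edge j<m)) (Ord.reflexive (R.sym key))

      wt>0 : ∀ {j} → j ℕ.< m → ¬ wt j ≤ 0#
      wt>0 j<m le = w>0 (Ord.trans (w≤wt j<m) le)

      edge-upper : ∀ {j} → j ℕ.< m → settled M (src j) → ¬ settled M (tgt j) →
                   ¬ val M (N ℕ.+ tgt j) ≤ 0# × val M (N ℕ.+ tgt j) ≤ d (src j) + wt j
      edge-upper {j} j<m st unsettled =
        let pos , le = minimum-below (h ℕ.+ h) (vertex-minima (ℕ.<-≤-trans (tgt<n j<m) n≤N) unsettled) (leaf-desc j<m)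
                         (λ q → +-positive (d≥0 (src<n j<m)) (wt>0 j<m) (Ord.trans (Ord.reflexive (R.sym leaf≈)) q))
        in pos , Ord.trans le (Ord.reflexive leaf≈)
        where leaf≈ = leaf-edge j j<m st

      root-below : ∀ {v} → v ℕ.< N → ¬ val M (N ℕ.+ v) ≤ 0# → ¬ val M 1 ≤ 0# × val M 1 ≤ val M (N ℕ.+ v)
      root-below v<N pos = minimum-below h root-minima (root-vertex v<N) pos

      root-attained : ¬ val M 1 ≤ 0# → ∃[ v ] (v ℕ.< n × val M 1 ≡ val M (N ℕ.+ v))
      root-attained pos with minimum-attained h root-minima pos
      ... | z , desc-z , eq = v , v<n , trans eq (cong (val M) z≡)
        where
        N≤z = proj₁ (Row-bottom h root-row desc-z)
        z<N+N = proj₂ (Row-bottom h root-row desc-z)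
        v = z ℕ.∸ N
        z≡ : z ≡ N ℕ.+ v
        z≡ = sym (ℕ.m+[n∸m]≡n N≤z)
        v<N : v ℕ.< N
        v<N = ℕ.+-cancelˡ-< N v N (subst (ℕ._< N ℕ.+ N) z≡ z<N+N)
        v<n : v ℕ.< n
        v<n = let j , j<m , eq′ , _ = positive-vertex v<N (subst (λ v → ¬ v ≤ 0#) (trans eq (cong (val M) z≡)) pos) in
              subst (ℕ._< n) eq′ (tgt<n j<m)

      module _ (source : settled M s) where

        all-settled : val M 1 ≤ 0# → ∀ v → v ℕ.< n → settled M v
        all-settled root≤0 v v<n = decidable-stable (settled? M v) λ unsettled →
          let j , j<m , st , unsettled′ , _ = cross (settled M) (settled? M) source v<n unsettled in
          proj₁ (root-below (ℕ.<-≤-trans (tgt<n j<m) n≤N) (proj₁ (edge-upper j<m st unsettled′))) root≤0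

        module Horizon {w′ : Carrier} (w′≈w : w′ ≈ w) where

          limit : Carrier
          limit = val M 1 + w′

          open Extraction base first≤base base+S≤bound (val M) limit (0# + (- w′))
            using (Live; live?; Heap)

          -- An unsettled vertex is reached either directly from a settled one,
          -- or through an edge into another unsettled vertex and one more edge.
          reached : ∀ {v} → v ℕ.< n → ¬ settled M v → (¬ val M (N ℕ.+ v) ≤ 0# × val M (N ℕ.+ v) ≤ d v) ⊎ limit ≤ d v
          reached v<n unsettled with cross (settled M) (settled? M) source v<n unsettled
          ... | j , j<m , st , unsettled′ , inj₁ (refl , le) =
            let pos , le′ = edge-upper j<m st unsettled′ in inj₁ (pos , Ord.trans le′ le)
          ... | j , j<m , st , unsettled′ , inj₂ le =
            let pos , le′ = edge-upper j<m st unsettled′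
                _ , le″ = root-below (ℕ.<-≤-trans (tgt<n j<m) n≤N) pos
            in inj₂ (Ord.trans (+-mono-≤ (Ord.trans le″ le′) (Ord.reflexive w′≈w)) le)

          live-exact : ∀ v → v ℕ.< n → Live (N ℕ.+ v) → val M (N ℕ.+ v) ≈ d v
          live-exact v v<n (pos , le) = Ord.antisym
            ([ proj₂ , Ord.trans le ]′ (reached v<n λ neg → neg (≰⇒≥ pos)))
            (key-lower (ℕ.<-≤-trans v<n n≤N) pos)

          not-live : ∀ v → v ℕ.< n → ¬ settled M v → ¬ Live (N ℕ.+ v) → limit ≤ d v
          not-live v v<n unsettled dead with reached v<n unsettled
          ... | inj₁ (pos , le) = Ord.trans (≰⇒≥ λ q → dead (pos , q)) le
          ... | inj₂ le         = le

          min⁺-node : ∀ {z} → 1 ℕ.≤ z → z ℕ.< N → val M z ≡ min⁺ (val M (z ℕ.+ z)) (val M (suc (z ℕ.+ z)))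
          min⁺-node 1≤z z<N = open-node 1≤z (ℕ.<-≤-trans z<N N≤N³)
            λ v _ eq → ℕ.<⇒≱ z<N (ℕ.≤-trans (ℕ.m≤m+n N v) (ℕ.≤-reflexive (sym eq)))

          heap : Heap
          heap = record
            { live-up = λ {z} 1≤z z<N p → subst (λ v → ¬ v ≤ 0# × v ≤ limit) (sym (min⁺-node 1≤z z<N)) (case p of λ where
                (inj₁ (pos , le)) → let q , le′ = min⁺-leftmost pos in q , Ord.trans le′ le
                (inj₂ (pos , le)) → let q , le′ = min⁺-rightmost pos in q , Ord.trans le′ le)
            ; live-down = λ {z} 1≤z z<N (pos , le) →
                case min⁺-witness (subst (λ v → ¬ v ≤ 0#) (min⁺-node 1≤z z<N) pos) of λ where
                  (inj₁ (eq , q)) → inj₁ (q , subst (_≤ limit) (trans (min⁺-node 1≤z z<N) eq) le)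
                  (inj₂ (eq , q)) → inj₂ (q , subst (_≤ limit) (trans (min⁺-node 1≤z z<N) eq) le)
            ; live-leaf = λ v<N (pos , _) → let j , j<m , eq , _ = positive-vertex v<N pos in subst (ℕ._< n) eq (tgt<n j<m) }

  module Phases (base : ℕ) (first≤base : first ℕ.≤ base) (base+S≤bound : base ℕ.+ S ℕ.≤ bound) (Δ : Distances K G)
                where
    open Dijkstra base first≤base base+S≤bound Δ public

    record Inv (M : Memory) (p : ℕ) : Set (c Level.⊔ ℓ₁ Level.⊔ ℓ₂) where
      field
        core   : Core M
        source : settled M s
        lower  : ∀ v → v ℕ.< n → ¬ settled M v → fromℕ (suc p) * w ≤ d v
        spent  : fromℕ p * w ≤ D

    fromℕ-suc-* : ∀ p x → fromℕ (suc p) * x ≈ x + fromℕ p * x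
    fromℕ-suc-* p x = R.trans (R.distribʳ x 1# (fromℕ p)) (R.+-cong (R.*-identityˡ x) R.refl)

    with-length : ∀ {q t M} {Q : Log → ℕ → ℕ → Set q} → Runs t M Q → Runs t M (λ l w s → length l ℕ.≤ w × Q l w s)
    with-length (runs e q) = runs e (length≤work e , q)

    degree : ℕ → ℕ
    degree v = off (suc v) ℕ.∸ off v

    share : ℕ → ℕ
    share v = if does (v ℕ.<? n) then suc (degree v) else 0

    pending : Memory → ℕ → ℕ
    pending M z = if does (0# ≤? val M z) then share (z ℕ.∸ N) else 0

    share-vertex : ∀ {v} → v ℕ.< n → share v ≡ suc (degree v)
    share-vertex {v} v<n = cong (if_then suc (degree v) else 0) (dec-true (v ℕ.<? n) v<n)

    share-none : ∀ {v} → ¬ v ℕ.< n → share v ≡ 0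
    share-none {v} v≮n = cong (if_then suc (degree v) else 0) (dec-false (v ℕ.<? n) v≮n)

    pending-open : ∀ {M z} → 0# ≤ val M z → pending M z ≡ share (z ℕ.∸ N)
    pending-open {M} {z} p = cong (if_then share (z ℕ.∸ N) else 0) (dec-true (0# ≤? val M z) p)

    pending-closed : ∀ {M z} → ¬ 0# ≤ val M z → pending M z ≡ 0
    pending-closed {M} {z} p = cong (if_then share (z ℕ.∸ N) else 0) (dec-false (0# ≤? val M z) p)

    potential : Memory → ℕ
    potential M = treeSum h 1 (pending M)

    open Relaxation base first≤base base+S≤bound (λ _ → 0#) 0# using (Γ; σ)

    phaseWork phaseSpan : ℕ
    phaseWork = 187 ℕ.+ 35 ℕ.* (Γ ℕ.+ h ℕ.* 17)
    phaseSpan = 8 ℕ.+ (5 ℕ.+ σ ℕ.+ h ℕ.* 10) ℕ.+ repairSpan H′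

    private
      phase-work : ∀ {w₁ w₂ w₃} t {l q q₃} → w₁ ℕ.≤ 5 ℕ.+ t ℕ.* (Γ ℕ.+ h ℕ.* 17) → l ℕ.≤ w₁ → w₂ ℕ.≤ 4 ℕ.+ l ℕ.* 34 →
                   w₃ ℕ.≤ 3 ℕ.+ q₃ ℕ.* phaseWork → q₃ ℕ.+ t ℕ.≤ q → 1 ℕ.≤ t →
                   3 ℕ.+ (2 ℕ.+ (w₁ ℕ.+ (2 ℕ.+ (w₂ ℕ.+ suc w₃)))) ℕ.≤ 3 ℕ.+ q ℕ.* phaseWork
      phase-work {w₁} {w₂} {w₃} t {l} {q} {q₃} p₁ p₂ p₃ p₄ p₅ p₆ = ℕ.+-monoʳ-≤ 3 (begin
        2 ℕ.+ (w₁ ℕ.+ (2 ℕ.+ (w₂ ℕ.+ suc w₃)))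
          ≤⟨ ℕ.+-monoʳ-≤ 2 (ℕ.+-mono-≤ p₁ (ℕ.+-monoʳ-≤ 2 (ℕ.+-mono-≤
               (ℕ.≤-trans p₃ (ℕ.+-monoʳ-≤ 4 (ℕ.*-monoˡ-≤ 34 (ℕ.≤-trans p₂ p₁)))) (s≤s p₄)))) ⟩
        2 ℕ.+ (5 ℕ.+ t ℕ.* e ℕ.+ (2 ℕ.+ (4 ℕ.+ (5 ℕ.+ t ℕ.* e) ℕ.* 34 ℕ.+ suc (3 ℕ.+ q₃ ℕ.* phaseWork))))
          ≡⟨ eq₁ t e (q₃ ℕ.* phaseWork) ⟩
        1 ℕ.* 187 ℕ.+ t ℕ.* (35 ℕ.* e) ℕ.+ q₃ ℕ.* phaseWork
          ≤⟨ ℕ.+-monoˡ-≤ (q₃ ℕ.* phaseWork) (ℕ.+-monoˡ-≤ (t ℕ.* (35 ℕ.* e)) (ℕ.*-monoˡ-≤ 187 p₆)) ⟩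
        t ℕ.* 187 ℕ.+ t ℕ.* (35 ℕ.* e) ℕ.+ q₃ ℕ.* phaseWork
          ≡⟨ eq₂ t 187 (35 ℕ.* e) q₃ ⟩
        (q₃ ℕ.+ t) ℕ.* phaseWork
          ≤⟨ ℕ.*-monoˡ-≤ phaseWork p₅ ⟩
        q ℕ.* phaseWork ∎)
        where
        open ℕ.≤-Reasoning
        e = Γ ℕ.+ h ℕ.* 17
        eq₁ : ∀ t e x → 2 ℕ.+ (5 ℕ.+ t ℕ.* e ℕ.+ (2 ℕ.+ (4 ℕ.+ (5 ℕ.+ t ℕ.* e) ℕ.* 34 ℕ.+ suc (3 ℕ.+ x))))
                        ≡ 1 ℕ.* 187 ℕ.+ t ℕ.* (35 ℕ.* e) ℕ.+ x
        eq₁ = solve-∀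
        eq₂ : ∀ t a b q → t ℕ.* a ℕ.+ t ℕ.* b ℕ.+ q ℕ.* (a ℕ.+ b) ≡ (q ℕ.+ t) ℕ.* (a ℕ.+ b)
        eq₂ = solve-∀

      phase-span : ∀ {s₁ s₂ s₃} i → s₁ ℕ.≤ 5 ℕ.+ σ ℕ.+ h ℕ.* 10 → s₂ ℕ.≤ repairSpan H′ → s₃ ℕ.≤ 3 ℕ.+ i ℕ.* phaseSpan →
                   3 ℕ.+ (2 ℕ.+ (s₁ ℕ.+ (2 ℕ.+ (s₂ ℕ.+ suc s₃)))) ℕ.≤ 3 ℕ.+ suc i ℕ.* phaseSpan
      phase-span {s₁} {s₂} {s₃} i p₁ p₂ p₃ = ℕ.≤-trans
        (ℕ.+-monoʳ-≤ 5 (ℕ.+-mono-≤ p₁ (ℕ.+-monoʳ-≤ 2 (ℕ.+-mono-≤ p₂ (s≤s p₃)))))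
        (ℕ.≤-reflexive (eq (5 ℕ.+ σ ℕ.+ h ℕ.* 10) (repairSpan H′) (i ℕ.* phaseSpan)))
        where
        eq : ∀ a b x → 5 ℕ.+ (a ℕ.+ (2 ℕ.+ (b ℕ.+ suc (3 ℕ.+ x)))) ≡ 3 ℕ.+ (8 ℕ.+ a ℕ.+ b ℕ.+ x)
        eq = solve-∀

    Loops : Memory → ℕ → Log → ℕ → ℕ → Set (ℓ₁ Level.⊔ ℓ₂)
    Loops M p l w′ s = (∀ v → v ℕ.< n → weights (apply l M) (m ℕ.+ v) ≈ d v) × w′ ℕ.≤ 3 ℕ.+ potential M ℕ.* phaseWork ×
                       ∃[ i ] (s ℕ.≤ 3 ℕ.+ i ℕ.* phaseSpan × fromℕ (i ℕ.+ p) * w ≤ D)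

    loop-runs : ∀ fuel {p ρ ω M} → potential M ℕ.≤ fuel → Env base ρ → ρ pʳ ≡ base ℕ.+ 1 → ρ xʳ ≡ 1 →
                ω 0ᵂ ≡ 0# → ω widthᵂ ≈ w → ω closedᵂ ≡ 0# + (- ω widthᵂ) → Inv M p →
                Runs (thread PHASE ρ ω) M (Loops M p)
    loop-runs fuel {p} {ρ} {ω} {M} enough env ep ex eZ ew eC inv =
      loadᵂ! refl ep refl $
      (case val M 1 ≤? 0# of λ where
        (yes q) →
          jump≤ᵂ-yes! refl (subst (val M 1 ≤_) (sym eZ) q) $
          halt! refl ((λ v v<n → Core.done core v v<n (all-settled core source q v v<n))
                     , ℕ.m≤m+n 3 _ , 0 , ℕ.m≤m+n 3 _ , spent)
        (no q) →
          jump≤ᵂ-no! refl (λ q′ → q (subst (val M 1 ≤_) eZ q′)) $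
          addᵂ! refl $
          phase fuel enough q)
      where
      open Inv inv

      phase : ∀ fuel → potential M ℕ.≤ fuel → ¬ val M 1 ≤ 0# →
              Runs (thread 32 ρ (ω [ aᵂ ≔ val M 1 ] [ limitᵂ ≔ val M 1 + ω widthᵂ ])) M
                (λ l w s → Loops M p (read (node 1) ∷ l) (3 ℕ.+ w) (3 ℕ.+ s))
      phase fuel enough pos =
        call! {Q₁ = λ l w s → length l ℕ.≤ w × Extracts 1 h (extractWork h 1) (extractSpan h 1) l w s} refl refl
          (with-length (extract-runs heap h env ex ℕ.≤-refl root-row eZ eC refl (Core.input core) (λ _ _ → refl)))
          (λ {l₁} {w₁} {s₁} (len₁ , e) →
            call! {Q₁ = Repairs 1 (repairWork H′ 1 (apply l₁ M)) (repairSpan H′) (apply l₁ M)} refl refl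
              (repair-runs H′ env ex ℕ.≤-refl leaf-row eZ (Settle.ready e))
              (λ {l₂} {w₂} {s₂} r →
                jump! refl $
                Runs-map (λ {l₃} {w₃} {s₃} (out , w≤ , i , s≤ , sp) →
                  (λ v v<n → subst (λ M → weights M (m ℕ.+ v) ≈ d v)
                     (sym (trans (apply-++ l₁ _ M) (apply-++ l₂ l₃ _))) (out v v<n))
                  , phase-work {w₁} {w₂} {w₃} (treeSum h 1 cost) {length l₁} {potential M} {potential (apply l₂ (apply l₁ M))}
                      (work≤ e) len₁ (ℕ.≤-trans (Repairs.work≤ r) (ℕ.+-monoʳ-≤ 4 (ℕ.*-monoˡ-≤ 34 (count-core (Core.clean core) l₁))))
                      w≤ (Settle.decrease e r) cost≥1
                  , suc i , phase-span {s₁} {s₂} {s₃} i (span≤ e) (Repairs.span≤ r) s≤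
                  , subst (λ i → fromℕ i * w ≤ D) (ℕ.+-suc i p) sp) $
                again fuel enough e r)
              λ { s≤ (out , w≤ , i , s≤′ , sp) → out , w≤ , i , ℕ.≤-trans (ℕ.+-monoʳ-≤ 3 (ℕ.+-monoʳ-≤ 2 (ℕ.+-monoʳ-≤ s₁ s≤))) s≤′ , sp })
          λ { s≤ (out , w≤ , i , s≤′ , sp) → out , w≤ , i , ℕ.≤-trans (ℕ.+-monoʳ-≤ 3 s≤) s≤′ , sp }
        where
        open Horizon core source ew
        open Extraction base first≤base base+S≤bound (val M) limit (0# + (- ω widthᵂ))
          using (Heap; Extracts; extractWork; extractSpan; extract-runs; cost; cost-live; cost-dead; cost-positive; Live; live?; Below; Top)
        open Extracts renaming (settled to extracted)

        first-vertex : ∃[ v ] (v ℕ.< n × val M 1 ≡ val M (N ℕ.+ v))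
        first-vertex = root-attained core pos

        w′≥0 : 0# ≤ ω widthᵂ
        w′≥0 = Ord.trans w≥0 (Ord.reflexive (R.sym ew))

        root-live : Live 1
        root-live = pos , ≤-+ˡ (val M 1) w′≥0

        cost≥1 : 1 ℕ.≤ treeSum h 1 cost
        cost≥1 = cost-positive heap h ℕ.≤-refl root-row root-live

        first-lower : fromℕ (suc p) * w ≤ val M 1
        first-lower =
          let v , v<n , eq = first-vertex
              pos′ = subst (λ x → ¬ x ≤ 0#) eq pos
          in subst (fromℕ (suc p) * w ≤_) (sym eq) (Ord.trans (lower v v<n (λ neg → neg (≰⇒≥ pos′)))
               (key-lower core (ℕ.<-≤-trans v<n n≤N) pos′))

        first-upper : val M 1 ≤ D
        first-upper =
          let v , v<n , eq = first-vertex in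
          subst (_≤ D) (sym eq) (Ord.trans (Ord.reflexive
            (live-exact v v<n (subst (λ x → ¬ x ≤ 0# × x ≤ limit) eq root-live))) (d≤D v<n))

        limit-lower : fromℕ (suc (suc p)) * w ≤ limit
        limit-lower = Ord.trans (Ord.reflexive (R.trans (fromℕ-suc-* (suc p) w) (R.+-comm w _)))
          (+-mono-≤ first-lower (Ord.reflexive (R.sym ew)))

        module Settle {l₁ w₁ s₁} (e : Extracts 1 h (extractWork h 1) (extractSpan h 1) l₁ w₁ s₁) where
          open Step {X = Below 1} {R = Top 1} {dist = λ v → val M (N ℕ.+ v)} {closing = 0# + (- ω widthᵂ)}
                 (negated λ le → w>0 (Ord.trans (Ord.reflexive (R.sym ew)) le))
                 (λ v v<n (_ , live) → live-exact v v<n live) core {l₁}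

          all-there : ∀ v → v ℕ.< n → Below 1 v → _
          all-there v v<n (_ , live) = extracted e v (root-vertex (ℕ.<-≤-trans v<n n≤N)) live

          ready : Repairable 1 (apply l₁ M)
          ready = repairable (allowed e) all-there (marked e)

          module _ {l₂ W B w₂ s₂} (r : Repairs 1 W B (apply l₁ M) l₂ w₂ s₂) where

            below : ∀ {v} → v ℕ.< n → Live (N ℕ.+ v) → Below 1 v
            below v<n live = (h , root-vertex (ℕ.<-≤-trans v<n n≤N)) , live

            inv′ : Inv (apply l₂ (apply l₁ M)) (suc p)
            inv′ = record
              { core   = core′ (allowed e) all-there (marked e) r
              ; source = still-settled (allowed e) all-there (marked e) r s s<n source
              ; lower  = λ v v<n unsettled → Ord.trans limit-lower (not-live v v<n
                  (λ st → unsettled (still-settled (allowed e) all-there (marked e) r v v<n st))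
                  (λ live → unsettled (X-settled (allowed e) all-there (marked e) r v v<n (below v<n live))))
              ; spent  = Ord.trans first-lower first-upper }

            decrease : potential (apply l₂ (apply l₁ M)) ℕ.+ treeSum h 1 cost ℕ.≤ potential M
            decrease = ℕ.≤-trans (ℕ.≤-reflexive (treeSum-+ h _ cost)) (treeSum-mono h λ z desc-z → pointwise z (Row-bottom h root-row desc-z))
              where
              M′ = apply l₂ (apply l₁ M)
              pointwise : ∀ z → N ℕ.≤ z × z ℕ.< N ℕ.+ N → pending M′ z ℕ.+ cost z ℕ.≤ pending M z
              pointwise z (N≤z , z<) = subst (λ z → pending M′ z ℕ.+ cost z ℕ.≤ pending M z) (ℕ.m+[n∸m]≡n N≤z)
                (at (z ℕ.∸ N) (ℕ.+-cancelˡ-< N _ _ (subst (ℕ._< N ℕ.+ N) (sym (ℕ.m+[n∸m]≡n N≤z)) z<)))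
                where
                at : ∀ v → v ℕ.< N → pending M′ (N ℕ.+ v) ℕ.+ cost (N ℕ.+ v) ℕ.≤ pending M (N ℕ.+ v)
                at v v<N = by-case (live? (N ℕ.+ v))
                  where
                  by-case : Dec (Live (N ℕ.+ v)) → pending M′ (N ℕ.+ v) ℕ.+ cost (N ℕ.+ v) ℕ.≤ pending M (N ℕ.+ v)
                  by-case (yes live) = subst (λ i → i ℕ.+ cost (N ℕ.+ v) ℕ.≤ pending M (N ℕ.+ v)) (sym pending₃)
                      (ℕ.≤-reflexive (trans (cost-live live) (trans (sym (share-vertex v<n′)) (sym pending₀))))
                      where
                      v<n = Heap.live-leaf heap v<N live
                      v<n′ = subst (ℕ._< n) (sym (ℕ.m+n∸m≡n N v)) v<n
                      pending₃ = pending-closed {M′} {N ℕ.+ v} (X-settled (allowed e) all-there (marked e) r v v<n (below v<n live))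
                      pending₀ = pending-open {M} {N ℕ.+ v} (≰⇒≥ (proj₁ live))
                  by-case (no dead) = subst (λ i → pending M′ (N ℕ.+ v) ℕ.+ i ℕ.≤ pending M (N ℕ.+ v)) (sym (cost-dead dead))
                      (ℕ.≤-trans (ℕ.≤-reflexive (ℕ.+-identityʳ _)) (unchanged (v ℕ.<? n) (0# ≤? val M′ (N ℕ.+ v))))
                      where
                      unchanged : Dec (v ℕ.< n) → Dec (0# ≤ val M′ (N ℕ.+ v)) → pending M′ (N ℕ.+ v) ℕ.≤ pending M (N ℕ.+ v)
                      unchanged _ (no st) = ℕ.≤-trans (ℕ.≤-reflexive (pending-closed {M′} {N ℕ.+ v} st)) z≤n
                      unchanged (yes v<n) (yes p) = ℕ.≤-reflexive (trans (pending-open {M′} {N ℕ.+ v} p) (sym (pending-open {M} {N ℕ.+ v}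
                        (decidable-stable (0# ≤? val M (N ℕ.+ v)) λ st → still-settled (allowed e) all-there (marked e) r v v<n st p))))
                      unchanged (no v≮n) (yes p) = ℕ.≤-trans (ℕ.≤-reflexive (trans (pending-open {M′} {N ℕ.+ v} p)
                        (share-none λ v<n → v≮n (subst (ℕ._< n) (ℕ.m+n∸m≡n N v) v<n)))) z≤n

        again : ∀ fuel → potential M ℕ.≤ fuel → ∀ {l₁ w₁ s₁} (e : Extracts 1 h (extractWork h 1) (extractSpan h 1) l₁ w₁ s₁) →
                ∀ {l₂ W B w₂ s₂} (r : Repairs 1 W B (apply l₁ M) l₂ w₂ s₂) →
                Runs (thread PHASE ρ (ω [ aᵂ ≔ val M 1 ] [ limitᵂ ≔ val M 1 + ω widthᵂ ])) (apply l₂ (apply l₁ M))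
                  (Loops (apply l₂ (apply l₁ M)) (suc p))
        again zero enough e r = ⊥-elim (ℕ.<⇒≱ cost≥1 (ℕ.≤-trans (ℕ.m≤n+m _ _) (ℕ.≤-trans (Settle.decrease e r) enough)))
        again (suc fuel) enough e r = loop-runs fuel
          (ℕ.≤-pred (ℕ.≤-trans (ℕ.≤-trans (ℕ.≤-reflexive (ℕ.+-comm 1 _)) (ℕ.+-monoʳ-≤ _ cost≥1)) (ℕ.≤-trans (Settle.decrease e r) enough)))
          env ep ex eZ ew eC (Settle.inv′ e r)

  module Width (base : ℕ) (first≤base : first ℕ.≤ base) (base+S≤bound : base ℕ.+ S ℕ.≤ bound) (Δ : Distances K G)
               where
    open Repairing base first≤base base+S≤bound
    open Distances Δ
    open Relaxation base first≤base base+S≤bound (λ _ → 0#) 0#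
      using (Allowed; leaves; flags-marked; Range; relax; ∅)

    module _ {M : Memory} (clean : ∀ z → z ℕ.< S → dirt M z ≡ 0) (blank : ∀ z → z ℕ.< S → val M z ≡ 0#) where

      module _ {l₁} (allowed : All (Allowed ∅ ∅ (Range 0 m)) l₁) (relaxed : ∀ j → Range 0 m j → relax j ∈ l₁) (marked : Marked l₁) where

        ready : Repairable 1 (apply l₁ M)
        ready = marked-repairable (λ z _ → clean z) (blank-tidy {M} blank) (flags-marked allowed) marked

        leaf-write : ∀ {z u} → write (node z) u ∈ l₁ → ∃[ j ] (j ℕ.< m × z ≡ leaf j × u ≡ weight (0# + wt j))
        leaf-write {z} {u} w = go (All.lookup allowed w) refl refl
          where
          go : ∀ {e} → Allowed ∅ ∅ (Range 0 m) e → e ≡ write (node z) u → cell e ≡ node z → ∃[ j ] (j ℕ.< m × z ≡ leaf j × u ≡ weight (0# + wt j))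
          go (leaves x j<m) eq eq′ with refl ← node-injective eq′ with refl ← eq = _ , j<m , refl , refl

        leaf₁ : ∀ j → j ℕ.< m → val (apply l₁ M) (leaf j) ≡ 0# + wt j
        leaf₁ j j<m = cong (λ { (weight v) → v }) (get-apply-write l₁ M (relaxed j (z≤n , j<m)) λ w →
          let j′ , j′<m , eq , eq′ = leaf-write w in
          trans eq′ (cong (λ j → weight (0# + wt j)) (sym (leaf-injective j<m j′<m eq))))

        module _ {l₂ W B w₂ s₂} (r : Repairs 1 W B (apply l₁ M) l₂ w₂ s₂) where

          M₂ : Memory
          M₂ = apply l₂ (apply l₁ M)

          leaf-kept : ∀ {z} → N³ ℕ.≤ z → z ℕ.< S → val M₂ z ≡ val (apply l₁ M) z
          leaf-kept {z} N³≤z z<S = [ id , (λ (z< , _) → ⊥-elim (ℕ.<⇒≱ z< N³≤z)) ]′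
            (Repairs.kept r z (under-root-S (ℕ.≤-trans (ℕ.≤-trans 1≤N N≤N³) N³≤z) z<S) z<S)

          nonNegative : ∀ z → 1 ℕ.≤ z → z ℕ.< N³ → 0# ≤ val M₂ z
          nonNegative z 1≤z z< with Repairs.kept r z (under-root-S 1≤z (ℕ.<-≤-trans z< N³≤S)) (ℕ.<-≤-trans z< N³≤S)
          ... | inj₂ (_ , _ , p) = p
          ... | inj₁ eq = Ord.reflexive (R.reflexive (sym (trans eq (trans
            (weights-other l₁ M λ v w → let j , _ , eq′ , _ = leaf-write w in ℕ.<⇒≱ z< (ℕ.≤-trans (N³≤leaf j) (ℕ.≤-reflexive (sym eq′))))
            (blank z (ℕ.<-≤-trans z< N³≤S))))))

          minima : Minima (val M₂) H′ 1
          minima i y i<k d = trans (Repairs.tidy r y (i , d) y<) (pick-open (nonNegative y (Under⇒≤ (i , d)) y<))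
            where y< = Row-inner H′ leaf-row i<k d

          leaf-under : ∀ j → j ℕ.< m → Desc H′ 1 (leaf j)
          leaf-under j j<m = desc
            (ℕ.≤-trans (ℕ.≤-reflexive (trans (ℕ.*-identityˡ _) (sym N³≡2^))) (N³≤leaf j))
            (ℕ.<-≤-trans (leaf<S j<m) (ℕ.≤-reflexive S≡2^H))

          wt>0′ : ∀ {j} → j ℕ.< m → ¬ 0# + wt j ≤ 0#
          wt>0′ {j} j<m = +-positive Ord.refl λ le → w>0 (Ord.trans (w≤wt j<m) le)

          root≈w : val M₂ 1 ≈ w
          root≈w = Ord.antisym root≤w w≤root
            where
            least = wt-min
            j₀ = proj₁ least
            j₀<m = proj₁ (proj₂ least)
            leaf≡ : ∀ j → j ℕ.< m → val M₂ (leaf j) ≡ 0# + wt j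
            leaf≡ j j<m = trans (leaf-kept (N³≤leaf j) (leaf<S j<m)) (leaf₁ j j<m)
            below-root = minimum-below H′ minima (leaf-under j₀ j₀<m)
              (subst (λ v → ¬ v ≤ 0#) (sym (leaf≡ j₀ j₀<m)) (wt>0′ j₀<m))
            root≤w : val M₂ 1 ≤ w
            root≤w = Ord.trans (proj₂ below-root) (Ord.trans (Ord.reflexive (R.trans (R.reflexive (leaf≡ j₀ j₀<m)) (R.+-identityˡ _)))
              (proj₂ (proj₂ least)))
            w≤root : w ≤ val M₂ 1
            w≤root with minimum-attained H′ minima (proj₁ below-root)
            ... | z , d , eq with Row-bottom H′ leaf-row d | written? l₁ (node z)
            ...   | N³≤z , z<S | inj₁ (u , wr) =
              let j , j<m , z≡ , _ = leaf-write wr in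
              Ord.trans (w≤wt j<m) (Ord.reflexive (R.trans (R.sym (R.+-identityˡ _))
                (R.reflexive (sym (trans eq (trans (cong (val M₂) z≡) (leaf≡ j j<m)))))))
            ...   | N³≤z , z<S | inj₂ ∉l₁ = ⊥-elim (proj₁ below-root (Ord.reflexive (R.reflexive
              (trans eq (trans (leaf-kept N³≤z z<S) (trans (weights-other l₁ M ∉l₁) (blank z z<S)))))))

  module Main (Δ : Distances K G) (least : ∀ i → i ℕ.< h → 2 ^ i ℕ.< n) where
    open Distances Δ

    base₂ : ℕ
    base₂ = first ℕ.+ N³ ℕ.+ N³

    first≤base₂ : first ℕ.≤ base₂
    first≤base₂ = ℕ.≤-trans (ℕ.m≤m+n first N³) (ℕ.m≤m+n _ N³)

    first+S≤bound : first ℕ.+ S ℕ.≤ bound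
    first+S≤bound = ℕ.+-monoˡ-≤ S first≤base₂

    module A = Repairing first ℕ.≤-refl first+S≤bound
    module WA = Width first ℕ.≤-refl first+S≤bound Δ
    module RA = Relaxation first ℕ.≤-refl first+S≤bound (λ _ → 0#) 0#
    module B = Phases base₂ first≤base₂ ℕ.≤-refl Δ

    potential≤ : ∀ M → B.potential M ℕ.≤ m ℕ.+ n
    potential≤ M = ℕ.≤-trans (treeSum-mono h λ z _ → pending≤ z) (ℕ.≤-trans (ℕ.m≤m+n _ (F (1 ℕ.* 2 ^ h))) (begin
      treeSum h 1 (λ z → B.share (z ℕ.∸ N)) ℕ.+ F (1 ℕ.* 2 ^ h)   ≡⟨ telescope h {F = F} B.root-row step-F ⟩
      F (2 ℕ.* 2 ^ h)                                             ≤⟨ F≤ (2 ℕ.* 2 ^ h ℕ.∸ N) ⟩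
      m ℕ.+ n                                                     ∎))
      where
      open ℕ.≤-Reasoning
      F₀ F : ℕ → ℕ
      F₀ v = off (v ℕ.⊓ n) ℕ.+ v ℕ.⊓ n
      F z = F₀ (z ℕ.∸ N)
      F≤ : ∀ v → F₀ v ℕ.≤ m ℕ.+ n
      F≤ v = ℕ.+-mono-≤ (off≤m (ℕ.m⊓n≤n v n)) (ℕ.m⊓n≤n v n)
      pending≤ : ∀ z → B.pending M z ℕ.≤ B.share (z ℕ.∸ N)
      pending≤ z with 0# ≤? B.val M z
      ... | yes _ = ℕ.≤-refl
      ... | no _  = z≤n
      F₀-suc : ∀ v → Dec (v ℕ.< n) → B.share v ℕ.+ F₀ v ≡ F₀ (suc v)
      F₀-suc v (yes v<n) = trans (cong₂ ℕ._+_ (B.share-vertex v<n) (cong (λ v → off v ℕ.+ v) (ℕ.m≤n⇒m⊓n≡m (ℕ.<⇒≤ v<n))))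
        (trans (rearrange (off (suc v) ℕ.∸ off v) (off v) v) (trans (cong (ℕ._+ suc v) (ℕ.m∸n+n≡m (off-mono v<n)))
          (cong (λ v → off v ℕ.+ v) (sym (ℕ.m≤n⇒m⊓n≡m v<n)))))
        where
        rearrange : ∀ a b v → suc a ℕ.+ (b ℕ.+ v) ≡ a ℕ.+ b ℕ.+ suc v
        rearrange = solve-∀
      F₀-suc v (no v≮n) = trans (cong (ℕ._+ F₀ v) (B.share-none v≮n))
        (cong (λ v → off v ℕ.+ v) (trans (ℕ.m≥n⇒m⊓n≡n (ℕ.≮⇒≥ v≮n)) (sym (ℕ.m≥n⇒m⊓n≡n (ℕ.m≤n⇒m≤1+n (ℕ.≮⇒≥ v≮n))))))
      step-F : ∀ z → N ℕ.≤ z → B.share (z ℕ.∸ N) ℕ.+ F z ≡ F (suc z)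
      step-F z N≤z = trans (F₀-suc (z ℕ.∸ N) (z ℕ.∸ N ℕ.<? n)) (cong F₀ (sym (ℕ.+-∸-assoc 1 N≤z)))

    record Ends (M : Memory) (W B w′ s : ℕ) : Set (ℓ₁ Level.⊔ ℓ₂) where
      constructor ends
      field
        distances : ∀ v → v ℕ.< n → weights M (m ℕ.+ v) ≈ d v
        work≤     : w′ ℕ.≤ W
        phases    : ℕ
        span≤     : s ℕ.≤ B ℕ.+ phases ℕ.* B.phaseSpan
        phases≤   : fromℕ phases * w ≤ D

    Post : Memory → ℕ → ℕ → Log → ℕ → ℕ → Set (ℓ₁ Level.⊔ ℓ₂)
    Post M W B l = Ends (apply l M) W B

    later : ∀ k {M W B w′ s} → Ends M W B w′ s → Ends M (k ℕ.+ W) (k ℕ.+ B) (k ℕ.+ w′) (k ℕ.+ s)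
    later k {B = B} (ends out w≤ i s≤ sp) =
      ends out (ℕ.+-monoʳ-≤ k w≤) i (ℕ.≤-trans (ℕ.+-monoʳ-≤ k s≤) (ℕ.≤-reflexive (sym (ℕ.+-assoc k B _)))) sp

    callPost : ∀ {q pc l l′ ρ ω M A C W B} {P : Log → ℕ → Set q} →
               nth halt sssp pc ≡ fork l l′ → nth halt sssp l′ ≡ halt →
               Runs (thread l ρ ω) M (λ l₁ w₁ s₁ → P l₁ w₁ × w₁ ℕ.≤ A × s₁ ℕ.≤ C) →
               (∀ {l₁ w₁} → P l₁ w₁ → w₁ ℕ.≤ A → length l₁ ℕ.≤ w₁ → Runs (thread (suc pc) ρ ω) (apply l₁ M) (Post (apply l₁ M) W B)) →
               Runs (thread pc ρ ω) M (Post M (2 ℕ.+ (A ℕ.+ W)) (2 ℕ.+ (C ℕ.+ B)))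
    callPost {M = M} {A} {C} {W} {B} {P} i i′ callee rest =
      call! {Q₁ = λ l₁ w₁ s₁ → length l₁ ℕ.≤ w₁ × P l₁ w₁ × w₁ ℕ.≤ A × s₁ ℕ.≤ C} i i′ (B.with-length callee)
        (λ {l₁} {w₁} {s₁} (len , p , w₁≤ , s₁≤) →
          Runs-map (λ {l₃} (ends out w≤ i s≤ sp) → ends
            (λ v v<n → subst (λ M → weights M (m ℕ.+ v) ≈ d v) (sym (apply-++ l₁ l₃ M)) (out v v<n))
            (ℕ.+-monoʳ-≤ 2 (ℕ.+-mono-≤ w₁≤ w≤)) i
            (ℕ.≤-trans (ℕ.+-monoʳ-≤ 2 (ℕ.+-mono-≤ s₁≤ s≤)) (ℕ.≤-reflexive (cong (2 ℕ.+_) (sym (ℕ.+-assoc C B _))))) sp)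
          (rest p w₁≤ len))
        λ { s≤ (ends out w≤ i s≤′ sp) → ends out w≤ i (ℕ.≤-trans s≤ s≤′) sp }

    Γ settleSpan repairSpan′ edgesSpan : ℕ
    Γ = RA.Γ
    settleSpan = RA.σ
    repairSpan′ = B.repairSpan B.H′
    edgesSpan = RA.β ℕ.+ (h ℕ.+ h) ℕ.* 9

    opaque
      edgesWork settleWork : ℕ
      edgesWork = 2 ℕ.+ m ℕ.* Γ
      settleWork = suc m ℕ.* Γ

      edgesWork≡ : edgesWork ≡ 2 ℕ.+ m ℕ.* Γ
      edgesWork≡ = refl

      settleWork≡ : settleWork ≡ suc m ℕ.* Γ
      settleWork≡ = refl

    W₁ B₁ W₂′ B₂′ W₂ B₂ W₃″ B₃″ W₃′ B₃′ W₃ B₃ : ℕ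
    W₁ = 4 ℕ.+ (m ℕ.+ n) ℕ.* B.phaseWork
    B₁ = 4
    W₂′ = 2 ℕ.+ (4 ℕ.+ settleWork ℕ.* 34 ℕ.+ W₁)
    B₂′ = 2 ℕ.+ (repairSpan′ ℕ.+ B₁)
    W₂ = 4 ℕ.+ (2 ℕ.+ (settleWork ℕ.+ (1 ℕ.+ W₂′)))
    B₂ = 4 ℕ.+ (2 ℕ.+ (settleSpan ℕ.+ (1 ℕ.+ B₂′)))
    W₃″ = 2 ℕ.+ (4 ℕ.+ edgesWork ℕ.* 34 ℕ.+ (2 ℕ.+ W₂))
    B₃″ = 2 ℕ.+ (repairSpan′ ℕ.+ (2 ℕ.+ B₂))
    W₃′ = 2 ℕ.+ (edgesWork ℕ.+ (1 ℕ.+ W₃″))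
    B₃′ = 2 ℕ.+ (edgesSpan ℕ.+ (1 ℕ.+ B₃″))
    W₃ = 6 ℕ.+ W₃′
    B₃ = 6 ℕ.+ B₃′

    phases-run : ∀ {ρ ω M} → Env base₂ ρ → ρ xʳ ≡ 1 → ω 0ᵂ ≡ 0# → ω widthᵂ ≈ w → ω closedᵂ ≡ 0# + (- ω widthᵂ) → B.Inv M 0 →
                 Runs (thread 28 ρ ω) M (Post M W₁ B₁)
    phases-run {M = M} env@(_ , e1 , _ , _ , _ , _ , _ , _ , _ , eb) ex eZ ew eC inv =
      add! refl (cong₂ ℕ._+_ eb e1) (ℕ.+-monoʳ-≤ base₂ (ℕ.≤-trans (ℕ.≤-trans 1≤N N≤N³) N³≤S)) $
      Runs-map (λ (out , w≤ , i , s≤ , sp) → ends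
        out (ℕ.+-monoʳ-≤ 1 (ℕ.≤-trans w≤ (ℕ.+-monoʳ-≤ 3 (ℕ.*-monoˡ-≤ B.phaseWork (potential≤ M))))) i
        (ℕ.+-monoʳ-≤ 1 s≤) (subst (λ i → fromℕ i * w ≤ D) (ℕ.+-identityʳ i) sp)) $
      B.loop-runs (B.potential M) ℕ.≤-refl env refl ex eZ ew eC inv

    source-runs : ∀ {ρ ω M} → Env first ρ → ρ sʳ ≡ s → ω 0ᵂ ≡ 0# → ω aᵂ ≡ 0# → ω widthᵂ ≈ w →
                  B.Core M → Runs (thread 21 ρ ω) M (Post M W₂ B₂)
    source-runs {ρ} {ω} {M} env@(e0 , e1 , e2 , e3 , em , eN , eN² , eN³ , et , eb) es eZ ea ew core =
      subᵂ! refl $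
      add! {z = first ℕ.+ N³} refl (cong₂ ℕ._+_ eb eN³) (ℕ.≤-trans (ℕ.m≤m+n _ N³) (ℕ.m≤m+n base₂ S)) $
      add! {z = base₂} refl (cong (first ℕ.+ N³ ℕ.+_) eN³) (ℕ.m≤m+n base₂ S) $
      add! {z = N ℕ.+ s} refl (cong₂ ℕ._+_ eN es) (B.≤S⇒≤bound (ℕ.<⇒≤ (B.vertex<S s<n))) $
      Runs-map (later 4 {W = 2 ℕ.+ (settleWork ℕ.+ (1 ℕ.+ W₂′))} {2 ℕ.+ (settleSpan ℕ.+ (1 ℕ.+ B₂′))}) $
      callPost {A = settleWork} {settleSpan} {1 ℕ.+ W₂′} {1 ℕ.+ B₂′} {P = λ l₁ w₁ → Σ ℕ λ s₁ → SB.Settles s (suc (SB.deg s) ℕ.* Γ) settleSpan l₁ w₁ s₁} refl refl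
        (Runs-map (λ e → (_ , e) , settle-bound (SB.Settles.work≤ e)
                         , SB.Settles.span≤ e) $
         SB.settle-runs s<n env₂ refl ea (cong (_+ (- ω widthᵂ)) eZ) (B.Core.input core))
        λ {l₁} {w₁} (_ , e) w₁≤ len →
          sub! {z = 1} refl (cong₂ ℕ._∸_ e1 e0) $
          Runs-map (later 1 {W = W₂′} {B₂′}) $
          callPost {A = 4 ℕ.+ settleWork ℕ.* 34} {repairSpan′} {W₁} {B₁} {P = λ l₂ w₂ → Σ ℕ λ s₂ → B.Repairs 1 (B.repairWork B.H′ 1 (apply l₁ M)) repairSpan′ (apply l₁ M) l₂ w₂ s₂} refl refl
            (Runs-map {Q = B.Repairs 1 (B.repairWork B.H′ 1 (apply l₁ M)) repairSpan′ (apply l₁ M)} (λ r → (_ , r) , B.repair-after {M} {l₁} {A = settleWork} (B.Core.clean core) (B.Repairs.work≤ r) len w₁≤ refl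
                             , B.Repairs.span≤ r) $
             B.repair-runs B.H′ env₂ refl ℕ.≤-refl B.leaf-row eZ (Settle.ready e))
            λ (_ , r) _ _ → phases-run env₂ refl eZ ew (cong (_+ (- ω widthᵂ)) eZ) (Settle.inv e r)
      where
      settle-bound : ∀ {w} → w ℕ.≤ suc (off (suc s) ℕ.∸ off s) ℕ.* Γ → w ℕ.≤ settleWork
      settle-bound {w} w≤ = ℕ.≤-trans w≤ (ℕ.≤-trans
        (ℕ.*-monoˡ-≤ Γ (s≤s (ℕ.≤-trans (ℕ.m∸n≤m (off (suc s)) (off s)) (off≤m s<n)))) (ℕ.≤-reflexive (sym settleWork≡)))

      module SB = Settlement base₂ first≤base₂ ℕ.≤-refl (λ _ → 0#) (0# + (- ω widthᵂ))

      env₂ : Env base₂ (ρ [ baseʳ ≔ base₂ ])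
      env₂ = e0 , e1 , e2 , e3 , em , eN , eN² , eN³ , et , refl

      source-exact : ∀ v → v ℕ.< n → v ≡ s → 0# ≈ d v
      source-exact v v<n refl = R.sym d-source

      module Settle {l₁ w₁ s₁} (e : SB.Settles s (suc (SB.deg s) ℕ.* Γ) settleSpan l₁ w₁ s₁) where
        open SB.Settles e
        open B.Step {X = _≡ s} {R = SB.∅} {dist = λ _ → 0#} {closing = 0# + (- ω widthᵂ)}
               (negated λ le → w>0 (Ord.trans (Ord.reflexive (R.sym ew)) le))
               source-exact core {l₁}

        there′ : ∀ v → v ℕ.< n → v ≡ s → SB.Settled v l₁
        there′ v v<n refl = settled

        ready : B.Repairable 1 (apply l₁ M)
        ready = repairable allowed there′ marked

        inv : ∀ {l₂ W B w₂ s₂} → B.Repairs 1 W B (apply l₁ M) l₂ w₂ s₂ → B.Inv (apply l₂ (apply l₁ M)) 0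
        inv {l₂} r = record
          { core   = core′ allowed there′ marked r
          ; source = source
          ; lower  = λ v v<n unsettled → Ord.trans (Ord.reflexive (R.trans (B.fromℕ-suc-* 0 w) (R.trans (R.+-cong R.refl (R.zeroˡ w)) (R.+-identityʳ w))))
              (case cross (B.settled M′) (B.settled? M′) source v<n unsettled of λ where
                (j , j<m , _ , _ , inj₁ (_ , le)) → Ord.trans (w≤wt j<m) (Ord.trans (≤-+ʳ (wt j) (d≥0 (src<n j<m))) le)
                (j , j<m , _ , _ , inj₂ le) → Ord.trans (≤-+ʳ w (Ord.trans (d≥0 (src<n j<m)) (≤-+ˡ (d (src j)) (≰⇒≥ λ le → w>0 (Ord.trans (w≤wt j<m) le))))) le)
          ; spent  = Ord.trans (Ord.reflexive (R.zeroˡ w)) (Ord.trans (d≥0 s<n) (d≤D s<n)) }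
          where
          M′ = apply l₂ (apply l₁ M)
          source : B.settled M′ s
          source = X-settled allowed there′ marked r s s<n refl

    record Initial (M : Memory) : Set c where
      field
        header-n : words M 0 ≡ n
        header-m : words M 1 ≡ m
        header-s : words M 2 ≡ s
        input    : Input M
        blankʷ   : ∀ a → first ℕ.≤ a → words M a ≡ 0
        blankᵂ   : ∀ a → m ℕ.≤ a → weights M a ≡ 0#

    Boot : (Register → ℕ) → Set
    Boot ρ = ρ 0ʳ ≡ 0 × ρ 1ʳ ≡ 1 × ρ 2ʳ ≡ 2 × ρ 3ʳ ≡ 3 × ρ nʳ ≡ n × ρ mʳ ≡ m × ρ sʳ ≡ s × ρ loʳ ≡ 0

    size-runs : ∀ k {i ρ ω M W B} → i ℕ.+ k ≡ h → Boot ρ → ρ Nʳ ≡ 2 ^ i →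
                (∀ {ρ′} → Boot ρ′ → ρ′ Nʳ ≡ N → Runs (thread LAYOUT ρ′ ω) M (Post M W B)) →
                Runs (thread SIZE ρ ω) M (Post M (1 ℕ.+ k ℕ.* 3 ℕ.+ W) (1 ℕ.+ k ℕ.* 3 ℕ.+ B))
    size-runs zero {i} {W = W} {B} eq boot@(_ , _ , _ , _ , en , _) eN rest
      with refl ← trans (sym (ℕ.+-identityʳ i)) eq =
      jump≤-yes! refl (subst₂ ℕ._≤_ (sym en) (sym eN) n≤N) $
      Runs-map (later 1 {W = W} {B}) $
      rest boot eN
    size-runs (suc k) {i} {W = W} {B} eq boot@(_ , _ , _ , _ , en , _) eN rest =
      jump≤-no! refl (subst₂ ℕ._<_ (sym eN) (sym en) (least i i<h)) $
      add! {z = 2 ^ suc i} refl (trans (cong₂ ℕ._+_ eN eN) (sym (2^-suc i)))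
        (B.≤S⇒≤bound (ℕ.≤-trans (ℕ.^-monoʳ-≤ 2 i<h) (ℕ.≤-trans N≤N³ N³≤S))) $
      jump! refl $
      Runs-map (later 3 {W = 1 ℕ.+ k ℕ.* 3 ℕ.+ W} {1 ℕ.+ k ℕ.* 3 ℕ.+ B}) $
      size-runs k (trans (sym (ℕ.+-suc i k)) eq) boot refl rest
      where
      i<h : i ℕ.< h
      i<h = subst (i ℕ.<_) eq (ℕ.m<m+n i (s≤s z≤n))

    module _ {M : Memory} (initial : Initial M) where
      open Initial initial

      region-dirt : ∀ {base z} → first ℕ.≤ base → words M (base ℕ.+ z) ≡ 0
      region-dirt {base} {z} le = blankʷ _ (ℕ.≤-trans le (ℕ.m≤m+n base z))

      region-val : ∀ {base z} → first ℕ.≤ base → weights M (base ℕ.+ z) ≡ 0#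
      region-val {base} {z} le = blankᵂ _ (ℕ.≤-trans (ℕ.≤-trans (ℕ.m≤n+m m targets) le) (ℕ.m≤m+n base z))

      tree-runs : ∀ {ρ ω} → Env first ρ → ρ sʳ ≡ s → ρ loʳ ≡ 0 → ρ hiʳ ≡ m → ω 0ᵂ ≡ 0# → ω aᵂ ≡ 0# →
                  Runs (thread 16 ρ ω) M
                    (Post M W₃′ B₃′)
      tree-runs {ρ} {ω} env@(e0 , e1 , _ , _ , _ , _ , _ , _ , _ , eb) es elo ehi eZ ea =
        callPost {A = edgesWork} {edgesSpan} {1 ℕ.+ W₃″} {1 ℕ.+ B₃″} {P = λ l₁ _ → All (RA.Allowed RA.∅ RA.∅ (RA.Range 0 m)) l₁ × (∀ j → RA.Range 0 m j → RA.relax j ∈ l₁) × RA.Marked l₁} refl refl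
          (Runs-map (λ (all , rel , mk , w≤ , s≤) → (all , rel , mk) , ℕ.≤-trans w≤ (ℕ.≤-reflexive (sym edgesWork≡)) , s≤) $
           RA.edges-runs env elo ehi ea z≤n ℕ.≤-refl input λ _ → refl)
          λ {l₁} {w₁} (all , rel , mk) w₁≤ len →
            sub! {z = 1} refl (cong₂ ℕ._∸_ e1 e0) $
            Runs-map (later 1 {W = W₃″} {B₃″}) $
            callPost {A = 4 ℕ.+ edgesWork ℕ.* 34} {repairSpan′} {2 ℕ.+ W₂} {2 ℕ.+ B₂} {P = λ l₂ w₂ → Σ ℕ λ s₂ → A.Repairs 1 (A.repairWork A.H′ 1 (apply l₁ M)) repairSpan′ (apply l₁ M) l₂ w₂ s₂} refl refl
              (Runs-map {Q = A.Repairs 1 (A.repairWork A.H′ 1 (apply l₁ M)) repairSpan′ (apply l₁ M)} (λ r → (_ , r) , A.repair-after {M} {l₁} {A = edgesWork} (λ z _ → dirt₁ z) (A.Repairs.work≤ r) len w₁≤ refl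
                               , A.Repairs.span≤ r) $
               A.repair-runs A.H′ env refl ℕ.≤-refl A.leaf-row eZ (WA.ready {M} dirt₁ val₁ all rel mk))
              λ {l₂} (_ , r) _ _ →
                add! {z = first ℕ.+ 1} refl (cong₂ ℕ._+_ eb e1) (A.node≤bound (ℕ.≤-trans 1≤N (ℕ.≤-trans N≤N³ N³≤S))) $
                loadᵂ! refl refl refl $
                Runs-map (later 2 {W = W₂} {B₂}) $
                source-runs env es eZ ea (WA.root≈w {M} dirt₁ val₁ all rel mk r)
                  (blank-core (All.map RA.Static-allowed all) (All.map A.Static-local (A.Repairs.local r))
                    (λ z → trans (words-other l₂ (apply l₁ M) λ _ w → local-far (All.lookup (A.Repairs.local r) w) refl)
                             (trans (words-other l₁ M λ _ w → allowed-far (All.lookup all w) refl) (region-dirt first≤base₂)))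
                    λ z → trans (weights-other l₂ (apply l₁ M) λ _ w → local-far (All.lookup (A.Repairs.local r) w) refl)
                             (trans (weights-other l₁ M λ _ w → allowed-far (All.lookup all w) refl) (region-val first≤base₂)))
        where
        dirt₁ : ∀ z → z ℕ.< S → A.dirt M z ≡ 0
        dirt₁ z _ = region-dirt ℕ.≤-refl

        val₁ : ∀ z → z ℕ.< S → A.val M z ≡ 0#
        val₁ z _ = region-val ℕ.≤-refl

        address : Cell → ℕ
        address (wordCell a)   = a
        address (weightCell a) = a

        near : ∀ {y z} → y ℕ.< S → first ℕ.+ y ≢ base₂ ℕ.+ z
        near {y} {z} y<S eq = ℕ.<⇒≱ (ℕ.+-monoʳ-< first y<S)
          (ℕ.≤-trans (ℕ.≤-reflexive (sym (ℕ.+-assoc first N³ N³))) (ℕ.≤-trans (ℕ.m≤m+n base₂ z) (ℕ.≤-reflexive (sym eq))))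

        local-far : ∀ {x u y z} → A.Local y (write x u) → address x ≢ base₂ ℕ.+ z
        local-far (A.write-flag _ y<S) eq = near y<S eq
        local-far (A.write-node _ y<S) eq = near y<S eq

        allowed-far : ∀ {x u z} → RA.Allowed RA.∅ RA.∅ (RA.Range 0 m) (write x u) → address x ≢ base₂ ℕ.+ z
        allowed-far (RA.marks _ y<S) eq    = near y<S eq
        allowed-far (RA.leaves _ j<m) eq   = near (leaf<S j<m) eq

        blank-core : ∀ {l₁ l₂} → All Static l₁ → All Static l₂ →
                     (∀ z → B.dirt (apply l₂ (apply l₁ M)) z ≡ 0) → (∀ z → B.val (apply l₂ (apply l₁ M)) z ≡ 0#) →
                     B.Core (apply l₂ (apply l₁ M))
        blank-core {l₁} {l₂} st₁ st₂ dirt₂ val₂ = record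
          { input     = Input-apply st₂ (Input-apply st₁ input)
          ; clean     = λ z _ _ → dirt₂ z
          ; tidy      = B.blank-tidy {apply l₂ (apply l₁ M)} (λ z _ → val₂ z)
          ; closed    = λ z _ _ neg → ⊥-elim (neg (zero≤ z))
          ; done      = λ v _ neg → ⊥-elim (neg (zero≤ (N ℕ.+ v)))
          ; leaf-edge = λ j _ neg → ⊥-elim (neg (zero≤ (N ℕ.+ src j)))
          ; leaf-only = λ z _ _ pos → ⊥-elim (pos (Ord.reflexive (R.reflexive (val₂ z)))) }
          where
          zero≤ : ∀ z → 0# ≤ B.val (apply l₂ (apply l₁ M)) z
          zero≤ z = Ord.reflexive (R.reflexive (sym (val₂ z)))

      main-runs : Runs (thread 0 (λ _ → 0) (λ _ → 0#)) M (Post M (8 ℕ.+ h ℕ.* 3 ℕ.+ W₃) (8 ℕ.+ h ℕ.* 3 ℕ.+ B₃))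
      main-runs =
        const! {k = 1} refl (small 1 (s≤s z≤n)) $
        const! {k = 2} refl (small 2 (s≤s (s≤s z≤n))) $
        const! {k = 3} refl (small 3 (s≤s (s≤s (s≤s z≤n)))) $
        load! refl refl header-n $
        load! refl refl header-m $
        load! refl refl header-s $
        const! {k = 1} refl (small 1 (s≤s z≤n)) $
        Runs-map (later 7 {W = 1 ℕ.+ h ℕ.* 3 ℕ.+ W₃} {1 ℕ.+ h ℕ.* 3 ℕ.+ B₃}) $
        size-runs h refl (refl , refl , refl , refl , refl , refl , refl , refl) refl λ { (e0 , e1 , e2 , e3 , en , em , es , elo) eN →
          mul! {z = N²} refl (cong₂ ℕ._*_ eN eN) (B.≤S⇒≤bound (ℕ.≤-trans N²≤N³ N³≤S)) $
          mul! {z = N³} refl (cong (N² ℕ.*_) eN) (B.≤S⇒≤bound N³≤S) $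
          const! {k = 4} refl (small 4 ℕ.≤-refl) $
          add! {z = targets} refl (cong (4 ℕ.+_) en) (ℕ.≤-trans (ℕ.m≤m+n targets m) first≤bound) $
          add! {z = first} refl (cong (targets ℕ.+_) em) first≤bound $
          sub! {z = m} refl (cong₂ ℕ._∸_ em e0) $
          Runs-map (later 6 {W = W₃′} {B₃′}) $
          tree-runs (e0 , e1 , e2 , e3 , em , eN , refl , refl , refl , refl) es elo refl refl refl }
        where
        first≤bound : first ℕ.≤ bound
        first≤bound = ℕ.≤-trans first≤base₂ (ℕ.m≤m+n base₂ S)
        small : ∀ k → k ℕ.≤ 4 → k ℕ.≤ bound
        small k k≤4 = ℕ.≤-trans k≤4 (ℕ.≤-trans (ℕ.≤-trans (ℕ.m≤m+n 4 n) (ℕ.m≤m+n targets m)) first≤bound)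

  module Costs (Δ : Distances K G) (least : ∀ i → i ℕ.< h → 2 ^ i ℕ.< n) (n≤1+m : n ℕ.≤ suc m) (1≤m : 1 ℕ.≤ m)
               where
    open Main Δ least using (Γ; W₃; B₃; edgesWork; settleWork; edgesWork≡; settleWork≡; settleSpan; edgesSpan; repairSpan′; module B)

    private
      X : ℕ
      X = m ℕ.* h

      1≤X : 1 ℕ.≤ X
      1≤X = ℕ.*-mono-≤ 1≤m 1≤h

      h# : ∀ k → Within h k k
      h# = within-const 1≤h

      x# : ∀ k → Within X k k
      x# = within-const 1≤X

      one : ∀ {x} → Within x x 1
      one = within-one

      h≤X : Within X h 1
      h≤X = within-≤ (ℕ.≤-trans (ℕ.≤-reflexive (sym (ℕ.*-identityˡ h))) (ℕ.*-monoˡ-≤ h 1≤m)) one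

      H≤ : Within h H 4
      H≤ = h# 1 ⊕ (one ⊕ one ⊕ one)

      β≤ : Within h (13 ℕ.+ H ℕ.* 4) 29
      β≤ = h# 13 ⊕ H≤ ⊗ 4

      Γ≤ : Within h Γ 40
      Γ≤ = β≤ ⊕ h# 11

      phaseWork≤ : Within h B.phaseWork 2182
      phaseWork≤ = h# 187 ⊕ within-*ˡ 35 (Γ≤ ⊕ one ⊗ 17)

      edgesSpan≤ : Within h edgesSpan 47
      edgesSpan≤ = β≤ ⊕ (one ⊕ one) ⊗ 9

      settleSpan≤ : Within h settleSpan 58
      settleSpan≤ = h# 11 ⊕ edgesSpan≤

      repairSpan≤ : Within h repairSpan′ 69
      repairSpan≤ = h# 6 ⊕ (one ⊕ one ⊕ one) ⊗ 21

      1+m≤ : Within m (suc m) 2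
      1+m≤ = within-const 1≤m 1 ⊕ one

      edgesWork≤ : Within X edgesWork 42
      edgesWork≤ = within-≤ (ℕ.≤-reflexive edgesWork≡) (x# 2 ⊕ within-product (one {m}) Γ≤)

      settleWork≤ : Within X settleWork 80
      settleWork≤ = within-≤ (ℕ.≤-reflexive settleWork≡) (within-product 1+m≤ Γ≤)

      phasesWork≤ : Within X ((m ℕ.+ n) ℕ.* B.phaseWork) 6546
      phasesWork≤ = within-product (one ⊕ within-≤ n≤1+m 1+m≤) phaseWork≤

    work-bounded : Within (m ℕ.* h) (8 ℕ.+ h ℕ.* 3 ℕ.+ W₃) 10861
    work-bounded = x# 8 ⊕ h≤X ⊗ 3 ⊕ (x# 6 ⊕ (x# 2 ⊕ (edgesWork≤ ⊕ (x# 1 ⊕ (x# 2 ⊕ (x# 4 ⊕ edgesWork≤ ⊗ 34 ⊕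
      (x# 2 ⊕ (x# 4 ⊕ (x# 2 ⊕ (settleWork≤ ⊕ (x# 1 ⊕ (x# 2 ⊕ (x# 4 ⊕ settleWork≤ ⊗ 34 ⊕ (x# 4 ⊕ phasesWork≤))))))))))))))

    span-bounded : Within h (8 ℕ.+ h ℕ.* 3 ℕ.+ B₃) 280
    span-bounded = h# 8 ⊕ one ⊗ 3 ⊕ (h# 6 ⊕ (h# 2 ⊕ (edgesSpan≤ ⊕ (h# 1 ⊕ (h# 2 ⊕ (repairSpan≤ ⊕
      (h# 2 ⊕ (h# 4 ⊕ (h# 2 ⊕ (settleSpan≤ ⊕ (h# 1 ⊕ (h# 2 ⊕ (repairSpan≤ ⊕ h# 4)))))))))))))

    phaseSpan-bounded : Within h B.phaseSpan 150
    phaseSpan-bounded = h# 8 ⊕ (h# 5 ⊕ settleSpan≤ ⊕ one ⊗ 10) ⊕ repairSpan≤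

-- The input in memory

nth-++ˡ : ∀ {a} {A : Set a} (z : A) xs ys {i} → i ℕ.< length xs → nth z (xs ++ ys) i ≡ nth z xs i
nth-++ˡ z (x ∷ xs) ys {zero}  _        = refl
nth-++ˡ z (x ∷ xs) ys {suc i} (s≤s i<) = nth-++ˡ z xs ys i<

nth-++ʳ : ∀ {a} {A : Set a} (z : A) xs ys i → nth z (xs ++ ys) (length xs ℕ.+ i) ≡ nth z ys i
nth-++ʳ z []       ys i = refl
nth-++ʳ z (x ∷ xs) ys i = nth-++ʳ z xs ys i

nth-beyond : ∀ {a} {A : Set a} (z : A) xs {i} → length xs ℕ.≤ i → nth z xs i ≡ z
nth-beyond z []       {zero}  _       = refl
nth-beyond z []       {suc i} _       = refl
nth-beyond z (x ∷ xs) {suc i} (s≤s p) = nth-beyond z xs p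

nth-applyUpTo : ∀ {a} {A : Set a} (z : A) f n {i} → i ℕ.< n → nth z (applyUpTo f n) i ≡ f i
nth-applyUpTo z f (suc n) {zero}  _        = refl
nth-applyUpTo z f (suc n) {suc i} (s≤s i<) = nth-applyUpTo z (f ∘ suc) n i<

nth-tabulate : ∀ {a} {A : Set a} (z : A) {n} (f : Fin n → A) i → nth z (tabulate f) (toℕ i) ≡ f i
nth-tabulate z f Fin.zero    = refl
nth-tabulate z f (Fin.suc i) = nth-tabulate z (f ∘ Fin.suc) i

n≤2^⌈log₂n⌉ : ∀ n → n ℕ.≤ 2 ^ ⌈log₂ n ⌉
n≤2^⌈log₂n⌉ = <-rec _ bounded
  where
  open ℕ.≤-Reasoning
  bounded : ∀ n → (∀ {k} → k ℕ.< n → k ℕ.≤ 2 ^ ⌈log₂ k ⌉) → n ℕ.≤ 2 ^ ⌈log₂ n ⌉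
  bounded 0 rec = z≤n
  bounded 1 rec = s≤s z≤n
  bounded n@(suc (suc k)) rec = begin
    n                                          ≡⟨ ℕ.⌊n/2⌋+⌈n/2⌉≡n n ⟨
    ℕ.⌊ n /2⌋ ℕ.+ ℕ.⌈ n /2⌉                    ≤⟨ ℕ.+-monoˡ-≤ _ (ℕ.⌊n/2⌋≤⌈n/2⌉ n) ⟩
    ℕ.⌈ n /2⌉ ℕ.+ ℕ.⌈ n /2⌉                    ≤⟨ ℕ.+-mono-≤ (rec (ℕ.⌈n/2⌉<n k)) (rec (ℕ.⌈n/2⌉<n k)) ⟩
    2 ^ ⌈log₂ ℕ.⌈ n /2⌉ ⌉ ℕ.+ 2 ^ ⌈log₂ ℕ.⌈ n /2⌉ ⌉   ≡⟨ cong (λ i → 2 ^ i ℕ.+ 2 ^ i) (⌈log₂⌈n/2⌉⌉≡⌈log₂n⌉∸1 n) ⟩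
    2 ^ (⌈log₂ n ⌉ ℕ.∸ 1) ℕ.+ 2 ^ (⌈log₂ n ⌉ ℕ.∸ 1)   ≡⟨ 2^-suc (⌈log₂ n ⌉ ℕ.∸ 1) ⟨
    2 ^ suc (⌈log₂ n ⌉ ℕ.∸ 1)                  ≡⟨ cong (2 ^_) (ℕ.m+[n∸m]≡n (⌈log₂⌉-mono-≤ {2} {n} (s≤s (s≤s z≤n)))) ⟩
    2 ^ ⌈log₂ n ⌉                              ∎

2^<n : ∀ {n i} → i ℕ.< ⌈log₂ n ⌉ → 2 ^ i ℕ.< n
2^<n {n} {i} i<log = ℕ.≰⇒> λ n≤2^i →
  ℕ.<⇒≱ i<log (ℕ.≤-trans (⌈log₂⌉-mono-≤ n≤2^i) (ℕ.≤-reflexive (⌈log₂2^n⌉≡n i)))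

module FieldScaling {c ℓ₁ ℓ₂} (K : OrderedField c ℓ₁ ℓ₂) where
  open OrderedField K
  open Choice K
  open FieldOrder K
  open RingProperties R.ring using (-‿distribˡ-*; -‿involutive)

  *-monoˡ-≤ : ∀ {a b x} → 0# ≤ x → a ≤ b → a * x ≤ b * x
  *-monoˡ-≤ {a} {b} {x} 0≤x a≤b = Ord.trans (≤-+ʳ (a * x) difference) (Ord.reflexive cancel)
    where
    difference : 0# ≤ (b + (- a)) * x
    difference = *-nonNegative (Ord.trans (Ord.reflexive (R.sym (R.-‿inverseʳ a))) (+-monoˡ-≤ (- a) a≤b)) 0≤x
    cancel : (b + (- a)) * x + a * x ≈ b * x
    cancel = R.trans (R.sym (R.distribʳ x (b + (- a)) a)) (R.*-congʳ
      (R.trans (R.+-assoc b (- a) a) (R.trans (R.+-congˡ (R.-‿inverseˡ a)) (R.+-identityʳ b))))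

  0≤1 : 0# ≤ 1#
  0≤1 = [ id , (λ 1≤0 → ⊥-elim (1≉0 (Ord.antisym 1≤0 (Ord.trans (square (negative 1≤0)) (Ord.reflexive one))))) ]′ (Ord.total 0# 1#)
    where
    negative : 1# ≤ 0# → 0# ≤ - 1#
    negative 1≤0 = Ord.trans (Ord.reflexive (R.sym (R.-‿inverseʳ 1#)))
      (Ord.trans (+-monoˡ-≤ (- 1#) 1≤0) (Ord.reflexive (R.+-identityˡ (- 1#))))
    square : 0# ≤ - 1# → 0# ≤ - 1# * - 1#
    square p = *-nonNegative p p
    one : - 1# * - 1# ≈ 1#
    one = R.trans (R.sym (-‿distribˡ-* 1# (- 1#))) (R.trans (R.-‿cong (R.*-identityˡ (- 1#))) (-‿involutive 1#))

  module _ {w : Carrier} (w>0 : ¬ w ≤ 0#) where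

    w≉0 : ¬ w ≈ 0#
    w≉0 eq = w>0 (Ord.reflexive eq)

    w⁻¹≥0 : 0# ≤ w ⁻¹
    w⁻¹≥0 = [ id , (λ neg → ⊥-elim (1≉0 (Ord.antisym
      (Ord.trans (Ord.reflexive (R.sym (R.trans (R.*-comm (w ⁻¹) w) (*-inverseʳ w w≉0))))
        (Ord.trans (*-monoˡ-≤ (≰⇒≥ w>0) neg) (Ord.reflexive (R.zeroˡ w)))) 0≤1))) ]′ (Ord.total 0# (w ⁻¹))

    divide : ∀ {x y} → x * w ≤ y → x ≤ y * w ⁻¹
    divide {x} {y} le = Ord.trans (Ord.reflexive (R.sym (R.trans (R.*-assoc x w (w ⁻¹))
      (R.trans (R.*-congˡ (*-inverseʳ w w≉0)) (R.*-identityʳ x))))) (*-monoˡ-≤ w⁻¹≥0 le)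

  fromℕ-nonNegative : ∀ k → 0# ≤ fromℕ k
  fromℕ-nonNegative zero    = Ord.refl
  fromℕ-nonNegative (suc k) = Ord.trans 0≤1 (≤-+ˡ 1# (fromℕ-nonNegative k))

  fromℕ-mono : ∀ {j k} → j ℕ.≤ k → fromℕ j ≤ fromℕ k
  fromℕ-mono {k = k} z≤n   = fromℕ-nonNegative k
  fromℕ-mono (s≤s j≤k)     = +-mono-≤ Ord.refl (fromℕ-mono j≤k)

  fromℕ-+ : ∀ j k → fromℕ (j ℕ.+ k) ≈ fromℕ j + fromℕ k
  fromℕ-+ zero    k = R.sym (R.+-identityˡ _)
  fromℕ-+ (suc j) k = R.trans (R.+-congˡ (fromℕ-+ j k)) (R.sym (R.+-assoc 1# _ _))

  fromℕ-* : ∀ j k → fromℕ (j ℕ.* k) ≈ fromℕ j * fromℕ k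
  fromℕ-* zero    k = R.sym (R.zeroˡ _)
  fromℕ-* (suc j) k = R.trans (fromℕ-+ k (j ℕ.* k)) (R.trans (R.+-cong (R.sym (R.*-identityˡ _)) (fromℕ-* j k))
    (R.sym (R.distribʳ (fromℕ k) 1# (fromℕ j))))

module Instance {c ℓ₁ ℓ₂} (K : OrderedField c ℓ₁ ℓ₂) (G : Graph K) (A : AdjacencyArray G) (s : Graph.V G) (2≤∣V∣ : 2 ℕ.≤ Graph.∣V∣ G)
                (reach : ∀ v → Reachable G s v) (d : Graph.V G → OrderedField.Carrier K) (isDistance : ∀ v → IsDistance G s v (d v))
                (rank : OrderedField.Carrier K) (isRank : IsRelaxedRank G d rank) where
  open OrderedField K
  open Choice K
  open FieldOrder K
  open FieldScaling K
  open Graph G renaming (weight to weightOf)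
  open AdjacencyArray A

  private
    w D : Carrier
    D = proj₁ isRank
    w = proj₁ (proj₂ isRank)

    maximum : IsMaximum d D
    maximum = proj₁ (proj₂ (proj₂ isRank))

    minimum : IsMinimum weightOf w
    minimum = proj₁ (proj₂ (proj₂ (proj₂ isRank)))

    rank≈ : rank ≈ D * w ⁻¹
    rank≈ = proj₂ (proj₂ (proj₂ (proj₂ isRank)))

  weight>0 : ∀ e → ¬ weightOf e ≤ 0#
  weight>0 e le = proj₂ (positive e) (Ord.antisym (proj₁ (positive e)) le)

  w>0 : ¬ w ≤ 0#
  w>0 le = let (e , eq) , _ = minimum in weight>0 e (Ord.trans (Ord.reflexive eq) le)

  w≥0 : 0# ≤ w
  w≥0 = ≰⇒≥ w>0

  walk≥0 : ∀ {u v x} → Walk G u v x → 0# ≤ x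
  walk≥0 []      = Ord.refl
  walk≥0 (e ∷ p) = Ord.trans (walk≥0 p) (≤-+ʳ _ (≰⇒≥ (weight>0 e)))

  snoc : ∀ {u x} e → Walk G u (source e) x → ∃[ y ] (Walk G u (target e) y × y ≈ x + weightOf e)
  snoc e []      = _ , e ∷ [] , R.+-comm (weightOf e) 0#
  snoc e (f ∷ p) = let y , q , eq = snoc e p in _ , f ∷ q , R.trans (R.+-congˡ eq) (R.sym (R.+-assoc _ _ _))

  last-edge : ∀ {u v x} → Walk G u v x → u ≡ v ⊎ (∃[ e ] target e ≡ v)
  last-edge []      = inj₁ refl
  last-edge (e ∷ p) with last-edge p
  ... | inj₁ eq = inj₂ (e , eq)
  ... | inj₂ e′ = inj₂ e′

  trivial : ∀ {u v x} → Walk G u v x → (u ≡ v × x ≡ 0#) ⊎ w ≤ x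
  trivial []      = inj₁ (refl , refl)
  trivial (e ∷ p) = inj₂ (Ord.trans (proj₂ minimum e) (≤-+ˡ _ (walk≥0 p)))

  crossing : ∀ {p} (P : V → Set p) → (∀ v → Dec (P v)) → ∀ {u v x} → Walk G u v x → P u → ¬ P v →
             ∃[ e ] ∃[ y ] (Walk G u (source e) y × P (source e) × ¬ P (target e) ×
               ((target e ≡ v × y + weightOf e ≤ x) ⊎ y + weightOf e + w ≤ x))
  crossing P P? [] pu ¬pv = ⊥-elim (¬pv pu)
  crossing P P? (e ∷ p) pu ¬pv with P? (target e)
  ... | yes pt with crossing P P? p pt ¬pv
  ...   | f , y , q , pf , ¬pf , inj₁ (eq , le) = f , _ , e ∷ q , pf , ¬pf , inj₁ (eq ,
          Ord.trans (Ord.reflexive (R.+-assoc _ _ _)) (+-mono-≤ Ord.refl le))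
  ...   | f , y , q , pf , ¬pf , inj₂ le = f , _ , e ∷ q , pf , ¬pf , inj₂
          (Ord.trans (Ord.reflexive (R.trans (R.+-congʳ (R.+-assoc _ _ _)) (R.+-assoc _ _ _))) (+-mono-≤ Ord.refl le))
  crossing P P? (e ∷ p) pu ¬pv | no ¬pt with trivial p
  ... | inj₁ (refl , refl) = e , 0# , [] , pu , ¬pt , inj₁ (refl , Ord.reflexive (R.+-comm 0# (weightOf e)))
  ... | inj₂ w≤x = e , 0# , [] , pu , ¬pt , inj₂ (+-mono-≤ (Ord.reflexive (R.+-identityˡ _)) w≤x)

  shortest : ∀ v → ∃[ x ] (Walk G s v x × x ≈ d v)
  shortest v = proj₁ (isDistance v)

  d≤walk : ∀ {v x} → Walk G s v x → d v ≤ x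
  d≤walk {v} = proj₂ (isDistance v)

  d-nonNegative : ∀ v → 0# ≤ d v
  d-nonNegative v = let x , p , eq = shortest v in Ord.trans (walk≥0 p) (Ord.reflexive eq)

  -- The distances and edges are indexed by numbers, as in the machine's memory.
  target′ source′ : ℕ → ℕ
  target′ = nth 0 (tabulate (toℕ ∘ target ∘ edgeAt))
  source′ = nth 0 (tabulate (toℕ ∘ source ∘ edgeAt))

  weight′ d′ : ℕ → Carrier
  weight′ = nth 0# (tabulate (weightOf ∘ edgeAt))
  d′ = nth 0# (tabulate d)

  index : ∀ {n k} → k ℕ.< n → ∃[ i ] k ≡ toℕ {n} i
  index k<n = fromℕ< k<n , sym (Fin.toℕ-fromℕ< k<n)

  target≡ : ∀ i → target′ (toℕ i) ≡ toℕ (target (edgeAt i))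
  target≡ = nth-tabulate 0 _

  source≡ : ∀ i → source′ (toℕ i) ≡ toℕ (source (edgeAt i))
  source≡ = nth-tabulate 0 _

  weight≡ : ∀ i → weight′ (toℕ i) ≡ weightOf (edgeAt i)
  weight≡ = nth-tabulate 0# _

  d≡ : ∀ v → d′ (toℕ v) ≡ d v
  d≡ = nth-tabulate 0# d

  d-target : ∀ i → d′ (target′ (toℕ i)) ≡ d (target (edgeAt i))
  d-target i = trans (cong d′ (target≡ i)) (d≡ _)

  d-step : ∀ i → d′ (source′ (toℕ i)) + weight′ (toℕ i) ≡ d (source (edgeAt i)) + weightOf (edgeAt i)
  d-step i = cong₂ _+_ (trans (cong d′ (source≡ i)) (d≡ _)) (weight≡ i)

  position : ∀ e → edgeAt (edges ⟨$⟩ˡ e) ≡ e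
  position e = inverseʳ edges

  ∣E∣≤∣V∣² : ∣E∣ ℕ.≤ ∣V∣ ℕ.* ∣V∣
  ∣E∣≤∣V∣² = Fin.injective⇒≤ {f = λ e → Fin.combine (source e) (target e)} λ {e} {f} eq →
    let eq₁ , eq₂ = Fin.combine-injective (source e) (target e) (source f) (target f) eq in simple eq₁ eq₂

  ∣V∣≤1+∣E∣ : ∣V∣ ℕ.≤ suc ∣E∣
  ∣V∣≤1+∣E∣ = Fin.injective⇒≤ {f = λ v → entry (last-edge (proj₂ (reach v)))} λ {u} {v} →
    entry-injective (last-edge (proj₂ (reach u))) (last-edge (proj₂ (reach v)))
    where
    entry : ∀ {v} → s ≡ v ⊎ (∃[ e ] target e ≡ v) → Fin (suc ∣E∣)
    entry (inj₁ _)       = Fin.zero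
    entry (inj₂ (e , _)) = Fin.suc e
    entry-injective : ∀ {u v} (a : s ≡ u ⊎ (∃[ e ] target e ≡ u)) (b : s ≡ v ⊎ (∃[ e ] target e ≡ v)) → entry a ≡ entry b → u ≡ v
    entry-injective (inj₁ refl) (inj₁ refl) eq = refl
    entry-injective (inj₂ (e , refl)) (inj₂ (f , refl)) eq = cong target (Fin.suc-injective eq)

  1≤log : 1 ℕ.≤ ⌈log₂ ∣V∣ ⌉
  1≤log = ⌈log₂⌉-mono-≤ {2} 2≤∣V∣

  csr : CSR K
  csr = record
    { n = ∣V∣ ; m = ∣E∣ ; h = ⌈log₂ ∣V∣ ⌉ ; off = offset ; tgt = target′ ; src = source′ ; wt = weight′
    ; 1≤h = 1≤log
    ; n≤N = n≤2^⌈log₂n⌉ ∣V∣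
    ; m≤N² = ℕ.≤-trans ∣E∣≤∣V∣² (ℕ.*-mono-≤ (n≤2^⌈log₂n⌉ ∣V∣) (n≤2^⌈log₂n⌉ ∣V∣))
    ; tgt<n = λ j<m → let i , eq = index j<m in subst (λ j → target′ j ℕ.< ∣V∣) (sym eq) (subst (ℕ._< ∣V∣) (sym (target≡ i)) (Fin.toℕ<n _))
    ; src<n = λ j<m → let i , eq = index j<m in subst (λ j → source′ j ℕ.< ∣V∣) (sym eq) (subst (ℕ._< ∣V∣) (sym (source≡ i)) (Fin.toℕ<n _))
    ; off-mono = λ v<n → let i , eq = index v<n in subst (λ v → offset v ℕ.≤ offset (suc v)) (sym eq) (offset-monotone i)
    ; off-last = offset-last
    ; off-src = λ j<m → let i , eq = index j<m in subst (λ j → offset (source′ j) ℕ.≤ j × j ℕ.< offset (suc (source′ j))) (sym eq)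
        (subst (λ v → offset v ℕ.≤ toℕ i × toℕ i ℕ.< offset (suc v)) (sym (source≡ i)) (edgeAt-source i)) }

  distances : Distances K csr
  distances = record
    { s = toℕ s ; s<n = Fin.toℕ<n s ; d = d′ ; w = w ; D = D ; w>0 = w>0
    ; w≤wt = λ j<m → let i , eq = index j<m in subst (λ j → w ≤ weight′ j) (sym eq) (subst (w ≤_) (sym (weight≡ i)) (proj₂ minimum _))
    ; wt-min = let (e , eq) , _ = minimum
                   i = edges ⟨$⟩ˡ e
               in toℕ i , Fin.toℕ<n i , Ord.reflexive (R.trans (R.reflexive (trans (weight≡ i) (cong weightOf (position e)))) eq)
    ; d≥0 = λ v<n → let i , eq = index v<n in subst (λ v → 0# ≤ d′ v) (sym eq) (subst (0# ≤_) (sym (d≡ i)) (d-nonNegative i))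
    ; d≤D = λ v<n → let i , eq = index v<n in subst (λ v → d′ v ≤ D) (sym eq) (subst (_≤ D) (sym (d≡ i)) (proj₂ maximum i))
    ; d-source = R.trans (R.reflexive (d≡ s)) (Ord.antisym (d≤walk []) (d-nonNegative s))
    ; d-edge = λ j<m → let i , eq = index j<m in subst (λ j → d′ (target′ j) ≤ d′ (source′ j) + weight′ j) (sym eq)
        (subst₂ _≤_ (sym (d-target i)) (sym (d-step i)) (triangle (edgeAt i)))
    ; cross = cross′ }
    where
    triangle : ∀ e → d (target e) ≤ d (source e) + weightOf e
    triangle e =
      let x , p , eq = shortest (source e)
          y , q , eq′ = snoc e p
      in Ord.trans (d≤walk q) (Ord.reflexive (R.trans eq′ (R.+-congʳ eq)))
    cross′ : ∀ (P : ℕ → Set ℓ₂) → (∀ v → Dec (P v)) → P (toℕ s) → ∀ {v} → v ℕ.< ∣V∣ → ¬ P v →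
             ∃[ j ] (j ℕ.< ∣E∣ × P (source′ j) × ¬ P (target′ j) ×
               ((target′ j ≡ v × d′ (source′ j) + weight′ j ≤ d′ v) ⊎ d′ (source′ j) + weight′ j + w ≤ d′ v))
    cross′ P P? ps v<n ¬pv with index v<n
    ... | v , refl =
      let x , p , eq = shortest v
          e , y , q , pe , ¬pe , le = crossing (P ∘ toℕ) (P? ∘ toℕ) p ps ¬pv
          i = edges ⟨$⟩ˡ e
          step≤ : d′ (source′ (toℕ i)) + weight′ (toℕ i) ≤ y + weightOf e
          step≤ = subst (_≤ y + weightOf e) (sym (trans (d-step i) (cong (λ e → d (source e) + weightOf e) (position e)))) (+-monoˡ-≤ (weightOf e) (d≤walk q))
          x≤ : x ≤ d′ (toℕ v)
          x≤ = Ord.reflexive (R.trans eq (R.reflexive (sym (d≡ v))))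
          target-i = trans (target≡ i) (cong (toℕ ∘ target) (position e))
          source-i = trans (source≡ i) (cong (toℕ ∘ source) (position e))
      in toℕ i , Fin.toℕ<n i , subst P (sym source-i) pe , (λ pt → ¬pe (subst P target-i pt)) , (case le of λ where
           (inj₁ (eq′ , le′)) → inj₁ (trans target-i (cong toℕ eq′) , Ord.trans step≤ (Ord.trans le′ x≤))
           (inj₂ le′)         → inj₂ (Ord.trans (+-monoˡ-≤ w step≤) (Ord.trans le′ x≤)))

  w≤D : w ≤ D
  w≤D = let v , v≢s = other
            _ , p , eq = shortest v
            _ , _ , q , _ , _ , le = crossing (_≡ s) (Fin._≟ s) p refl v≢s
        in Ord.trans (bound q le) (Ord.trans (Ord.reflexive eq) (proj₂ maximum v))
    where
    other : ∃[ v ] v ≢ s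
    other = case Fin._≟_ (fromℕ< {0} (ℕ.<-trans (s≤s z≤n) 2≤∣V∣)) s of λ where
      (no ≢s)   → _ , ≢s
      (yes ≡s) → fromℕ< 2≤∣V∣ , λ ≡s′ → case trans (sym (Fin.toℕ-fromℕ< 2≤∣V∣)) (trans (cong toℕ (trans ≡s′ (sym ≡s))) (Fin.toℕ-fromℕ< _)) of λ ()
    bound : ∀ {e v y x} → Walk G s (source e) y → (target e ≡ v × y + weightOf e ≤ x) ⊎ y + weightOf e + w ≤ x → w ≤ x
    bound {e} q (inj₁ (_ , le)) = Ord.trans (proj₂ minimum e) (Ord.trans (≤-+ʳ (weightOf e) (walk≥0 q)) le)
    bound {e} q (inj₂ le) = Ord.trans (≤-+ʳ w (Ord.trans (walk≥0 q) (≤-+ˡ _ (≰⇒≥ (weight>0 e))))) le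

  quotient≤rank : ∀ i → fromℕ i * w ≤ D → fromℕ i ≤ rank
  quotient≤rank i le = Ord.trans (divide w>0 le) (Ord.reflexive (R.sym rank≈))

  1≤rank : 1# ≤ rank
  1≤rank = Ord.trans (divide w>0 (Ord.trans (Ord.reflexive (R.*-identityˡ w)) w≤D)) (Ord.reflexive (R.sym rank≈))

bound<2^ : ∀ {c ℓ₁ ℓ₂} {K : OrderedField c ℓ₁ ℓ₂} (G : CSR K) → CSR.bound G ℕ.< 2 ^ (6 ℕ.* CSR.h G)
bound<2^ G = begin-strict
  bound                                            ≤⟨ ℕ.+-monoˡ-≤ S (ℕ.+-monoˡ-≤ N³ (ℕ.+-monoˡ-≤ N³ (ℕ.+-mono-≤ (ℕ.+-mono-≤ 4≤N³ n≤N³) m≤N³))) ⟩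
  N³ ℕ.+ N³ ℕ.+ N³ ℕ.+ N³ ℕ.+ N³ ℕ.+ (N³ ℕ.+ N³)   ≡⟨ seven N³ ⟩
  7 ℕ.* N³                                         <⟨ ℕ.*-monoˡ-< N³ {{ℕ.>-nonZero (ℕ.≤-trans 1≤N N≤N³)}} (ℕ.n<1+n 7) ⟩
  8 ℕ.* N³                                         ≤⟨ ℕ.*-monoˡ-≤ N³ (ℕ.*-mono-≤ (ℕ.*-mono-≤ 2≤N 2≤N) 2≤N) ⟩
  N³ ℕ.* N³                                        ≡⟨ cong₂ ℕ._*_ N³≡2^ N³≡2^ ⟩
  2 ^ (h ℕ.+ h ℕ.+ h) ℕ.* 2 ^ (h ℕ.+ h ℕ.+ h)      ≡⟨ ℕ.^-distribˡ-+-* 2 (h ℕ.+ h ℕ.+ h) (h ℕ.+ h ℕ.+ h) ⟨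
  2 ^ (h ℕ.+ h ℕ.+ h ℕ.+ (h ℕ.+ h ℕ.+ h))          ≡⟨ cong (2 ^_) (six h) ⟩
  2 ^ (6 ℕ.* h)                                    ∎
  where
  open CSR G
  open ℕ.≤-Reasoning
  4≤N³ : 4 ℕ.≤ N³
  4≤N³ = ℕ.≤-trans (ℕ.*-mono-≤ 2≤N 2≤N) N²≤N³
  n≤N³ : n ℕ.≤ N³
  n≤N³ = ℕ.≤-trans n≤N N≤N³
  m≤N³ : m ℕ.≤ N³
  m≤N³ = ℕ.≤-trans m≤N² N²≤N³
  seven : ∀ x → x ℕ.+ x ℕ.+ x ℕ.+ x ℕ.+ x ℕ.+ (x ℕ.+ x) ≡ 7 ℕ.* x
  seven = solve-∀
  six : ∀ h → h ℕ.+ h ℕ.+ h ℕ.+ (h ℕ.+ h ℕ.+ h) ≡ 6 ℕ.* h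
  six = solve-∀

opaque
  workFactor spanFactor : ℕ
  workFactor = 10861
  spanFactor = 430

  workFactor≡ : workFactor ≡ 10861
  workFactor≡ = refl

  spanFactor≡ : spanFactor ≡ 280 ℕ.+ 150
  spanFactor≡ = refl

module _ {c ℓ₁ ℓ₂} (K : OrderedField c ℓ₁ ℓ₂) where
  open OrderedField K
  open Choice K
  open FieldOrder K
  open FieldScaling K

  span≤rank : ∀ {rank h s b q f} p i r → f ≡ p ℕ.+ r → Within h b p → Within h q r → s ℕ.≤ b ℕ.+ i ℕ.* q → fromℕ i ≤ rank → 1# ≤ rank →
              fromℕ s ≤ fromℕ f * (rank * fromℕ h)
  span≤rank {rank} {h} {s} p i r refl (within b≤) (within q≤) s≤ i≤ 1≤ = Ord.trans
    (fromℕ-mono (ℕ.≤-trans s≤ (ℕ.≤-trans (ℕ.+-mono-≤ b≤ (ℕ.*-monoʳ-≤ i q≤)) (ℕ.≤-reflexive (regroup p h i r)))))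
    (Ord.trans (Ord.reflexive (fromℕ-* (p ℕ.+ i ℕ.* r) h)) (Ord.trans (*-monoˡ-≤ (fromℕ-nonNegative h) coefficient)
      (Ord.reflexive (R.*-assoc _ _ _))))
    where
    regroup : ∀ p h i r → p ℕ.* h ℕ.+ i ℕ.* (r ℕ.* h) ≡ (p ℕ.+ i ℕ.* r) ℕ.* h
    regroup = solve-∀
    coefficient : fromℕ (p ℕ.+ i ℕ.* r) ≤ fromℕ (p ℕ.+ r) * rank
    coefficient = Ord.trans
      (Ord.reflexive (R.trans (fromℕ-+ p (i ℕ.* r)) (R.+-cong (R.sym (R.*-identityˡ _)) (fromℕ-* i r))))
      (Ord.trans (+-mono-≤ (*-monoˡ-≤ (fromℕ-nonNegative p) 1≤) (*-monoˡ-≤ (fromℕ-nonNegative r) i≤))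
        (Ord.reflexive (R.trans (R.sym (R.distribˡ rank (fromℕ p) (fromℕ r)))
          (R.trans (R.*-comm rank _) (R.*-congʳ (R.sym (fromℕ-+ p r)))))))

module Start {c ℓ₁ ℓ₂} (K : OrderedField c ℓ₁ ℓ₂) (G : Graph K) (A : AdjacencyArray G) (s : Graph.V G) (2≤∣V∣ : 2 ℕ.≤ Graph.∣V∣ G)
             (reach : ∀ v → Reachable G s v) (d : Graph.V G → OrderedField.Carrier K) (isDistance : ∀ v → IsDistance G s v (d v))
             (rank : OrderedField.Carrier K) (isRank : IsRelaxedRank G d rank) where
  open OrderedField K
  open Graph G using (∣V∣; ∣E∣)
  open AdjacencyArray A using (offset; edgeAt)
  open Instance K G A s 2≤∣V∣ reach d isDistance rank isRank

  bits : ℕ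
  bits = 6 ℕ.* ⌈log₂ ∣V∣ ⌉

  open Verification K bits csr (bound<2^ csr)
  open Main distances (λ i → 2^<n)

  M₀ : Memory
  M₀ = Machine.input K bits sealed G A s

  1≤∣E∣ : 1 ℕ.≤ ∣E∣
  1≤∣E∣ = ℕ.≤-pred (ℕ.≤-trans 2≤∣V∣ ∣V∣≤1+∣E∣)

  initial : Initial M₀
  initial = record
    { header-n = refl ; header-m = refl ; header-s = refl
    ; input = record
        { off-read = λ {v} v≤n → trans (nth-++ˡ 0 offsets targets′ (subst (v ℕ.<_) (sym length-offsets) (s≤s v≤n)))
                                       (nth-applyUpTo 0 offset (suc ∣V∣) (s≤s v≤n))
        ; tgt-read = λ {j} _ → trans (cong (λ k → nth 0 (offsets ++ targets′) (k ℕ.+ j)) (sym length-offsets)) (nth-++ʳ 0 offsets targets′ j)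
        ; wt-read = λ _ → refl }
    ; blankʷ = λ a first≤a → nth-beyond 0 (∣V∣ ∷ ∣E∣ ∷ toℕ s ∷ offsets ++ targets′) (ℕ.≤-trans (ℕ.≤-reflexive length-words) first≤a)
    ; blankᵂ = λ a m≤a → nth-beyond 0# _ (ℕ.≤-trans (ℕ.≤-reflexive (List.length-tabulate _)) m≤a) }
    where
    offsets targets′ : List ℕ
    offsets = applyUpTo offset (suc ∣V∣)
    targets′ = tabulate (toℕ ∘ Graph.target G ∘ edgeAt)
    length-offsets : length offsets ≡ suc ∣V∣
    length-offsets = List.length-applyUpTo offset (suc ∣V∣)
    length-words : 3 ℕ.+ length (offsets ++ targets′) ≡ first
    length-words = cong (3 ℕ.+_) (trans (List.length-++ offsets) (cong₂ ℕ._+_ length-offsets (List.length-tabulate _)))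

  open Costs distances (λ i → 2^<n) ∣V∣≤1+∣E∣ 1≤∣E∣

  execution : Machine.EveryExecution K bits sealed
                (λ span work M → (∀ v → Machine.output K bits sealed G M v ≈ d v) ×
                                 work ℕ.≤ workFactor ℕ.* (∣E∣ ℕ.* ⌈log₂ ∣V∣ ⌉) ×
                                 fromℕ span ≤ fromℕ spanFactor * (rank * fromℕ ⌈log₂ ∣V∣ ⌉))
                (Machine.start K bits sealed M₀)
  execution = conclude (main-runs initial)
    where
    conclude : Runs (thread 0 (λ _ → 0) (λ _ → 0#)) M₀ (Post M₀ (8 ℕ.+ h ℕ.* 3 ℕ.+ W₃) (8 ℕ.+ h ℕ.* 3 ℕ.+ B₃)) → _
    conclude (runs e (ends out w≤ i s≤ sp)) = everyExecution _ e λ M′ eq →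
      (λ v → subst₂ _≈_ (sym (cong (λ { (weight x) → x }) (eq (weightCell (∣E∣ ℕ.+ toℕ v))))) (d≡ v) (out (toℕ v) (Fin.toℕ<n v)))
      , ℕ.≤-trans w≤ (Within.bounded (subst (Within (∣E∣ ℕ.* ⌈log₂ ∣V∣ ⌉) _) (sym workFactor≡) work-bounded))
      , span≤rank K 280 i 150 spanFactor≡ span-bounded phaseSpan-bounded s≤ (quotient≤rank i sp) 1≤rank

theorem4p5 : ∀ {c ℓ₁ ℓ₂} (K : OrderedField c ℓ₁ ℓ₂) →
    let open OrderedField K in
    ∃[ program ] ∃[ κ ] ∃[ a ] ∃[ b ]
      ∀ (G : Graph K) (A : AdjacencyArray G) (s : Graph.V G) →
      let open Graph G
          open Machine K (κ ℕ.* ⌈log₂ ∣V∣ ⌉) program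
      in
      2 ℕ.≤ ∣V∣ →
      (∀ v → Reachable G s v) →
      ∀ (d : V → Carrier) → (∀ v → IsDistance G s v (d v)) →
      ∀ (rank : Carrier) → IsRelaxedRank G d rank →
      EveryExecution
        (λ span work M →
          (∀ v → output G M v ≈ d v) ×
          work ℕ.≤ a ℕ.* (∣E∣ ℕ.* ⌈log₂ ∣V∣ ⌉) ×
          fromℕ span ≤ fromℕ b * (rank * fromℕ ⌈log₂ ∣V∣ ⌉))
        (start (input G A s))
theorem4p5 K = sealed , 6 , workFactor , spanFactor , λ G A s 2≤∣V∣ reach d isDistance rank isRank →
  Start.execution K G A s 2≤∣V∣ reach d isDistance rank isRank
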